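{- Let $\mathcal A$ be an irreducible affine apartment of split classical type $\Phi$ and $o$ a special vertex in it. Let $\vec C$ be a Weyl chamber of $\Phi$ and $a_0$ the highest root relative to $\vec C$. Then for every vertex $x$ of $\mathcal A$ in the closure of $o+\vec C$ and every integer $r\ge 0$, $$d(x,o)\le r\iff a_0(x-o)\le r.$$
   Context: $\Phi$ is an irreducible root system of type $A_n$ ($n\ge1$), $B_n$ ($n\ge3$), $C_n$ ($n\ge2$) or $D_n$ ($n\ge4$) on the real vector space $V$ spanned by its coroots. The affine apartment of split type $\Phi$ is $\mathcal A=o+V$ decomposed into facets (a polysimplicial complex) by the walls $\{x: a(x-o)=k\}$, $a\in\Phi$, $k\in\mathbb Z$. Vertices are $0$-dimensional facets; two vertices are adjacent if they are the endpoints of an edge ($1$-dimensional facet); $d(x,y)$ is the minimal length of a sequence of consecutively adjacent vertices from $x$ to $y$ in $\mathcal A$. A vertex is special if for every $a\in\Phi$ a wall with direction $\ker a$ passes through it. The Weyl chamber $\vec C$ determines a basis $\Delta$ (the simple roots with $\vec C=\{v: a(v)>0,\ a\in\Delta\}$), and $a_0$ is the unique root whose coefficients in $\Delta$ are maximal.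
   Formalization: The apartment is formalized with rational instead of real points: vertices, facets, edges and the vector giving the Weyl chamber are taken over the rationals (all vertices of these apartments are in fact rational). -}

module Defs where

open import Data.Nat as ℕ using (ℕ; zero; suc)
open import Data.Integer as ℤ using (ℤ; +_; -[1+_])
open import Data.Rational as ℚ using (ℚ; 0ℚ; ½; _/_)
open import Data.Fin using (Fin; _≟_)
open import Data.Vec using (Vec; tabulate; zipWith; map; foldr; replicate)
open import Data.List using (List; []; _∷_)
open import Data.List.Relation.Unary.All using (All)
open import Data.Product using (Σ; ∃; ∃₂; _×_; _,_)
open import Data.Sum using (_⊎_)
open import Data.Unit using (⊤)
open import Relation.Nullary using (¬_; does)
open import Relation.Binary.PropositionalEquality using (_≡_; _≢_)
open import Function.Bundles using (_⇔_)
open import Data.Bool using (if_then_else_)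

data CType : Set where
  A B C D : CType

Valid : CType → ℕ → Set
Valid A n = 1 ℕ.≤ n
Valid B n = 3 ℕ.≤ n
Valid C n = 2 ℕ.≤ n
Valid D n = 4 ℕ.≤ n

-- dimension of the ambient coordinate space
-- (A_n lives in the sum-zero hyperplane of ℚ^(n+1); B,C,D in ℚ^n)
dim : CType → ℕ → ℕ
dim A n = suc n
dim B n = n
dim C n = n
dim D n = n

-- Integer vectors (roots, as linear forms via the dot product) and
-- rational points of the apartment (coordinates relative to the base origin)

IVec : ℕ → Set
IVec m = Vec ℤ m

Pt : ℕ → Set
Pt m = Vec ℚ m

e : ∀ {m} → Fin m → IVec m
e i = tabulate (λ j → if does (i ≟ j) then + 1 else + 0)

_+ᵢ_ : ∀ {m} → IVec m → IVec m → IVec m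
_+ᵢ_ = zipWith ℤ._+_

_·ᵢ_ : ∀ {m} → ℤ → IVec m → IVec m
k ·ᵢ a = map (k ℤ.*_) a

zeroᵢ : ∀ {m} → IVec m
zeroᵢ = replicate _ (+ 0)

sumᵢ : ∀ {m} → List (IVec m) → IVec m
sumᵢ [] = zeroᵢ
sumᵢ (a ∷ l) = a +ᵢ sumᵢ l

Sign : ℤ → Set
Sign s = (s ≡ + 1) ⊎ (s ≡ -[1+ 0 ])

Long : ∀ {m} → IVec m → Set
Long {m} a = ∃₂ λ (i j : Fin m) → i ≢ j × ∃₂ λ s t → Sign s × Sign t ×
               (a ≡ (s ·ᵢ e i) +ᵢ (t ·ᵢ e j))

IsRoot : (T : CType) (n : ℕ) → IVec (dim T n) → Set
IsRoot A n a = ∃₂ λ (i j : Fin (suc n)) → i ≢ j × (a ≡ e i +ᵢ (-[1+ 0 ] ·ᵢ e j))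
IsRoot B n a = Long a ⊎ (∃₂ λ i s → Sign s × a ≡ s ·ᵢ e i)
IsRoot C n a = Long a ⊎ (∃₂ λ i s → Sign s × a ≡ (s ℤ.* + 2) ·ᵢ e i)
IsRoot D n a = Long a

_+ₚ_ : ∀ {m} → Pt m → Pt m → Pt m
_+ₚ_ = zipWith ℚ._+_

_-ₚ_ : ∀ {m} → Pt m → Pt m → Pt m
_-ₚ_ = zipWith ℚ._-_

_·ₚ_ : ∀ {m} → ℚ → Pt m → Pt m
q ·ₚ x = map (q ℚ.*_) x

seg : ∀ {m} → Pt m → Pt m → ℚ → Pt m
seg x y t = x +ₚ (t ·ₚ (y -ₚ x))

⟪_,_⟫ : ∀ {m} → IVec m → Pt m → ℚ
⟪ a , x ⟫ = foldr _ ℚ._+_ 0ℚ (zipWith (λ k q → (k / 1) ℚ.* q) a x)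

-- points of the apartment o+V (V = span of coroots)
InV : (T : CType) (n : ℕ) → Pt (dim T n) → Set
InV A n x = foldr _ ℚ._+_ 0ℚ x ≡ 0ℚ
InV B n x = ⊤
InV C n x = ⊤
InV D n x = ⊤

SameFacet : (T : CType) (n : ℕ) → Pt (dim T n) → Pt (dim T n) → Set
SameFacet T n p q = ∀ a → IsRoot T n a → (k : ℤ) →
  ((⟪ a , p ⟫ ℚ.< k / 1) ⇔ (⟪ a , q ⟫ ℚ.< k / 1)) ×
  ((⟪ a , p ⟫ ≡ k / 1) ⇔ (⟪ a , q ⟫ ≡ k / 1))

Vertex : (T : CType) (n : ℕ) → Pt (dim T n) → Set
Vertex T n x = InV T n x × (∀ z → InV T n z → SameFacet T n x z → z ≡ x)

-- x and y are the two endpoints of an edge (1-dimensional facet):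
-- the open segment ]x,y[ lies in one facet F (that of the midpoint),
-- and F is contained in the line through x and y.
Adjacent : (T : CType) (n : ℕ) → Pt (dim T n) → Pt (dim T n) → Set
Adjacent T n x y = Vertex T n x × Vertex T n y × x ≢ y ×
  (∀ t → 0ℚ ℚ.< t → t ℚ.< + 1 / 1 → SameFacet T n (seg x y t) (seg x y ½)) ×
  (∀ z → InV T n z → SameFacet T n z (seg x y ½) → ∃ λ t → z ≡ seg x y t)

data Walk (T : CType) (n : ℕ) : Pt (dim T n) → Pt (dim T n) → ℕ → Set where
  here : ∀ {x} → Walk T n x x 0
  step : ∀ {x y z k} → Adjacent T n x y → Walk T n y z k → Walk T n x z (suc k)

Dist≤ : (T : CType) (n : ℕ) → Pt (dim T n) → Pt (dim T n) → ℕ → Set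
Dist≤ T n x y r = ∃ λ k → k ℕ.≤ r × Walk T n x y k

IsInt : ℚ → Set
IsInt q = ∃ λ (k : ℤ) → q ≡ k / 1

Special : (T : CType) (n : ℕ) → Pt (dim T n) → Set
Special T n o = Vertex T n o × (∀ a → IsRoot T n a → IsInt ⟪ a , o ⟫)

-- Weyl chambers: the chamber containing a regular vector v ∈ V

Regular : (T : CType) (n : ℕ) → Pt (dim T n) → Set
Regular T n v = InV T n v × (∀ a → IsRoot T n a → ⟪ a , v ⟫ ≢ 0ℚ)

Positive : (T : CType) (n : ℕ) → Pt (dim T n) → IVec (dim T n) → Set
Positive T n v a = IsRoot T n a × 0ℚ ℚ.< ⟪ a , v ⟫

Simple : (T : CType) (n : ℕ) → Pt (dim T n) → IVec (dim T n) → Set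
Simple T n v a = Positive T n v a ×
  ¬ (∃₂ λ b c → Positive T n v b × Positive T n v c × a ≡ b +ᵢ c)

-- a0 is a root whose Δ-coefficients dominate those of every root b:
-- a0 - b is a ℕ-combination of simple roots
Highest : (T : CType) (n : ℕ) → Pt (dim T n) → IVec (dim T n) → Set
Highest T n v a0 = IsRoot T n a0 ×
  (∀ b → IsRoot T n b → ∃ λ (l : List (IVec (dim T n))) →
     All (Simple T n v) l × a0 ≡ b +ᵢ sumᵢ l)

InClosedSector : (T : CType) (n : ℕ) → Pt (dim T n) → Pt (dim T n) → Pt (dim T n) → Set
InClosedSector T n o v x = InV T n x ×
  (∀ a → Positive T n v a → 0ℚ ℚ.≤ ⟪ a , x -ₚ o ⟫)

{-# OPTIONS --safe #-}

-- A root changes by at most 1 along an edge, as a larger change would cross a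
-- wall in the interior of the edge; hence a₀(x − o) ≤ d(x, o).
--
-- For the converse, a₀(x − o) ≤ r gives a(x − o) ≤ r for every root a, because
-- a₀ − a is a sum of simple roots and x lies in the sector.  This condition no
-- longer mentions the chamber, and one shows by induction on r that it implies
-- d(x, o) ≤ r: a vertex whose root values are at most r + 1 is, or is adjacent
-- to, a vertex whose root values are at most r.
--
-- Vertices are located by perturbation: if w / q are the coordinates of a vertex
-- relative to o, then o + (4w + η) / 4q with a small integral η lies in the same
-- facet as soon as η vanishes on the roots that are integral at o + w / q, so
-- such an η must be trivial.  In type A this makes the coordinate differences
-- integral, and the required neighbour lowers all the largest coordinates by 1.
-- In types B, C, D it puts the vertices in o + ½ℤⁿ, and the neighbour moves
-- either all half-integral or all integral coordinates by ½ towards o; in types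
-- B and D a vertex o + m eᵢ instead moves by a whole unit along eᵢ.

module Submission where

open import Defs
open import Data.Nat using (ℕ)
open import Data.Integer using (+_)
open import Data.Rational using (_≤_; _/_)
open import Function.Bundles using (_⇔_)
open import Data.Bool using (Bool; true; false; not; if_then_else_)
import Data.Bool.Properties as BoolP
open import Data.Nat as ℕ using (zero; suc)
import Data.Nat.Properties as ℕP
import Data.Nat.Divisibility as ℕ∣
open import Data.Integer as ℤ using (ℤ; -[1+_]; 0ℤ; 1ℤ; -1ℤ)
import Data.Integer.Properties as ℤP
import Data.Integer.DivMod as ℤD
open import Data.Integer.Divisibility.Signed using (_∣_; divides; _∣?_; ∣m∣n⇒∣m+n; ∣m+n∣m⇒∣n; ∣m⇒∣-m; ∣n⇒∣m*n; ∣⇒∣ᵤ; ∣ᵤ⇒∣)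
open import Data.Rational as ℚ using (ℚ; 0ℚ; 1ℚ; ½)
import Data.Rational.Properties as ℚP
import Data.Rational.Unnormalised as ℚᵘ
import Data.Rational.Unnormalised.Properties as ℚᵘP
open import Data.Fin using (Fin; zero; suc; _≟_)
open import Data.Fin.Properties using (any?)
open import Data.Vec using ([]; _∷_; lookup; tabulate; foldr)
import Data.Vec.Properties as VecP
open import Relation.Nullary.Decidable using (dec-true; dec-false; does-⇔)
open import Relation.Nullary using (¬_; yes; no; does; Dec; contradiction; ¬?; _×-dec_)
open import Relation.Binary.PropositionalEquality
open import Relation.Binary.Definitions using (tri<; tri≈; tri>)
open import Tactic.RingSolver using (solve-∀)
import Data.Integer.Tactic.RingSolver as ℤSolver
open import Data.Sum using (_⊎_; inj₁; inj₂; [_,_]′)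
open import Data.Product
open import Data.Unit using (⊤; tt)
open import Function.Bundles using (mk⇔; Equivalence)
open import Data.List using (_∷_)
open import Data.List.Relation.Unary.All using (All; []; _∷_)
open import Data.Maybe using (just; nothing)
open import Tactic.RingSolver.Core.AlmostCommutativeRing using (AlmostCommutativeRing; fromCommutativeRing)
open import Level using (0ℓ)

-- Rational arithmetic

-- The neighbour chosen in the descent may leave the sector: a coordinate equal to 0 that moves
-- always goes to +1/2, whatever the chamber. The induction therefore runs on a bound for all roots,
-- a condition that is symmetric under changes of sign. In types B and D the extreme roots involve
-- two coordinates, so the bound concerns sums of two absolute values. At o + m eᵢ with m integral,
-- moving all integral coordinates by 1/2 lowers one absolute value but raises the others from 0,
-- and the sum stays; this is what forces the unit step. In type C the roots 2eᵢ bound each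
-- coordinate separately, so half steps suffice; a unit step would not even be an edge there, since
-- 2eᵢ would change by 2. A half step ends at a point whose coordinates relative to o are all
-- integral or all half-integral. Such a point is always a vertex, even though the vertex it starts
-- from may mix both kinds.

ℚring : AlmostCommutativeRing 0ℓ 0ℓ
ℚring = fromCommutativeRing ℚP.+-*-commutativeRing isZero
  where
  isZero : ∀ x → _
  isZero x with 0ℚ ℚP.≟ x
  ... | yes p = just p
  ... | no _ = nothing

-- Opaque: unfolding k / 1 would make unification intractable.
opaque
  ι : ℤ → ℚ
  ι k = k / 1

  ι≡ : ∀ k → ι k ≡ k / 1
  ι≡ _ = refl

  toℚᵘ-ι : ∀ k → ℚ.toℚᵘ (ι k) ℚᵘ.≃ ℚᵘ.mkℚᵘ k 0
  toℚᵘ-ι k = ℚP.toℚᵘ-fromℚᵘ (ℚᵘ.mkℚᵘ k 0)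

0<1 : 0ℚ ℚ.< 1ℚ
0<1 = ℚP.positive⁻¹ 1ℚ

0<½ : 0ℚ ℚ.< ½
0<½ = ℚP.positive⁻¹ ½

ι-+ : ∀ a b → ι (a ℤ.+ b) ≡ ι a ℚ.+ ι b
ι-+ a b = ℚP.toℚᵘ-injective (begin
  ℚ.toℚᵘ (ι (a ℤ.+ b)) ≈⟨ toℚᵘ-ι (a ℤ.+ b) ⟩
  ℚᵘ.mkℚᵘ (a ℤ.+ b) 0 ≈⟨ ℚᵘ.*≡* (scale a b) ⟩
  ℚᵘ.mkℚᵘ a 0 ℚᵘ.+ ℚᵘ.mkℚᵘ b 0 ≈⟨ ℚᵘP.+-cong (toℚᵘ-ι a) (toℚᵘ-ι b) ⟨
  ℚ.toℚᵘ (ι a) ℚᵘ.+ ℚ.toℚᵘ (ι b) ≈⟨ ℚP.toℚᵘ-homo-+ (ι a) (ι b) ⟨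
  ℚ.toℚᵘ (ι a ℚ.+ ι b) ∎)
  where
  open ℚᵘP.≃-Reasoning
  scale : ∀ a b → (a ℤ.+ b) ℤ.* + 1 ≡ (a ℤ.* + 1 ℤ.+ b ℤ.* + 1) ℤ.* + 1
  scale = ℤSolver.solve-∀

ι-* : ∀ a b → ι (a ℤ.* b) ≡ ι a ℚ.* ι b
ι-* a b = ℚP.toℚᵘ-injective (begin
  ℚ.toℚᵘ (ι (a ℤ.* b)) ≈⟨ toℚᵘ-ι (a ℤ.* b) ⟩
  ℚᵘ.mkℚᵘ (a ℤ.* b) 0 ≈⟨ ℚᵘ.*≡* refl ⟩
  ℚᵘ.mkℚᵘ a 0 ℚᵘ.* ℚᵘ.mkℚᵘ b 0 ≈⟨ ℚᵘP.*-cong (toℚᵘ-ι a) (toℚᵘ-ι b) ⟨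
  ℚ.toℚᵘ (ι a) ℚᵘ.* ℚ.toℚᵘ (ι b) ≈⟨ ℚP.toℚᵘ-homo-* (ι a) (ι b) ⟨
  ℚ.toℚᵘ (ι a ℚ.* ι b) ∎)
  where open ℚᵘP.≃-Reasoning

ι-neg : ∀ a → ι (ℤ.- a) ≡ ℚ.- ι a
ι-neg a = begin
  ι (ℤ.- a) ≡⟨ sub (ι (ℤ.- a)) (ι a) ⟩
  (ι (ℤ.- a) ℚ.+ ι a) ℚ.- ι a ≡⟨ cong (ℚ._- ι a) (ι-+ (ℤ.- a) a) ⟨
  ι (ℤ.- a ℤ.+ a) ℚ.- ι a ≡⟨ cong (ℚ._- ι a) (trans (cong ι (ℤP.+-inverseˡ a)) (ι≡ 0ℤ)) ⟩
  0ℚ ℚ.- ι a ≡⟨ ℚP.+-identityˡ _ ⟩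
  ℚ.- ι a ∎
  where
  open ≡-Reasoning
  sub : ∀ x y → x ≡ (x ℚ.+ y) ℚ.- y
  sub = solve-∀ ℚring

ι-- : ∀ a b → ι (a ℤ.- b) ≡ ι a ℚ.- ι b
ι-- a b = trans (ι-+ a (ℤ.- b)) (cong (ι a ℚ.+_) (ι-neg b))

ι-mono-< : ∀ {a b} → a ℤ.< b → ι a ℚ.< ι b
ι-mono-< {a} {b} a<b = ℚP.toℚᵘ-cancel-<
  (ℚᵘP.<-respˡ-≃ (ℚᵘP.≃-sym (toℚᵘ-ι a)) (ℚᵘP.<-respʳ-≃ (ℚᵘP.≃-sym (toℚᵘ-ι b))
    (ℚᵘ.*<* (subst₂ ℤ._<_ (sym (ℤP.*-identityʳ a)) (sym (ℤP.*-identityʳ b)) a<b))))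

ι-mono-≤ : ∀ {a b} → a ℤ.≤ b → ι a ℚ.≤ ι b
ι-mono-≤ {a} {b} a≤b with a ℤ.≟ b
... | yes refl = ℚP.≤-refl
... | no a≢b = ℚP.<⇒≤ (ι-mono-< (ℤP.≤∧≢⇒< a≤b a≢b))

ι-cancel-≤ : ∀ {a b} → ι a ℚ.≤ ι b → a ℤ.≤ b
ι-cancel-≤ {a} {b} le with a ℤ.≤? b
... | yes p = p
... | no ¬p = contradiction (ℚP.<-≤-trans (ι-mono-< (ℤP.≰⇒> ¬p)) le) (ℚP.<-irrefl refl)

ι-cancel-< : ∀ {a b} → ι a ℚ.< ι b → a ℤ.< b
ι-cancel-< {a} {b} lt with a ℤ.<? b
... | yes p = p
... | no ¬p = contradiction (ℚP.<-≤-trans lt (ι-mono-≤ (ℤP.≮⇒≥ ¬p))) (ℚP.<-irrefl refl)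

ι-injective : ∀ {a b} → ι a ≡ ι b → a ≡ b
ι-injective eq = ℤP.≤-antisym (ι-cancel-≤ (ℚP.≤-reflexive eq)) (ι-cancel-≤ (ℚP.≤-reflexive (sym eq)))

0<ι : ∀ {q} → 0ℤ ℤ.< q → 0ℚ ℚ.< ι q
0<ι {q} 0<q = subst (ℚ._< ι q) (ι≡ 0ℤ) (ι-mono-< 0<q)

ι-pos : ∀ {q} → 0ℤ ℤ.< q → ℚ.Positive (ι q)
ι-pos 0<q = ℚ.positive (0<ι 0<q)

x≡y⇒x-y≡0 : ∀ {x y : ℚ} → x ≡ y → x ℚ.- y ≡ 0ℚ
x≡y⇒x-y≡0 {x} refl = ℚP.+-inverseʳ x

x-y≡0⇒x≡y : ∀ {x y : ℚ} → x ℚ.- y ≡ 0ℚ → x ≡ y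
x-y≡0⇒x≡y {x} {y} eq = trans (sub x y) (trans (cong (ℚ._+ y) eq) (ℚP.+-identityˡ y))
  where
  sub : ∀ x y → x ≡ (x ℚ.- y) ℚ.+ y
  sub = solve-∀ ℚring

0<y-x : ∀ {x y : ℚ} → x ℚ.< y → 0ℚ ℚ.< y ℚ.- x
0<y-x {x} {y} x<y = subst (ℚ._< y ℚ.- x) (ℚP.+-inverseʳ x) (ℚP.+-monoˡ-< (ℚ.- x) x<y)

0≤y-x : ∀ {x y : ℚ} → x ℚ.≤ y → 0ℚ ℚ.≤ y ℚ.- x
0≤y-x {x} {y} x≤y = subst (ℚ._≤ y ℚ.- x) (ℚP.+-inverseʳ x) (ℚP.+-monoˡ-≤ (ℚ.- x) x≤y)

x<y-if : ∀ {x y : ℚ} → 0ℚ ℚ.< y ℚ.- x → x ℚ.< y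
x<y-if {x} {y} lt = subst₂ ℚ._<_ (ℚP.+-identityˡ x) (sub y x) (ℚP.+-monoˡ-< x lt)
  where
  sub : ∀ y x → (y ℚ.- x) ℚ.+ x ≡ y
  sub = solve-∀ ℚring

x≤y-if : ∀ {x y : ℚ} → 0ℚ ℚ.≤ y ℚ.- x → x ℚ.≤ y
x≤y-if {x} {y} lt = subst₂ ℚ._≤_ (ℚP.+-identityˡ x) (sub y x) (ℚP.+-monoˡ-≤ x lt)
  where
  sub : ∀ y x → (y ℚ.- x) ℚ.+ x ≡ y
  sub = solve-∀ ℚring

0<x*y : ∀ {x y : ℚ} → 0ℚ ℚ.< x → 0ℚ ℚ.< y → 0ℚ ℚ.< x ℚ.* y
0<x*y {x} {y} 0<x 0<y = subst (ℚ._< x ℚ.* y) (ℚP.*-zeroʳ x)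
  (ℚP.*-monoʳ-<-pos x {{ℚ.positive 0<x}} 0<y)

0≤x*y : ∀ {x y : ℚ} → 0ℚ ℚ.< x → 0ℚ ℚ.≤ y → 0ℚ ℚ.≤ x ℚ.* y
0≤x*y {x} {y} 0<x 0≤y = subst (ℚ._≤ x ℚ.* y) (ℚP.*-zeroʳ x)
  (ℚP.*-monoˡ-≤-nonNeg x {{ℚ.nonNegative (ℚP.<⇒≤ 0<x)}} 0≤y)

*-cancelˡ-pos : ∀ {c x y : ℚ} → 0ℚ ℚ.< c → c ℚ.* x ≡ c ℚ.* y → x ≡ y
*-cancelˡ-pos {c} 0<c eq = ℚP.≤-antisym
  (ℚP.*-cancelˡ-≤-pos c {{ℚ.positive 0<c}} (ℚP.≤-reflexive eq))
  (ℚP.*-cancelˡ-≤-pos c {{ℚ.positive 0<c}} (ℚP.≤-reflexive (sym eq)))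

-- α = K + P / q, cleared of denominators
module Scaled {q K P : ℤ} {α : ℚ} (0<q : 0ℤ ℤ.< q) (α≡ : ι q ℚ.* (α ℚ.- ι K) ≡ ι P) where

  private
    instance
      qpos : ℚ.Positive (ι q)
      qpos = ι-pos 0<q

    ι-lattice : ∀ k → ι q ℚ.* (ι k ℚ.- ι K) ≡ ι (q ℤ.* (k ℤ.- K))
    ι-lattice k = trans (cong (ι q ℚ.*_) (sym (ι-- k K))) (sym (ι-* q (k ℤ.- K)))

    to : (R : ℚ → ℚ → Set) → (∀ {x y z} → R x y → R (x ℚ.+ z) (y ℚ.+ z)) →
         (∀ {x y} → R x y → R (ι q ℚ.* x) (ι q ℚ.* y)) →
         ∀ k → R α (ι k) → R (ι P) (ι (q ℤ.* (k ℤ.- K)))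
    to R add mul k r = subst₂ R α≡ (ι-lattice k) (mul (add r))

  ≤⇒ : ∀ k → α ℚ.≤ ι k → P ℤ.≤ q ℤ.* (k ℤ.- K)
  ≤⇒ k r = ι-cancel-≤ (to ℚ._≤_ (ℚP.+-monoˡ-≤ _) (ℚP.*-monoˡ-≤-nonNeg (ι q) {{ℚ.nonNegative (ℚP.<⇒≤ (0<ι 0<q))}}) k r)

  <⇒ : ∀ k → α ℚ.< ι k → P ℤ.< q ℤ.* (k ℤ.- K)
  <⇒ k r = ι-cancel-< (to ℚ._<_ (ℚP.+-monoˡ-< _) (ℚP.*-monoʳ-<-pos (ι q)) k r)

  ≡⇒ : ∀ k → α ≡ ι k → P ≡ q ℤ.* (k ℤ.- K)
  ≡⇒ k r = ι-injective (to _≡_ (cong (ℚ._+ _)) (cong (ι q ℚ.*_)) k r)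

  >⇒ : ∀ k → ι k ℚ.< α → q ℤ.* (k ℤ.- K) ℤ.< P
  >⇒ k r = ι-cancel-< (to (λ x y → y ℚ.< x) (ℚP.+-monoˡ-< _) (ℚP.*-monoʳ-<-pos (ι q)) k r)

  ⇒≤ : ∀ k → P ℤ.≤ q ℤ.* (k ℤ.- K) → α ℚ.≤ ι k
  ⇒≤ k r with ℚP.<-cmp α (ι k)
  ... | tri< lt _ _ = ℚP.<⇒≤ lt
  ... | tri≈ _ eq _ = ℚP.≤-reflexive eq
  ... | tri> _ _ gt = contradiction (ℤP.<-≤-trans (>⇒ k gt) r) (ℤP.<-irrefl refl)

  ⇒≥ : ∀ k → q ℤ.* (k ℤ.- K) ℤ.≤ P → ι k ℚ.≤ α
  ⇒≥ k r with ℚP.<-cmp α (ι k)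
  ... | tri< lt _ _ = contradiction (ℤP.<-≤-trans (<⇒ k lt) r) (ℤP.<-irrefl refl)
  ... | tri≈ _ eq _ = ℚP.≤-reflexive (sym eq)
  ... | tri> _ _ gt = ℚP.<⇒≤ gt

  ⇒≡ : ∀ k → P ≡ q ℤ.* (k ℤ.- K) → α ≡ ι k
  ⇒≡ k r = ℚP.≤-antisym (⇒≤ k (ℤP.≤-reflexive r)) (⇒≥ k (ℤP.≤-reflexive (sym r)))

  ⇒< : ∀ k → P ℤ.< q ℤ.* (k ℤ.- K) → α ℚ.< ι k
  ⇒< k r with ℚP.<-cmp α (ι k)
  ... | tri< lt _ _ = lt
  ... | tri≈ _ eq _ = contradiction r (ℤP.<-irrefl (≡⇒ k eq))
  ... | tri> _ _ gt = contradiction (ℤP.<-trans (>⇒ k gt) r) (ℤP.<-irrefl refl)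

module Between {α β κ : ℚ} where

  at : ℚ → ℚ
  at t = α ℚ.+ t ℚ.* (β ℚ.- α)

  private
    gap : ∀ t α β κ → κ ℚ.- (α ℚ.+ t ℚ.* (β ℚ.- α)) ≡ (1ℚ ℚ.- t) ℚ.* (κ ℚ.- α) ℚ.+ t ℚ.* (κ ℚ.- β)
    gap = solve-∀ ℚring

    gap′ : ∀ t α β κ → (α ℚ.+ t ℚ.* (β ℚ.- α)) ℚ.- κ ≡ (1ℚ ℚ.- t) ℚ.* (α ℚ.- κ) ℚ.+ t ℚ.* (β ℚ.- κ)
    gap′ = solve-∀ ℚring

    fixed : ∀ t κ → κ ℚ.+ t ℚ.* (κ ℚ.- κ) ≡ κ
    fixed = solve-∀ ℚring

  -- If one end lies strictly below `κ`, so does every proper convex combination, which gives that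
  -- end positive weight; otherwise both ends equal `κ`. Thus an open segment with its ends weakly
  -- on one side of a wall has a constant position relative to that wall.
  below : α ℚ.≤ κ → β ℚ.≤ κ → (α ≡ κ × β ≡ κ × (∀ t → at t ≡ κ)) ⊎ (∀ t → 0ℚ ℚ.< t → t ℚ.< 1ℚ → at t ℚ.< κ)
  below α≤κ β≤κ with ℚP.<-cmp α κ | ℚP.<-cmp β κ
  ... | tri> _ _ gt | _ = contradiction (ℚP.<-≤-trans gt α≤κ) (ℚP.<-irrefl refl)
  ... | tri< α<κ _ _ | _ = inj₂ λ t 0<t t<1 → x<y-if (subst (0ℚ ℚ.<_) (sym (gap t α β κ))
      (ℚP.+-mono-<-≤ (0<x*y (0<y-x t<1) (0<y-x α<κ)) (0≤x*y 0<t (0≤y-x β≤κ))))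
  ... | tri≈ _ _ _ | tri> _ _ gt = contradiction (ℚP.<-≤-trans gt β≤κ) (ℚP.<-irrefl refl)
  ... | tri≈ _ _ _ | tri< β<κ _ _ = inj₂ λ t 0<t t<1 → x<y-if (subst (0ℚ ℚ.<_) (sym (gap t α β κ))
      (ℚP.+-mono-≤-< (0≤x*y (0<y-x t<1) (0≤y-x α≤κ)) (0<x*y 0<t (0<y-x β<κ))))
  ... | tri≈ _ refl _ | tri≈ _ refl _ = inj₁ (refl , refl , λ t → fixed t κ)

  above : κ ℚ.≤ α → κ ℚ.≤ β → (α ≡ κ × β ≡ κ × (∀ t → at t ≡ κ)) ⊎ (∀ t → 0ℚ ℚ.< t → t ℚ.< 1ℚ → κ ℚ.< at t)
  above κ≤α κ≤β with ℚP.<-cmp α κ | ℚP.<-cmp β κ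
  ... | tri< lt _ _ | _ = contradiction (ℚP.<-≤-trans lt κ≤α) (ℚP.<-irrefl refl)
  ... | tri> _ _ κ<α | _ = inj₂ λ t 0<t t<1 → x<y-if (subst (0ℚ ℚ.<_) (sym (gap′ t α β κ))
      (ℚP.+-mono-<-≤ (0<x*y (0<y-x t<1) (0<y-x κ<α)) (0≤x*y 0<t (0≤y-x κ≤β))))
  ... | tri≈ _ _ _ | tri< lt _ _ = contradiction (ℚP.<-≤-trans lt κ≤β) (ℚP.<-irrefl refl)
  ... | tri≈ _ _ _ | tri> _ _ κ<β = inj₂ λ t 0<t t<1 → x<y-if (subst (0ℚ ℚ.<_) (sym (gap′ t α β κ))
      (ℚP.+-mono-≤-< (0≤x*y (0<y-x t<1) (0≤y-x κ≤α)) (0<x*y 0<t (0<y-x κ<β))))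
  ... | tri≈ _ refl _ | tri≈ _ refl _ = inj₁ (refl , refl , λ t → fixed t κ)

-- Common denominators and integer parts

0<* : ∀ {a b} → 0ℤ ℤ.< a → 0ℤ ℤ.< b → 0ℤ ℤ.< a ℤ.* b
0<* {a} {b} 0<a 0<b = subst (ℤ._< a ℤ.* b) (ℤP.*-zeroʳ a) (ℤP.*-monoˡ-<-pos a {{ℤ.positive 0<a}} 0<b)

fraction : ∀ β → ∃₂ λ q P → 0ℤ ℤ.< q × ι q ℚ.* β ≡ ι P
fraction β = ℚ.↧ β , ℚ.↥ β , ℤ.+<+ ℕ.z<s , ℚP.toℚᵘ-injective (begin
  ℚ.toℚᵘ (ι (ℚ.↧ β) ℚ.* β) ≈⟨ ℚP.toℚᵘ-homo-* (ι (ℚ.↧ β)) β ⟩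
  ℚ.toℚᵘ (ι (ℚ.↧ β)) ℚᵘ.* ℚ.toℚᵘ β ≈⟨ ℚᵘP.*-congʳ (toℚᵘ-ι (ℚ.↧ β)) ⟩
  ℚᵘ.mkℚᵘ (ℚ.↧ β) 0 ℚᵘ.* ℚ.toℚᵘ β ≈⟨ clear β ⟩
  ℚᵘ.mkℚᵘ (ℚ.↥ β) 0 ≈⟨ toℚᵘ-ι (ℚ.↥ β) ⟨
  ℚ.toℚᵘ (ι (ℚ.↥ β)) ∎)
  where
  open ℚᵘP.≃-Reasoning
  cross : ∀ d n → (d ℤ.* n) ℤ.* + 1 ≡ n ℤ.* (+ 1 ℤ.* d)
  cross = ℤSolver.solve-∀
  clear : ∀ β → ℚᵘ.mkℚᵘ (ℚ.↧ β) 0 ℚᵘ.* ℚ.toℚᵘ β ℚᵘ.≃ ℚᵘ.mkℚᵘ (ℚ.↥ β) 0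
  clear (ℚ.mkℚ n d _) = ℚᵘ.*≡* (cross (+ suc d) n)

common-denominator : ∀ {m} (u : Fin m → ℚ) → ∃₂ λ q (p : Fin m → ℤ) → 0ℤ ℤ.< q × ∀ i → ι q ℚ.* u i ≡ ι (p i)
common-denominator {zero} u = 1ℤ , (λ ()) , ℤ.+<+ ℕ.z<s , λ ()
common-denominator {suc m} u with fraction (u zero) | common-denominator (λ i → u (suc i))
... | q , P , 0<q , eq | q′ , p , 0<q′ , eqs =
  q ℤ.* q′ , (λ { zero → q′ ℤ.* P ; (suc i) → q ℤ.* p i }) , 0<* 0<q 0<q′ ,
  λ { zero → head-eq ; (suc i) → tail-eq i }
  where
  open ≡-Reasoning
  left : ∀ a b c → (a ℚ.* b) ℚ.* c ≡ b ℚ.* (a ℚ.* c)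
  left = solve-∀ ℚring
  head-eq = begin
    ι (q ℤ.* q′) ℚ.* u zero ≡⟨ cong (ℚ._* u zero) (ι-* q q′) ⟩
    (ι q ℚ.* ι q′) ℚ.* u zero ≡⟨ left (ι q) (ι q′) (u zero) ⟩
    ι q′ ℚ.* (ι q ℚ.* u zero) ≡⟨ cong (ι q′ ℚ.*_) eq ⟩
    ι q′ ℚ.* ι P ≡⟨ ι-* q′ P ⟨
    ι (q′ ℤ.* P) ∎
  tail-eq = λ i → begin
    ι (q ℤ.* q′) ℚ.* u (suc i) ≡⟨ cong (ℚ._* u (suc i)) (ι-* q q′) ⟩
    (ι q ℚ.* ι q′) ℚ.* u (suc i) ≡⟨ ℚP.*-assoc (ι q) (ι q′) (u (suc i)) ⟩
    ι q ℚ.* (ι q′ ℚ.* u (suc i)) ≡⟨ cong (ι q ℚ.*_) (eqs i) ⟩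
    ι q ℚ.* ι (p i) ≡⟨ ι-* q (p i) ⟨
    ι (q ℤ.* p i) ∎

integer-above : ∀ β → ∃ λ k → β ℚ.< ι k × ι k ℚ.≤ β ℚ.+ 1ℚ
integer-above β with fraction β
-- The integer is 1 plus the floor of `β`; `c` is the quotient of the numerator by the denominator.
... | q , P , 0<q , eq = 1ℤ ℤ.+ c , S.⇒< (1ℤ ℤ.+ c) below ,
  subst (ℚ._≤ β ℚ.+ 1ℚ) (trans (ℚP.+-comm (ι c) 1ℚ) (trans (cong (ℚ._+ ι c) (sym (ι≡ 1ℤ))) (sym (ι-+ 1ℤ c)))) (ℚP.+-monoˡ-≤ 1ℚ (S.⇒≥ c above))
  where
  instance
    q≢0 : ℤ.NonZero q
    q≢0 = ℤ.>-nonZero 0<q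
  c = P ℤD./ q
  r = P ℤD.% q
  P≡ : P ≡ + r ℤ.+ c ℤ.* q
  P≡ = ℤD.a≡a%n+[a/n]*n P q
  r<q : + r ℤ.< q
  r<q = subst (+ r ℤ.<_) (ℤP.0≤i⇒+∣i∣≡i (ℤP.<⇒≤ 0<q)) (ℤ.+<+ (ℤD.n%d<d P q))
  minus0 : ∀ x → x ℚ.- 0ℚ ≡ x
  minus0 = solve-∀ ℚring
  module S = Scaled {q} {0ℤ} {P} {β} 0<q (trans (cong (ι q ℚ.*_) (trans (cong (λ z → β ℚ.- z) (ι≡ 0ℤ)) (minus0 β))) eq)
  e₁ : ∀ q c → q ℤ.+ c ℤ.* q ≡ q ℤ.* ((1ℤ ℤ.+ c) ℤ.- 0ℤ)
  e₁ = ℤSolver.solve-∀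
  e₂ : ∀ q c → 0ℤ ℤ.+ c ℤ.* q ≡ q ℤ.* (c ℤ.- 0ℤ)
  e₂ = ℤSolver.solve-∀
  below : P ℤ.< q ℤ.* ((1ℤ ℤ.+ c) ℤ.- 0ℤ)
  below = subst₂ ℤ._<_ (sym P≡) (e₁ q c) (ℤP.+-monoˡ-< (c ℤ.* q) r<q)
  above : q ℤ.* (c ℤ.- 0ℤ) ℤ.≤ P
  above = subst₂ ℤ._≤_ (e₂ q c) (sym P≡) (ℤP.+-monoˡ-≤ (c ℤ.* q) (ℤ.+≤+ ℕ.z≤n))

-- Roots as linear forms

-- Every root of types A, B, C, D acts as x ↦ s xᵢ + t xⱼ with s, t ∈ {0, ±1};
-- i = j is allowed.
record Form (m : ℕ) : Set where
  constructor form
  field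
    s : ℤ
    i : Fin m
    t : ℤ
    j : Fin m

evℤ : ∀ {m} → Form m → (Fin m → ℤ) → ℤ
evℤ (form s i t j) p = s ℤ.* p i ℤ.+ t ℤ.* p j

evℚ : ∀ {m} → Form m → (Fin m → ℚ) → ℚ
evℚ (form s i t j) x = ι s ℚ.* x i ℚ.+ ι t ℚ.* x j

val : ∀ {m} → Form m → Pt m → ℚ
val φ x = evℚ φ (lookup x)

evℚ-- : ∀ {m} (φ : Form m) x y → evℚ φ (λ i → x i ℚ.- y i) ≡ evℚ φ x ℚ.- evℚ φ y
evℚ-- (form s i t j) x y = lin (ι s) (ι t) (x i) (x j) (y i) (y j)
  where
  lin : ∀ s t a b c d → s ℚ.* (a ℚ.- c) ℚ.+ t ℚ.* (b ℚ.- d) ≡ (s ℚ.* a ℚ.+ t ℚ.* b) ℚ.- (s ℚ.* c ℚ.+ t ℚ.* d)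
  lin = solve-∀ ℚring

evℤ-+ : ∀ {m} (φ : Form m) p r → evℤ φ (λ i → p i ℤ.+ r i) ≡ evℤ φ p ℤ.+ evℤ φ r
evℤ-+ (form s i t j) p r = lin s t (p i) (p j) (r i) (r j)
  where
  lin : ∀ s t a b c d → s ℤ.* (a ℤ.+ c) ℤ.+ t ℤ.* (b ℤ.+ d) ≡ (s ℤ.* a ℤ.+ t ℤ.* b) ℤ.+ (s ℤ.* c ℤ.+ t ℤ.* d)
  lin = ℤSolver.solve-∀

evℤ-* : ∀ {m} (φ : Form m) c p → evℤ φ (λ i → c ℤ.* p i) ≡ c ℤ.* evℤ φ p
evℤ-* (form s i t j) c p = lin s t c (p i) (p j)
  where
  lin : ∀ s t c a b → s ℤ.* (c ℤ.* a) ℤ.+ t ℤ.* (c ℤ.* b) ≡ c ℤ.* (s ℤ.* a ℤ.+ t ℤ.* b)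
  lin = ℤSolver.solve-∀

ι-evℤ : ∀ {m} (φ : Form m) p → ι (evℤ φ p) ≡ evℚ φ (λ i → ι (p i))
ι-evℤ (form s i t j) p = trans (ι-+ (s ℤ.* p i) (t ℤ.* p j)) (cong₂ ℚ._+_ (ι-* s (p i)) (ι-* t (p j)))

evℚ-* : ∀ {m} (φ : Form m) c x → evℚ φ (λ i → c ℚ.* x i) ≡ c ℚ.* evℚ φ x
evℚ-* (form s i t j) c x = lin (ι s) (ι t) c (x i) (x j)
  where
  lin : ∀ s t c a b → s ℚ.* (c ℚ.* a) ℚ.+ t ℚ.* (c ℚ.* b) ≡ c ℚ.* (s ℚ.* a ℚ.+ t ℚ.* b)
  lin = solve-∀ ℚring

evℚ-cong : ∀ {m} (φ : Form m) {x y} → (∀ i → x i ≡ y i) → evℚ φ x ≡ evℚ φ y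
evℚ-cong (form s i t j) eq = cong₂ (λ a b → ι s ℚ.* a ℚ.+ ι t ℚ.* b) (eq i) (eq j)

lookup-seg : ∀ {m} (x y : Pt m) t i → lookup (seg x y t) i ≡ lookup x i ℚ.+ t ℚ.* (lookup y i ℚ.- lookup x i)
lookup-seg x y t i = trans (VecP.lookup-zipWith ℚ._+_ i x (t ·ₚ (y -ₚ x))) (cong (lookup x i ℚ.+_)
  (trans (VecP.lookup-map i (t ℚ.*_) (y -ₚ x)) (cong (t ℚ.*_) (VecP.lookup-zipWith ℚ._-_ i y x))))

val-seg : ∀ {m} (φ : Form m) x y t → val φ (seg x y t) ≡ val φ x ℚ.+ t ℚ.* (val φ y ℚ.- val φ x)
val-seg φ@(form s i t j) x y r = trans (evℚ-cong φ (lookup-seg x y r)) (lin (ι s) (ι t) r (lookup x i) (lookup x j) (lookup y i) (lookup y j))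
  where
  lin : ∀ s t r a b c d → s ℚ.* (a ℚ.+ r ℚ.* (c ℚ.- a)) ℚ.+ t ℚ.* (b ℚ.+ r ℚ.* (d ℚ.- b))
    ≡ (s ℚ.* a ℚ.+ t ℚ.* b) ℚ.+ r ℚ.* ((s ℚ.* c ℚ.+ t ℚ.* d) ℚ.- (s ℚ.* a ℚ.+ t ℚ.* b))
  lin = solve-∀ ℚring

val-- : ∀ {m} (φ : Form m) x y → val φ (x -ₚ y) ≡ val φ x ℚ.- val φ y
val-- φ x y = trans (evℚ-cong φ (λ i → VecP.lookup-zipWith ℚ._-_ i x y)) (evℚ-- φ (lookup x) (lookup y))

SameSide : ℚ → ℚ → ℚ → Set
SameSide κ α β = (α ℚ.< κ ⇔ β ℚ.< κ) × (α ≡ κ ⇔ β ≡ κ)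

-- Below, on and above are exhaustive and exclude one another, so the three forward implications
-- already yield the converses.
sameSide : ∀ {κ α β} → (α ℚ.< κ → β ℚ.< κ) → (α ≡ κ → β ≡ κ) → (κ ℚ.< α → κ ℚ.< β) → SameSide κ α β
sameSide {κ} {α} {β} f g h = mk⇔ f f⁻¹ , mk⇔ g g⁻¹
  where
  f⁻¹ : β ℚ.< κ → α ℚ.< κ
  f⁻¹ β<κ with ℚP.<-cmp α κ
  ... | tri< α<κ _ _ = α<κ
  ... | tri≈ _ α≡κ _ = contradiction β<κ (ℚP.<-irrefl (g α≡κ))
  ... | tri> _ _ κ<α = contradiction β<κ (ℚP.<-asym (h κ<α))
  g⁻¹ : β ≡ κ → α ≡ κ
  g⁻¹ β≡κ with ℚP.<-cmp α κ
  ... | tri< α<κ _ _ = contradiction (f α<κ) (ℚP.<-irrefl β≡κ)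
  ... | tri≈ _ α≡κ _ = α≡κ
  ... | tri> _ _ κ<α = contradiction (h κ<α) (ℚP.<-irrefl (sym β≡κ))

∣i∣≤n⇒bounds : ∀ {i n} → ℤ.∣ i ∣ ℕ.≤ n → ℤ.- (+ n) ℤ.≤ i × i ℤ.≤ + n
∣i∣≤n⇒bounds {+ a} {n} le = ℤP.≤-trans (ℤP.neg-mono-≤ (ℤ.+≤+ ℕ.z≤n)) (ℤ.+≤+ ℕ.z≤n) , ℤ.+≤+ le
∣i∣≤n⇒bounds { -[1+ a ]} {suc n} (ℕ.s≤s le) = ℤ.-≤- le , ℤ.-≤+

-- P and P + H stand for q times the values of a root at the ends of an edge.
no-crossing : ∀ {q P H} k → 0ℤ ℤ.< q → (ℤ.∣ H ∣ ℕ.≤ 1) ⊎ (q ∣ P × + ℤ.∣ H ∣ ℤ.≤ q) →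
  (P ℤ.≤ q ℤ.* k × P ℤ.+ H ℤ.≤ q ℤ.* k) ⊎ (q ℤ.* k ℤ.≤ P × q ℤ.* k ℤ.≤ P ℤ.+ H)
no-crossing {q} {P} {H} k 0<q h with ℤP.<-cmp P (q ℤ.* k)
no-crossing {q} {P} {H} k 0<q h | tri≈ _ refl _ with ℤP.≤-total H 0ℤ
... | inj₁ H≤0 = inj₁ (ℤP.≤-refl , subst (P ℤ.+ H ℤ.≤_) (ℤP.+-identityʳ P) (ℤP.+-monoʳ-≤ P H≤0))
... | inj₂ 0≤H = inj₂ (ℤP.≤-refl , subst (ℤ._≤ P ℤ.+ H) (ℤP.+-identityʳ P) (ℤP.+-monoʳ-≤ P 0≤H))
no-crossing {q} {P} {H} k 0<q (inj₁ h) | tri< P<N _ _ = inj₁ (ℤP.<⇒≤ P<N ,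
  ℤP.≤-trans (subst (P ℤ.+ H ℤ.≤_) (ℤP.+-comm P 1ℤ) (ℤP.+-monoʳ-≤ P (proj₂ (∣i∣≤n⇒bounds h)))) (ℤP.i<j⇒suc[i]≤j P<N))
no-crossing {q} {P} {H} k 0<q (inj₁ h) | tri> _ _ N<P = inj₂ (ℤP.<⇒≤ N<P ,
  ℤP.≤-trans (ℤP.i<j⇒i≤pred[j] N<P) (subst (ℤ._≤ P ℤ.+ H) (ℤP.+-comm P (ℤ.- 1ℤ)) (ℤP.+-monoʳ-≤ P (proj₁ (∣i∣≤n⇒bounds h)))))
-- The root is integral at the first end, so the next wall is at least a full `q` away, and `H`
-- cannot carry the value beyond it.
no-crossing {q} {P} {H} k 0<q (inj₂ (divides c refl , h)) | tri< P<N _ _ = inj₁ (ℤP.<⇒≤ P<N , (begin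
  c ℤ.* q ℤ.+ H ≤⟨ ℤP.+-monoʳ-≤ (c ℤ.* q) (ℤP.≤-trans (proj₂ (∣i∣≤n⇒bounds {H} ℕP.≤-refl)) h) ⟩
  c ℤ.* q ℤ.+ q ≡⟨ lin c q ⟩
  q ℤ.* (1ℤ ℤ.+ c) ≤⟨ ℤP.*-monoˡ-≤-nonNeg q {{ℤ.nonNegative (ℤP.<⇒≤ 0<q)}} (ℤP.i<j⇒suc[i]≤j c<k) ⟩
  q ℤ.* k ∎))
  where
  open ℤP.≤-Reasoning
  lin : ∀ c q → c ℤ.* q ℤ.+ q ≡ q ℤ.* (1ℤ ℤ.+ c)
  lin = ℤSolver.solve-∀
  c<k : c ℤ.< k
  c<k = ℤP.*-cancelˡ-<-nonNeg q {{ℤ.nonNegative (ℤP.<⇒≤ 0<q)}} (subst (ℤ._< q ℤ.* k) (ℤP.*-comm c q) P<N)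
no-crossing {q} {P} {H} k 0<q (inj₂ (divides c refl , h)) | tri> _ _ N<P = inj₂ (ℤP.<⇒≤ N<P , (begin
  q ℤ.* k ≤⟨ ℤP.*-monoˡ-≤-nonNeg q {{ℤ.nonNegative (ℤP.<⇒≤ 0<q)}} (ℤP.i<j⇒i≤pred[j] k<c) ⟩
  q ℤ.* (ℤ.- 1ℤ ℤ.+ c) ≡⟨ lin c q ⟩
  c ℤ.* q ℤ.+ ℤ.- q ≤⟨ ℤP.+-monoʳ-≤ (c ℤ.* q) (ℤP.≤-trans (ℤP.neg-mono-≤ h) (proj₁ (∣i∣≤n⇒bounds {H} ℕP.≤-refl))) ⟩
  c ℤ.* q ℤ.+ H ∎))
  where
  open ℤP.≤-Reasoning
  lin : ∀ c q → q ℤ.* (ℤ.- 1ℤ ℤ.+ c) ≡ c ℤ.* q ℤ.+ ℤ.- q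
  lin = ℤSolver.solve-∀
  k<c : k ℤ.< c
  k<c = ℤP.*-cancelˡ-<-nonNeg q {{ℤ.nonNegative (ℤP.<⇒≤ 0<q)}} (subst (q ℤ.* k ℤ.<_) (ℤP.*-comm c q) N<P)

-- Distinct integers differ by at least 1, so scaling by 4 opens a gap of 4, which absorbs any
-- perturbation of size at most 2. Hence the 4 in `rigid`; the 2 comes from two coordinates
-- perturbed by at most 1 each.
4*-+-mono-< : ∀ {P N H} → ℤ.∣ H ∣ ℕ.≤ 2 → P ℤ.< N → + 4 ℤ.* P ℤ.+ H ℤ.< + 4 ℤ.* N
4*-+-mono-< {P} {N} {H} h P<N = begin-strict
  + 4 ℤ.* P ℤ.+ H ≤⟨ ℤP.+-monoʳ-≤ (+ 4 ℤ.* P) (proj₂ (∣i∣≤n⇒bounds h)) ⟩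
  + 4 ℤ.* P ℤ.+ + 2 <⟨ ℤP.+-monoʳ-< (+ 4 ℤ.* P) (ℤ.+<+ (ℕ.s≤s (ℕ.s≤s (ℕ.s≤s ℕ.z≤n)))) ⟩
  + 4 ℤ.* P ℤ.+ + 4 ≡⟨ lin P ⟩
  + 4 ℤ.* (1ℤ ℤ.+ P) ≤⟨ ℤP.*-monoˡ-≤-nonNeg (+ 4) (ℤP.i<j⇒suc[i]≤j P<N) ⟩
  + 4 ℤ.* N ∎
  where
  open ℤP.≤-Reasoning
  lin : ∀ P → + 4 ℤ.* P ℤ.+ + 4 ≡ + 4 ℤ.* (1ℤ ℤ.+ P)
  lin = ℤSolver.solve-∀

4*-+-mono-> : ∀ {P N H} → ℤ.∣ H ∣ ℕ.≤ 2 → N ℤ.< P → + 4 ℤ.* N ℤ.< + 4 ℤ.* P ℤ.+ H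
4*-+-mono-> {P} {N} {H} h N<P = begin-strict
  + 4 ℤ.* N ≤⟨ ℤP.*-monoˡ-≤-nonNeg (+ 4) (ℤP.i<j⇒i≤pred[j] N<P) ⟩
  + 4 ℤ.* (ℤ.- 1ℤ ℤ.+ P) ≡⟨ lin P ⟩
  + 4 ℤ.* P ℤ.+ ℤ.- (+ 4) <⟨ ℤP.+-monoʳ-< (+ 4 ℤ.* P) (ℤ.-<- (ℕ.s≤s (ℕ.s≤s ℕ.z≤n))) ⟩
  + 4 ℤ.* P ℤ.+ ℤ.- (+ 2) ≤⟨ ℤP.+-monoʳ-≤ (+ 4 ℤ.* P) (proj₁ (∣i∣≤n⇒bounds h)) ⟩
  + 4 ℤ.* P ℤ.+ H ∎
  where
  open ℤP.≤-Reasoning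
  lin : ∀ P → + 4 ℤ.* (ℤ.- 1ℤ ℤ.+ P) ≡ + 4 ℤ.* P ℤ.+ ℤ.- (+ 4)
  lin = ℤSolver.solve-∀

-- Facets, vertices and edges cut out by linear forms

SameFacetᶠ : ∀ {m} → (Form m → Set) → Pt m → Pt m → Set
SameFacetᶠ F x y = ∀ φ → F φ → ∀ k → SameSide (ι k) (val φ x) (val φ y)

module _ {m : ℕ} (F : Form m → Set) (V : Pt m → Set) where

  Vertexᶠ : Pt m → Set
  Vertexᶠ x = V x × (∀ z → V z → SameFacetᶠ F x z → z ≡ x)

  Adjacentᶠ : Pt m → Pt m → Set
  Adjacentᶠ x y = Vertexᶠ x × Vertexᶠ y × x ≢ y ×
    (∀ t → 0ℚ ℚ.< t → t ℚ.< 1ℚ → SameFacetᶠ F (seg x y t) (seg x y ½)) ×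
    (∀ z → V z → SameFacetᶠ F z (seg x y ½) → ∃ λ t → z ≡ seg x y t)

-- x = o + w / q as far as the forms in F can tell; in type A, where points have
-- coordinate sum 0, this fixes w up to a constant vector.
Rep : ∀ {m} (F : Form m → Set) (o : Pt m) (q : ℤ) (w : Fin m → ℤ) (x : Pt m) → Set
Rep F o q w x = ∀ φ → F φ → ι q ℚ.* (val φ x ℚ.- val φ o) ≡ ι (evℤ φ w)

-- Some integer exceeds `β` by at most 1, and it stays strictly below `α` because the drop is larger
-- than 1. Strictness at both ends puts the parameter (α - k) / (α - β) strictly between 0 and 1.
crosses-integer : ∀ {α β} → 1ℚ ℚ.< α ℚ.- β → ∃₂ λ k t → 0ℚ ℚ.< t × t ℚ.< 1ℚ × α ℚ.+ t ℚ.* (β ℚ.- α) ≡ ι k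
crosses-integer {α} {β} 1<α-β with integer-above β
... | k , β<k , k≤β+1 = k , (α ℚ.- ι k) ℚ.* inv , 0<x*y (0<y-x k<α) 0<inv ,
  x<y-if (subst (0ℚ ℚ.<_) (trans (split α β (ι k) inv) (cong (ℚ._- (α ℚ.- ι k) ℚ.* inv) (ℚP.*-inverseʳ (α ℚ.- β))))
    (0<x*y (0<y-x β<k) 0<inv)) ,
  trans (at α β (ι k) inv) (trans (cong (λ v → α ℚ.- (α ℚ.- ι k) ℚ.* v) (ℚP.*-inverseʳ (α ℚ.- β))) (rest α (ι k)))
  where
  instance
    δ-pos : ℚ.Positive (α ℚ.- β)
    δ-pos = ℚ.positive (ℚP.<-trans 0<1 1<α-β)
    δ≢0 : ℚ.NonZero (α ℚ.- β)
    δ≢0 = ℚP.pos⇒nonZero (α ℚ.- β)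
  inv = ℚ.1/ (α ℚ.- β)
  0<inv : 0ℚ ℚ.< inv
  0<inv = ℚP.positive⁻¹ inv {{ℚP.1/pos⇒pos (α ℚ.- β)}}
  back : ∀ α β → β ℚ.+ (α ℚ.- β) ≡ α
  back = solve-∀ ℚring
  k<α : ι k ℚ.< α
  k<α = ℚP.≤-<-trans k≤β+1 (subst (β ℚ.+ 1ℚ ℚ.<_) (back α β) (ℚP.+-monoʳ-< β 1<α-β))
  split : ∀ α β κ v → (κ ℚ.- β) ℚ.* v ≡ (α ℚ.- β) ℚ.* v ℚ.- (α ℚ.- κ) ℚ.* v
  split = solve-∀ ℚring
  at : ∀ α β κ v → α ℚ.+ (α ℚ.- κ) ℚ.* v ℚ.* (β ℚ.- α) ≡ α ℚ.- (α ℚ.- κ) ℚ.* ((α ℚ.- β) ℚ.* v)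
  at = solve-∀ ℚring
  rest : ∀ α κ → α ℚ.- (α ℚ.- κ) ℚ.* 1ℚ ≡ κ
  rest = solve-∀ ℚring

halve : ∀ {t} → 0ℚ ℚ.< t → t ℚ.< 1ℚ → ∃ λ t′ → 0ℚ ℚ.< t′ × t′ ℚ.< 1ℚ × t′ ℚ.+ t′ ≡ t
halve {t} 0<t t<1 = ½ ℚ.* t , 0<t′ , ℚP.<-trans (subst₂ ℚ._<_ (ℚP.+-identityˡ (½ ℚ.* t)) t≡ (ℚP.+-monoˡ-< (½ ℚ.* t) 0<t′)) t<1 , t≡
  where
  half : ∀ h t → h ℚ.* t ℚ.+ h ℚ.* t ≡ (h ℚ.+ h) ℚ.* t
  half = solve-∀ ℚring
  t≡ : ½ ℚ.* t ℚ.+ ½ ℚ.* t ≡ t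
  t≡ = trans (half ½ t) (ℚP.*-identityˡ t)
  0<t′ : 0ℚ ℚ.< ½ ℚ.* t
  0<t′ = 0<x*y 0<½ 0<t

-- Meeting a wall inside the edge is not yet absurd, since an edge may lie in a wall. But all points
-- of the open edge have the same position relative to that wall, so the root would take one value
-- at two interior points, against its nonzero slope.
adjacent-val-≤1 : ∀ {m} {F : Form m → Set} {V : Pt m → Set} {x y φ} → Adjacentᶠ F V x y → F φ → val φ x ℚ.- val φ y ℚ.≤ 1ℚ
adjacent-val-≤1 {F = F} {V} {x} {y} {φ} (_ , _ , _ , same , _) Fφ = ℚP.≮⇒≥ λ 1<δ → no-jump 1<δ (crosses-integer {α} {β} 1<δ)
  where
  α = val φ x
  β = val φ y
  gap : ∀ α β t → t ℚ.* (α ℚ.- β) ≡ (α ℚ.+ t ℚ.* (β ℚ.- α)) ℚ.- (α ℚ.+ (t ℚ.+ t) ℚ.* (β ℚ.- α))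
  gap = solve-∀ ℚring
  -- crossing the integer k at t, the value would still be k at t / 2
  stays : ∀ {k t t′} → α ℚ.+ t ℚ.* (β ℚ.- α) ≡ ι k → 0ℚ ℚ.< t → t ℚ.< 1ℚ → 0ℚ ℚ.< t′ → t′ ℚ.< 1ℚ → α ℚ.+ t′ ℚ.* (β ℚ.- α) ≡ ι k
  stays {k} {t} {t′} at 0<t t<1 0<t′ t′<1 = trans (sym (val-seg φ x y t′)) (Equivalence.from (proj₂ (same t′ 0<t′ t′<1 φ Fφ k))
    (Equivalence.to (proj₂ (same t 0<t t<1 φ Fφ k)) (trans (val-seg φ x y t) at)))
  no-jump : 1ℚ ℚ.< α ℚ.- β → ¬ (∃₂ λ k t → 0ℚ ℚ.< t × t ℚ.< 1ℚ × α ℚ.+ t ℚ.* (β ℚ.- α) ≡ ι k)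
  no-jump 1<δ (k , t , 0<t , t<1 , at) = ℚP.<-irrefl (sym still) (0<x*y {t′} {α ℚ.- β} 0<t′ (ℚP.<-trans 0<1 1<δ))
    where
    halved = halve 0<t t<1
    t′ = proj₁ halved
    0<t′ = proj₁ (proj₂ halved)
    t′<1 = proj₁ (proj₂ (proj₂ halved))
    t≡ = proj₂ (proj₂ (proj₂ halved))
    still : t′ ℚ.* (α ℚ.- β) ≡ 0ℚ
    still = begin
      t′ ℚ.* (α ℚ.- β) ≡⟨ gap α β t′ ⟩
      (α ℚ.+ t′ ℚ.* (β ℚ.- α)) ℚ.- (α ℚ.+ (t′ ℚ.+ t′) ℚ.* (β ℚ.- α))
        ≡⟨ cong₂ (λ a b → a ℚ.- (α ℚ.+ b ℚ.* (β ℚ.- α))) (stays at 0<t t<1 0<t′ t′<1) t≡ ⟩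
      ι k ℚ.- (α ℚ.+ t ℚ.* (β ℚ.- α)) ≡⟨ cong (λ a → ι k ℚ.- a) at ⟩
      ι k ℚ.- ι k ≡⟨ ℚP.+-inverseʳ (ι k) ⟩
      0ℚ ∎
      where open ≡-Reasoning

-- The induction step, with all roots in place of the highest one.
Descends : ∀ {m} (F : Form m → Set) (V : Pt m → Set) (o : Pt m) → Set
Descends F V o = ∀ r {x} → Vertexᶠ F V x → (∀ φ → F φ → val φ x ℚ.- val φ o ℚ.≤ ι (+ suc r)) →
  ∃ λ y → Vertexᶠ F V y × (x ≡ y ⊎ Adjacentᶠ F V x y) × (∀ φ → F φ → val φ y ℚ.- val φ o ℚ.≤ ι (+ r))

-- What type A shares with the other types: the forms separate the points of `V`, are integral at
-- `o`, and every rational displacement is realised in `V` as far as the forms can see it.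
-- Integrality at `o` turns walls through o + w / q into divisibility by `q`.
module Apartment {m} (F : Form m → Set) (V : Pt m → Set)
  (V-seg : ∀ {x y} t → V x → V y → V (seg x y t))
  (separated : ∀ {x y} → V x → V y → (∀ φ → F φ → val φ x ≡ val φ y) → x ≡ y)
  (o : Pt m) (o-lattice : ∀ φ → F φ → ∃ λ K → val φ o ≡ ι K)
  (realise : ∀ q w → 0ℤ ℤ.< q → ∃ λ z → V z × Rep F o q w z)
  where

  private
    over : ∀ {q w x φ} (Fφ : F φ) → Rep F o q w x → ι q ℚ.* (val φ x ℚ.- ι (proj₁ (o-lattice φ Fφ))) ≡ ι (evℤ φ w)
    over {q} {w} {x} {φ} Fφ rep = trans (cong (λ v → ι q ℚ.* (val φ x ℚ.- v)) (sym (proj₂ (o-lattice φ Fφ)))) (rep φ Fφ)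

    integral : ∀ {q w x φ} → 0ℤ ℤ.< q → F φ → Rep F o q w x → q ∣ evℤ φ w → ∃ λ k → val φ x ≡ ι k
    integral {q} {w} {x} {φ} 0<q Fφ rep (divides c eq) = c ℤ.+ K ,
      Scaled.⇒≡ {q} {K} {evℤ φ w} {val φ x} 0<q (over {q} {w} {x} Fφ rep) (c ℤ.+ K) (trans eq (lin c q K))
      where
      K = proj₁ (o-lattice φ Fφ)
      lin : ∀ c q K → c ℤ.* q ≡ q ℤ.* ((c ℤ.+ K) ℤ.- K)
      lin = ℤSolver.solve-∀

  -- The point o + (4w + η) / 4q lies in the facet of o + w / q.
  rigid : ∀ {q w x η} → 0ℤ ℤ.< q → Rep F o q w x → Vertexᶠ F V x →
    (∀ φ → F φ → ℤ.∣ evℤ φ η ∣ ℕ.≤ 2) → (∀ φ → F φ → q ∣ evℤ φ w → evℤ φ η ≡ 0ℤ) →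
    ∀ φ → F φ → evℤ φ η ≡ 0ℤ
  rigid {q} {w} {x} {η} 0<q rep (Vx , unique) small vanish = conclude
    where
    w′ : Fin m → ℤ
    w′ i = + 4 ℤ.* w i ℤ.+ η i
    realised = realise (+ 4 ℤ.* q) w′ (0<* {+ 4} (ℤ.+<+ ℕ.z<s) 0<q)
    z = proj₁ realised
    Vz = proj₁ (proj₂ realised)
    rep′ = proj₂ (proj₂ realised)
    ev : ∀ φ → evℤ φ w′ ≡ + 4 ℤ.* evℤ φ w ℤ.+ evℤ φ η
    ev φ = trans (evℤ-+ φ (λ i → + 4 ℤ.* w i) η) (cong (ℤ._+ evℤ φ η) (evℤ-* φ (+ 4) w))
    same : SameFacetᶠ F x z
    same φ Fφ k = sameSide
      (λ lt → Z.⇒< k (subst₂ ℤ._<_ (sym (ev φ)) scale (4*-+-mono-< (small φ Fφ) (X.<⇒ k lt))))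
      (λ eq → Z.⇒≡ k (trans (ev φ) (trans (on-wall (X.≡⇒ k eq)) scale)))
      λ gt → ℚP.≰⇒> λ le → ℤP.<-irrefl refl (ℤP.<-≤-trans
        (subst₂ ℤ._<_ scale (sym (ev φ)) (4*-+-mono-> (small φ Fφ) (X.>⇒ k gt))) (Z.≤⇒ k le))
      where
      K = proj₁ (o-lattice φ Fφ)
      N = q ℤ.* (k ℤ.- K)
      module X = Scaled {q} {K} {evℤ φ w} {val φ x} 0<q (over {q} {w} {x} Fφ rep)
      module Z = Scaled {+ 4 ℤ.* q} {K} {evℤ φ w′} {val φ z} (0<* {+ 4} (ℤ.+<+ ℕ.z<s) 0<q) (over {+ 4 ℤ.* q} {w′} {z} Fφ rep′)
      scale : + 4 ℤ.* N ≡ (+ 4 ℤ.* q) ℤ.* (k ℤ.- K)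
      scale = sym (ℤP.*-assoc (+ 4) q (k ℤ.- K))
      on-wall : evℤ φ w ≡ N → + 4 ℤ.* evℤ φ w ℤ.+ evℤ φ η ≡ + 4 ℤ.* N
      on-wall eq = trans (cong₂ (λ a b → + 4 ℤ.* a ℤ.+ b) eq (vanish φ Fφ (divides (k ℤ.- K) (trans eq (ℤP.*-comm q (k ℤ.- K))))))
        (ℤP.+-identityʳ (+ 4 ℤ.* N))
    conclude : ∀ φ → F φ → evℤ φ η ≡ 0ℤ
    conclude φ Fφ = cancel (ι-injective (begin
      ι (+ 4 ℤ.* evℤ φ w ℤ.+ evℤ φ η) ≡⟨ cong ι (ev φ) ⟨
      ι (evℤ φ w′) ≡⟨ rep′ φ Fφ ⟨
      ι (+ 4 ℤ.* q) ℚ.* (val φ z ℚ.- val φ o) ≡⟨ cong₂ (λ a b → a ℚ.* (val φ b ℚ.- val φ o)) (ι-* (+ 4) q) (unique z Vz same) ⟩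
      (ι (+ 4) ℚ.* ι q) ℚ.* (val φ x ℚ.- val φ o) ≡⟨ ℚP.*-assoc (ι (+ 4)) (ι q) _ ⟩
      ι (+ 4) ℚ.* (ι q ℚ.* (val φ x ℚ.- val φ o)) ≡⟨ cong (ι (+ 4) ℚ.*_) (rep φ Fφ) ⟩
      ι (+ 4) ℚ.* ι (evℤ φ w) ≡⟨ ι-* (+ 4) (evℤ φ w) ⟨
      ι (+ 4 ℤ.* evℤ φ w) ∎))
      where
      open ≡-Reasoning
      drop : ∀ a b → b ≡ (a ℤ.+ b) ℤ.- a
      drop = ℤSolver.solve-∀
      cancel : ∀ {a b} → a ℤ.+ b ≡ a → b ≡ 0ℤ
      cancel {a} {b} eq = trans (drop a b) (trans (cong (ℤ._- a) eq) (ℤP.+-inverseʳ a))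

  -- A root that is integral at `x` has a wall through `x`, so it takes the same value at any `z` in
  -- the facet of `x`. By `spans` the vanishing of these roots on z - x propagates to all roots.
  vertexᶠ : ∀ {q w x} → 0ℤ ℤ.< q → V x → Rep F o q w x →
    (∀ d → (∀ φ → F φ → q ∣ evℤ φ w → evℚ φ d ≡ 0ℚ) → ∀ φ → F φ → evℚ φ d ≡ 0ℚ) → Vertexᶠ F V x
  vertexᶠ {q} {w} {x} 0<q Vx rep spans = Vx , λ z Vz same → separated Vz Vx λ φ Fφ →
    x-y≡0⇒x≡y (trans (sym (evℚ-- φ (lookup z) (lookup x))) (spans (λ i → lookup z i ℚ.- lookup x i) (fixed z same) φ Fφ))
    where
    fixed : ∀ z → SameFacetᶠ F x z → ∀ φ → F φ → q ∣ evℤ φ w → evℚ φ (λ i → lookup z i ℚ.- lookup x i) ≡ 0ℚ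
    fixed z same φ Fφ q∣ = let (k , eq) = integral {q} {w} {x} 0<q Fφ rep q∣ in trans (evℚ-- φ (lookup z) (lookup x))
      (x≡y⇒x-y≡0 (trans (Equivalence.to (proj₂ (same φ Fφ k)) eq) (sym eq)))

  -- `short` keeps walls from cutting the open segment: a change by 1 cannot jump over a multiple of
  -- `q`, and a root integral at `x` may change by a full `q`. The last hypothesis makes the facet
  -- one-dimensional: the roots constant along the segment with a wall through it have only
  -- multiples of `ε` as common zeros, as far as `F` can tell.
  adjacentᶠ : ∀ {q w ε x y} → 0ℤ ℤ.< q → Rep F o q w x → Rep F o q (λ i → w i ℤ.+ ε i) y →
    Vertexᶠ F V x → Vertexᶠ F V y →
    (∃ λ φ → F φ × evℤ φ ε ≢ 0ℤ) →
    (∀ φ → F φ → (ℤ.∣ evℤ φ ε ∣ ℕ.≤ 1) ⊎ (q ∣ evℤ φ w × + ℤ.∣ evℤ φ ε ∣ ℤ.≤ q)) →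
    (∀ d → (∀ φ → F φ → evℤ φ ε ≡ 0ℤ → q ∣ evℤ φ w → evℚ φ d ≡ 0ℚ) →
      ∃ λ τ → ∀ φ → F φ → evℚ φ d ≡ τ ℚ.* ι (evℤ φ ε)) →
    Adjacentᶠ F V x y
  adjacentᶠ {q} {w} {ε} {x} {y} 0<q rep rep′ vx vy (ψ , Fψ , ε≢0) short line =
    vx , vy , x≢y , same , on-line
    where
    Δ : ∀ φ → F φ → ι q ℚ.* (val φ y ℚ.- val φ x) ≡ ι (evℤ φ ε)
    Δ φ Fφ = begin
      ι q ℚ.* (val φ y ℚ.- val φ x) ≡⟨ tele (ι q) (val φ y) (val φ x) (val φ o) ⟩
      ι q ℚ.* (val φ y ℚ.- val φ o) ℚ.- ι q ℚ.* (val φ x ℚ.- val φ o) ≡⟨ cong₂ ℚ._-_ (rep′ φ Fφ) (rep φ Fφ) ⟩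
      ι (evℤ φ (λ i → w i ℤ.+ ε i)) ℚ.- ι (evℤ φ w) ≡⟨ ι-- _ (evℤ φ w) ⟨
      ι (evℤ φ (λ i → w i ℤ.+ ε i) ℤ.- evℤ φ w) ≡⟨ cong ι (trans (cong (ℤ._- evℤ φ w) (evℤ-+ φ w ε)) (drop (evℤ φ w) (evℤ φ ε))) ⟩
      ι (evℤ φ ε) ∎
      where
      open ≡-Reasoning
      tele : ∀ q a b c → q ℚ.* (a ℚ.- b) ≡ q ℚ.* (a ℚ.- c) ℚ.- q ℚ.* (b ℚ.- c)
      tele = solve-∀ ℚring
      drop : ∀ a b → (a ℤ.+ b) ℤ.- a ≡ b
      drop = ℤSolver.solve-∀
    x≢y : x ≢ y
    x≢y refl = ε≢0 (ι-injective (trans (sym (Δ ψ Fψ)) (trans (cong (ι q ℚ.*_) (ℚP.+-inverseʳ (val ψ x))) (trans (ℚP.*-zeroʳ (ι q)) (sym (ι≡ 0ℤ))))))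
    same : ∀ t → 0ℚ ℚ.< t → t ℚ.< 1ℚ → SameFacetᶠ F (seg x y t) (seg x y ½)
    same t 0<t t<1 φ Fφ k = subst₂ (SameSide (ι k)) (sym (val-seg φ x y t)) (sym (val-seg φ x y ½))
      (sides (no-crossing {q} {evℤ φ w} {evℤ φ ε} (k ℤ.- K) 0<q (short φ Fφ)))
      where
      K = proj₁ (o-lattice φ Fφ)
      ½<1 : ½ ℚ.< 1ℚ
      ½<1 = ℚP.≰⇒> λ { (ℚ.*≤* (ℤ.+≤+ (ℕ.s≤s ()))) }
      module X = Scaled {q} {K} {evℤ φ w} {val φ x} 0<q (over {q} {w} {x} Fφ rep)
      module Y = Scaled {q} {K} {evℤ φ w ℤ.+ evℤ φ ε} {val φ y} 0<q (trans (over {q} {λ i → w i ℤ.+ ε i} {y} Fφ rep′) (cong ι (evℤ-+ φ w ε)))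
      module B = Between {val φ x} {val φ y} {ι k}
      constant : (∀ s → B.at s ≡ ι k) → SameSide (ι k) (B.at t) (B.at ½)
      constant all = sameSide (λ lt → contradiction lt (ℚP.<-irrefl (all t))) (λ _ → all ½) (λ gt → contradiction gt (ℚP.<-irrefl (sym (all t))))
      sides : (evℤ φ w ℤ.≤ q ℤ.* (k ℤ.- K) × evℤ φ w ℤ.+ evℤ φ ε ℤ.≤ q ℤ.* (k ℤ.- K)) ⊎
        (q ℤ.* (k ℤ.- K) ℤ.≤ evℤ φ w × q ℤ.* (k ℤ.- K) ℤ.≤ evℤ φ w ℤ.+ evℤ φ ε) → SameSide (ι k) (B.at t) (B.at ½)
      sides (inj₁ (p , r)) = [ (λ c → constant (proj₂ (proj₂ c))) , (λ all → sameSide (λ _ → all ½ 0<½ ½<1)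
          (λ eq → contradiction (all t 0<t t<1) (ℚP.<-irrefl eq)) (λ gt → contradiction gt (ℚP.<-asym (all t 0<t t<1)))) ]′
        (B.below (X.⇒≤ k p) (Y.⇒≤ k r))
      sides (inj₂ (p , r)) = [ (λ c → constant (proj₂ (proj₂ c))) , (λ all → sameSide (λ lt → contradiction lt (ℚP.<-asym (all t 0<t t<1)))
          (λ eq → contradiction (all t 0<t t<1) (ℚP.<-irrefl (sym eq))) (λ _ → all ½ 0<½ ½<1)) ]′
        (B.above (X.⇒≥ k p) (Y.⇒≥ k r))
    on-line : ∀ z → V z → SameFacetᶠ F z (seg x y ½) → ∃ λ t → z ≡ seg x y t
    -- `τ` measures z - x in units of `ε`, while y - x is ε / q; hence the factor `q`.
    on-line z Vz facet = τ ℚ.* ι q , separated Vz (V-seg (τ ℚ.* ι q) (proj₁ vx) (proj₁ vy)) λ φ Fφ → begin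
        val φ z ≡⟨ back (val φ z) (val φ x) ⟩
        val φ x ℚ.+ (val φ z ℚ.- val φ x) ≡⟨ cong (val φ x ℚ.+_) (trans (sym (evℚ-- φ (lookup z) (lookup x))) (eqs φ Fφ)) ⟩
        val φ x ℚ.+ τ ℚ.* ι (evℤ φ ε) ≡⟨ cong (λ v → val φ x ℚ.+ τ ℚ.* v) (Δ φ Fφ) ⟨
        val φ x ℚ.+ τ ℚ.* (ι q ℚ.* (val φ y ℚ.- val φ x)) ≡⟨ cong (val φ x ℚ.+_) (ℚP.*-assoc τ (ι q) _) ⟨
        val φ x ℚ.+ (τ ℚ.* ι q) ℚ.* (val φ y ℚ.- val φ x) ≡⟨ val-seg φ x y (τ ℚ.* ι q) ⟨
        val φ (seg x y (τ ℚ.* ι q)) ∎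
      where
      open ≡-Reasoning
      back : ∀ a b → a ≡ b ℚ.+ (a ℚ.- b)
      back = solve-∀ ℚring
      fixed : ∀ φ → F φ → evℤ φ ε ≡ 0ℤ → q ∣ evℤ φ w → evℚ φ (λ i → lookup z i ℚ.- lookup x i) ≡ 0ℚ
      fixed φ Fφ ε≡0 q∣ = trans (evℚ-- φ (lookup z) (lookup x)) (x≡y⇒x-y≡0 (trans (Equivalence.from (proj₂ (facet φ Fφ k)) mid) (sym eq)))
        where
        k = proj₁ (integral {q} {w} {x} 0<q Fφ rep q∣)
        eq = proj₂ (integral {q} {w} {x} 0<q Fφ rep q∣)
        y-x≡0 : val φ y ℚ.- val φ x ≡ 0ℚ
        y-x≡0 = *-cancelˡ-pos (0<ι 0<q) (trans (Δ φ Fφ) (trans (trans (cong ι ε≡0) (ι≡ 0ℤ)) (sym (ℚP.*-zeroʳ (ι q)))))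
        mid : val φ (seg x y ½) ≡ ι k
        mid = trans (val-seg φ x y ½) (trans (cong (λ v → val φ x ℚ.+ ½ ℚ.* v) y-x≡0)
          (trans (cong (val φ x ℚ.+_) (ℚP.*-zeroʳ ½)) (trans (ℚP.+-identityʳ _) eq)))
      τ = proj₁ (line (λ i → lookup z i ℚ.- lookup x i) fixed)
      eqs = proj₂ (line (λ i → lookup z i ℚ.- lookup x i) fixed)

  bound⇒ev : ∀ {q w x r φ} → 0ℤ ℤ.< q → Rep F o q w x → F φ → val φ x ℚ.- val φ o ℚ.≤ ι r → evℤ φ w ℤ.≤ q ℤ.* r
  bound⇒ev {q} {w} {x} {r} {φ} 0<q rep Fφ le = ι-cancel-≤ (subst₂ ℚ._≤_ (rep φ Fφ) (sym (ι-* q r))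
    (ℚP.*-monoˡ-≤-nonNeg (ι q) {{ℚ.nonNegative (ℚP.<⇒≤ (0<ι 0<q))}} le))

  ev⇒bound : ∀ {q w x r φ} → 0ℤ ℤ.< q → Rep F o q w x → F φ → evℤ φ w ℤ.≤ q ℤ.* r → val φ x ℚ.- val φ o ℚ.≤ ι r
  ev⇒bound {q} {w} {x} {r} {φ} 0<q rep Fφ le = ℚP.*-cancelˡ-≤-pos (ι q) {{ι-pos 0<q}}
    (subst₂ ℚ._≤_ (sym (rep φ Fφ)) (ι-* q r) (ι-mono-≤ le))

-- Parity

Coef : ℤ → Set
Coef s = Sign s ⊎ s ≡ 0ℤ

∣sign∣ : ∀ {s} → Sign s → ℤ.∣ s ∣ ≡ 1
∣sign∣ (inj₁ refl) = refl
∣sign∣ (inj₂ refl) = refl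

sign-square : ∀ {s} → Sign s → s ℤ.* s ≡ 1ℤ
sign-square (inj₁ refl) = refl
sign-square (inj₂ refl) = refl

sign-neg : ∀ {s} → Sign s → Sign (ℤ.- s)
sign-neg (inj₁ refl) = inj₂ refl
sign-neg (inj₂ refl) = inj₁ refl

∣coef∣≤1 : ∀ {s} → Coef s → ℤ.∣ s ∣ ℕ.≤ 1
∣coef∣≤1 (inj₁ s) = ℕP.≤-reflexive (∣sign∣ s)
∣coef∣≤1 (inj₂ refl) = ℕ.z≤n

∣coef*∣≤ : ∀ {s} → Coef s → ∀ a → ℤ.∣ s ℤ.* a ∣ ℕ.≤ ℤ.∣ a ∣
∣coef*∣≤ {s} c a = subst₂ ℕ._≤_ (sym (ℤP.abs-* s a)) (ℕP.*-identityˡ ℤ.∣ a ∣) (ℕP.*-monoˡ-≤ ℤ.∣ a ∣ (∣coef∣≤1 c))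

∣evℤ∣≤ : ∀ {m} {s t} {i j : Fin m} (w : Fin m → ℤ) → Coef s → Coef t → ℤ.∣ evℤ (form s i t j) w ∣ ℕ.≤ ℤ.∣ w i ∣ ℕ.+ ℤ.∣ w j ∣
∣evℤ∣≤ {s = s} {t} {i} {j} w cs ct = ℕP.≤-trans (ℤP.∣i+j∣≤∣i∣+∣j∣ (s ℤ.* w i) (t ℤ.* w j)) (ℕP.+-mono-≤ (∣coef*∣≤ cs (w i)) (∣coef*∣≤ ct (w j)))

∣0ℤ : ∀ {q} → q ∣ 0ℤ
∣0ℤ {q} = divides 0ℤ (sym (ℤP.*-zeroˡ q))

∣-sign : ∀ {q s a} → Sign s → q ∣ s ℤ.* a → q ∣ a
∣-sign {q} {s} {a} ss q∣sa = subst (q ∣_) (trans (sym (ℤP.*-assoc s s a)) (trans (cong (ℤ._* a) (sign-square ss)) (ℤP.*-identityˡ a)))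
  (∣n⇒∣m*n s q∣sa)

⟦_⟧ : ∀ {P : Set} → Dec P → ℤ
⟦ P? ⟧ = if does P? then 1ℤ else 0ℤ

⟦⟧-cong : ∀ {P Q : Set} (P? : Dec P) (Q? : Dec Q) → (P → Q) → (Q → P) → ⟦ P? ⟧ ≡ ⟦ Q? ⟧
⟦⟧-cong (yes _) (yes _) f g = refl
⟦⟧-cong (yes p) (no ¬r) f g = contradiction (f p) ¬r
⟦⟧-cong (no ¬p) (yes r) f g = contradiction (g r) ¬p
⟦⟧-cong (no _) (no _) f g = refl

⟦⟧-yes : ∀ {P : Set} (P? : Dec P) → P → ⟦ P? ⟧ ≡ 1ℤ
⟦⟧-yes (yes _) p = refl
⟦⟧-yes (no ¬p) p = contradiction p ¬p

⟦⟧-no : ∀ {P : Set} (P? : Dec P) → ¬ P → ⟦ P? ⟧ ≡ 0ℤ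
⟦⟧-no (yes p) ¬p = contradiction p ¬p
⟦⟧-no (no _) ¬p = refl

⟦⟧≡1 : ∀ {P : Set} (P? : Dec P) → ⟦ P? ⟧ ≡ 1ℤ → P
⟦⟧≡1 (yes p) _ = p

indicator : ℤ → ℤ → ℤ
indicator q a = ⟦ q ∣? a ⟧

indicator-∣ : ∀ {q a} → q ∣ a → indicator q a ≡ 1ℤ
indicator-∣ {q} {a} = ⟦⟧-yes (q ∣? a)

indicator≡1⇒∣ : ∀ {q a} → indicator q a ≡ 1ℤ → q ∣ a
indicator≡1⇒∣ {q} {a} = ⟦⟧≡1 (q ∣? a)

indicator-cong : ∀ {q a b} → (q ∣ a → q ∣ b) → (q ∣ b → q ∣ a) → indicator q a ≡ indicator q b
indicator-cong {q} {a} {b} = ⟦⟧-cong (q ∣? a) (q ∣? b)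

indicator-opposite : ∀ {q a b} → q ∣ a ℤ.+ b → indicator q a ≡ indicator q b
indicator-opposite {q} {a} {b} q∣a+b = indicator-cong {q} {a} {b} (∣m+n∣m⇒∣n q∣a+b) (∣m+n∣m⇒∣n (subst (q ∣_) (ℤP.+-comm a b) q∣a+b))

-- Odd and q-periodic in a, and vanishing at a = c only if q divides 2c.
oddStep : ℤ → ℤ → ℤ → ℤ
oddStep q c a = indicator q (a ℤ.- c) ℤ.- indicator q (a ℤ.+ c)

∣oddStep∣≤1 : ∀ q c a → ℤ.∣ oddStep q c a ∣ ℕ.≤ 1
∣oddStep∣≤1 q c a with does (q ∣? (a ℤ.- c)) | does (q ∣? (a ℤ.+ c))
... | false | false = ℕ.z≤n
... | false | true = ℕP.≤-refl
... | true | false = ℕP.≤-refl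
... | true | true = ℕ.z≤n

-- Modulo `q` the arguments are opposite, which exchanges the two indicators. With a and b the two
-- terms of a root, the hypothesis says that the root is integral at the point, as `rigid` requires
-- of the roots on which the perturbation must vanish.
oddStep-opposite : ∀ {q c a b} → q ∣ a ℤ.+ b → oddStep q c a ℤ.+ oddStep q c b ≡ 0ℤ
oddStep-opposite {q} {c} {a} {b} q∣a+b = trans (cong₂ (λ u v → (u ℤ.- v) ℤ.+ oddStep q c b)
    (indicator-opposite {q} {a ℤ.- c} {b ℤ.+ c} (subst (q ∣_) (e₁ a b c) q∣a+b))
    (indicator-opposite {q} {a ℤ.+ c} {b ℤ.- c} (subst (q ∣_) (e₂ a b c) q∣a+b)))
  (cancel (indicator q (b ℤ.+ c)) (indicator q (b ℤ.- c)))
  where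
  e₁ : ∀ a b c → a ℤ.+ b ≡ (a ℤ.- c) ℤ.+ (b ℤ.+ c)
  e₁ = ℤSolver.solve-∀
  e₂ : ∀ a b c → a ℤ.+ b ≡ (a ℤ.+ c) ℤ.+ (b ℤ.- c)
  e₂ = ℤSolver.solve-∀
  cancel : ∀ u v → (u ℤ.- v) ℤ.+ (v ℤ.- u) ≡ 0ℤ
  cancel = ℤSolver.solve-∀

oddStep-zero : ∀ q c → oddStep q c 0ℤ ≡ 0ℤ
oddStep-zero q c = trans (cong (λ u → u ℤ.- indicator q (0ℤ ℤ.+ c)) (indicator-opposite {q} {0ℤ ℤ.- c} {0ℤ ℤ.+ c} (subst (q ∣_) (lin c) ∣0ℤ)))
  (ℤP.+-inverseʳ (indicator q (0ℤ ℤ.+ c)))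
  where
  lin : ∀ c → 0ℤ ≡ (0ℤ ℤ.- c) ℤ.+ (0ℤ ℤ.+ c)
  lin = ℤSolver.solve-∀

oddStep-coef : ∀ {q c s} a → Coef s → oddStep q c (s ℤ.* a) ≡ s ℤ.* oddStep q c a
oddStep-coef {q} {c} a (inj₁ (inj₁ refl)) = trans (cong (oddStep q c) (ℤP.*-identityˡ a)) (sym (ℤP.*-identityˡ (oddStep q c a)))
oddStep-coef {q} {c} a (inj₁ (inj₂ refl)) = trans (neg (oddStep q c (-1ℤ ℤ.* a)) (oddStep q c a) (oddStep-opposite {q} {c} { -1ℤ ℤ.* a} {a} (subst (q ∣_) (lin a) ∣0ℤ))) (sym (ℤP.-1*i≡-i _))
  where
  lin : ∀ a → 0ℤ ≡ -1ℤ ℤ.* a ℤ.+ a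
  lin = ℤSolver.solve-∀
  back : ∀ x y → x ≡ (x ℤ.+ y) ℤ.- y
  back = ℤSolver.solve-∀
  neg : ∀ x y → x ℤ.+ y ≡ 0ℤ → x ≡ ℤ.- y
  neg x y eq = trans (back x y) (trans (cong (ℤ._- y) eq) (ℤP.+-identityˡ (ℤ.- y)))
oddStep-coef {q} {c} a (inj₂ refl) = oddStep-zero q c

oddStep-self : ∀ {q c} → oddStep q c c ≡ 0ℤ → q ∣ c ℤ.+ c
oddStep-self {q} {c} eq = indicator≡1⇒∣ {q} {c ℤ.+ c} (trans (sym (ℤP.i-j≡0⇒i≡j (indicator q (c ℤ.- c)) (indicator q (c ℤ.+ c)) eq)) (indicator-∣ {q} {c ℤ.- c} (subst (q ∣_) (sym (ℤP.+-inverseʳ c)) ∣0ℤ)))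

-- Boolean-valued, so that one construction serves both parity classes, with the parity as an
-- argument.
even : ℤ → Bool
even a = does (+ 2 ∣? a)

even⇒∣ : ∀ {a} → even a ≡ true → + 2 ∣ a
even⇒∣ {a} = from-true (+ 2 ∣? a)
  where
  from-true : ∀ {P : Set} (P? : Dec P) → does P? ≡ true → P
  from-true (yes p) _ = p

∣⇒even : ∀ {a} → + 2 ∣ a → even a ≡ true
∣⇒even {a} = dec-true (+ 2 ∣? a)

∤⇒odd : ∀ {a} → ¬ + 2 ∣ a → even a ≡ false
∤⇒odd {a} = dec-false (+ 2 ∣? a)

2∤1 : ¬ + 2 ∣ 1ℤ
2∤1 p = contradiction (∣⇒even p) λ ()

odd⇒+sign : ∀ {a s} → even a ≡ false → Sign s → + 2 ∣ a ℤ.+ s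
odd⇒+sign {a} {s} odd ss = go ss (a ℤD.%ℕ 2) (ℤD.n%ℕd<d a 2) (ℤD.a≡a%ℕn+[a/ℕn]*n a 2)
  where
  go : ∀ {s} → Sign s → ∀ r → r ℕ.< 2 → a ≡ + r ℤ.+ (a ℤD./ℕ 2) ℤ.* + 2 → + 2 ∣ a ℤ.+ s
  go _ 0 _ eq with trans (sym odd) (∣⇒even (divides (a ℤD./ℕ 2) (trans eq (ℤP.+-identityˡ _))))
  ... | ()
  go (inj₁ refl) 1 _ eq = divides (a ℤD./ℕ 2 ℤ.+ 1ℤ) (trans (cong (ℤ._+ 1ℤ) eq) (lin (a ℤD./ℕ 2)))
    where
    lin : ∀ c → 1ℤ ℤ.+ c ℤ.* + 2 ℤ.+ 1ℤ ≡ (c ℤ.+ 1ℤ) ℤ.* + 2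
    lin = ℤSolver.solve-∀
  go (inj₂ refl) 1 _ eq = divides (a ℤD./ℕ 2) (trans (cong (ℤ._+ -1ℤ) eq) (lin (a ℤD./ℕ 2)))
    where
    lin : ∀ c → 1ℤ ℤ.+ c ℤ.* + 2 ℤ.+ -1ℤ ≡ c ℤ.* + 2
    lin = ℤSolver.solve-∀
  go _ (suc (suc r)) (ℕ.s≤s (ℕ.s≤s ())) _

even-+sign : ∀ {a s} → Sign s → even (a ℤ.+ s) ≡ not (even a)
even-+sign {a} {s} ss = go (even a) refl
  where
  2∤s : ¬ + 2 ∣ s
  2∤s p = 2∤1 (subst (+ 2 ∣_) (sign-square ss) (∣n⇒∣m*n s p))
  go : ∀ b → even a ≡ b → even (a ℤ.+ s) ≡ not b
  go true eq = ∤⇒odd λ p → 2∤s (∣m+n∣m⇒∣n p (even⇒∣ {a} eq))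
  go false eq = ∣⇒even (odd⇒+sign {a} eq ss)

even-sum : ∀ {a b} → even a ≡ even b → + 2 ∣ a ℤ.+ b
even-sum {a} {b} eq = go (even a) refl (sym eq)
  where
  lin : ∀ a b → a ℤ.+ b ≡ (a ℤ.+ 1ℤ) ℤ.+ (b ℤ.+ -1ℤ)
  lin = ℤSolver.solve-∀
  go : ∀ c → even a ≡ c → even b ≡ c → + 2 ∣ a ℤ.+ b
  go true ea eb = ∣m∣n⇒∣m+n (even⇒∣ {a} ea) (even⇒∣ {b} eb)
  go false ea eb = subst (+ 2 ∣_) (sym (lin a b)) (∣m∣n⇒∣m+n (odd⇒+sign {a} ea (inj₁ refl)) (odd⇒+sign {b} eb (inj₂ refl)))

even-sum⁻¹ : ∀ {a b} → + 2 ∣ a ℤ.+ b → even a ≡ even b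
even-sum⁻¹ {a} {b} p = does-⇔ (mk⇔ (∣m+n∣m⇒∣n p) (∣m+n∣m⇒∣n (subst (+ 2 ∣_) (ℤP.+-comm a b) p))) (+ 2 ∣? a) (+ 2 ∣? b)

even-sign* : ∀ {s} a → Sign s → even (s ℤ.* a) ≡ even a
even-sign* {s} a ss = does-⇔ (mk⇔ (∣-sign {s = s} ss) (∣n⇒∣m*n s)) (+ 2 ∣? (s ℤ.* a)) (+ 2 ∣? a)

same-parity⇒2∣ev : ∀ {n} {w : Fin n → ℤ} {s t i j} → Sign s → Sign t → even (w i) ≡ even (w j) → + 2 ∣ evℤ (form s i t j) w
same-parity⇒2∣ev {w = w} {s} {t} {i} {j} ss st eq = even-sum {s ℤ.* w i} {t ℤ.* w j}
  (trans (even-sign* (w i) ss) (trans eq (sym (even-sign* (w j) st))))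

2∣ev⇒same-parity : ∀ {n} {w : Fin n → ℤ} {s t i j} → Sign s → Sign t → + 2 ∣ evℤ (form s i t j) w → even (w i) ≡ even (w j)
2∣ev⇒same-parity {w = w} {s} {t} {i} {j} ss st p = trans (sym (even-sign* (w i) ss))
  (trans (even-sum⁻¹ {s ℤ.* w i} {t ℤ.* w j} p) (even-sign* (w j) st))

-- One unit towards 0, but 0 itself moves to 1.
toward : ℤ → ℤ
toward (+ zero) = 1ℤ
toward (+ suc n) = -1ℤ
toward -[1+ n ] = 1ℤ

toward-sign : ∀ a → Sign (toward a)
toward-sign (+ zero) = inj₁ refl
toward-sign (+ suc n) = inj₂ refl
toward-sign -[1+ n ] = inj₁ refl

∣+toward∣ : ∀ a → ℤ.∣ a ∣ ≡ suc ℤ.∣ a ℤ.+ toward a ∣ ⊎ (ℤ.∣ a ∣ ≡ 0 × ℤ.∣ a ℤ.+ toward a ∣ ≡ 1)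
∣+toward∣ (+ zero) = inj₂ (refl , refl)
∣+toward∣ (+ suc n) = inj₁ refl
∣+toward∣ -[1+ zero ] = inj₁ refl
∣+toward∣ -[1+ suc n ] = inj₁ refl

-- Never 0, so that it can serve as a coefficient of a root; at 0 either sign makes the product in
-- `sgn*` vanish.
sgn : ℤ → ℤ
sgn a = ℤ.- toward a

sgn-sign : ∀ a → Sign (sgn a)
sgn-sign a = sign-neg (toward-sign a)

sgn* : ∀ a → sgn a ℤ.* a ≡ + ℤ.∣ a ∣
sgn* (+ zero) = refl
sgn* (+ suc n) = ℤP.*-identityˡ (+ suc n)
sgn* -[1+ n ] = cong (λ k → + suc k) (ℕP.+-identityʳ n)

stepTo : Bool → ℤ → ℤ
stepTo b a = if does (even a BoolP.≟ b) then toward a else 0ℤ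

stepTo-cases : ∀ b a → (even a ≡ b × stepTo b a ≡ toward a) ⊎ (even a ≢ b × stepTo b a ≡ 0ℤ)
stepTo-cases b a with even a BoolP.≟ b
... | yes p = inj₁ (p , refl)
... | no ¬p = inj₂ (¬p , refl)

stepTo-coef : ∀ b a → Coef (stepTo b a)
stepTo-coef b a with even a BoolP.≟ b
... | yes p = inj₁ (toward-sign a)
... | no ¬p = inj₂ refl

-- Entries of parity `b` change it and the others already have the opposite one. The resulting
-- uniform parity is what makes the end of a move a vertex.
even-stepTo : ∀ b a → even (a ℤ.+ stepTo b a) ≡ not b
even-stepTo b a = [ (λ { (eq , st) → trans (cong (λ d → even (a ℤ.+ d)) st) (trans (even-+sign {a} (toward-sign a)) (cong not eq)) })
  , (λ { (neq , st) → trans (cong (λ d → even (a ℤ.+ d)) st) (trans (cong even (ℤP.+-identityʳ a)) (BoolP.¬-not neq)) }) ]′ (stepTo-cases b a)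

-- Types B, C, D

Longᶠ : ∀ {m} → Form m → Set
Longᶠ (form s i t j) = i ≢ j × Sign s × Sign t

Shortᶠ : ∀ {m} → Form m → Set
Shortᶠ (form s i t j) = i ≡ j × Sign s × t ≡ 0ℤ

Doubleᶠ : ∀ {m} → Form m → Set
Doubleᶠ (form s i t j) = i ≡ j × Sign s × t ≡ s

a+a≡0⇒a≡0 : ∀ {a} → a ℚ.+ a ≡ 0ℚ → a ≡ 0ℚ
a+a≡0⇒a≡0 {a} eq = *-cancelˡ-pos {1ℚ ℚ.+ 1ℚ} (ℚP.positive⁻¹ (1ℚ ℚ.+ 1ℚ)) (trans (lin 1ℚ a) (trans (cong₂ ℚ._+_ (ℚP.*-identityˡ a) (ℚP.*-identityˡ a)) (trans eq (sym (ℚP.*-zeroʳ (1ℚ ℚ.+ 1ℚ))))))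
  where
  lin : ∀ u a → (u ℚ.+ u) ℚ.* a ≡ u ℚ.* a ℚ.+ u ℚ.* a
  lin = solve-∀ ℚring

module _ {m} {i j : Fin m} where

  -- The two add up to twice the coordinate `i`. Long roots alone thus recover single coordinates,
  -- which is needed in type D, where no root is supported on one coordinate.
  sum diff : Form m
  sum = form 1ℤ i 1ℤ j
  diff = form 1ℤ i -1ℤ j

  evℚ-sum+diff : ∀ d → evℚ sum d ℚ.+ evℚ diff d ≡ d i ℚ.+ d i
  evℚ-sum+diff d = trans (cong₂ (λ u v → (u ℚ.* d i ℚ.+ u ℚ.* d j) ℚ.+ (u ℚ.* d i ℚ.+ v ℚ.* d j)) (ι≡ 1ℤ) (trans (ι-neg 1ℤ) (cong ℚ.-_ (ι≡ 1ℤ))))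
    (trans (lin 1ℚ (d i) (d j)) (cong₂ ℚ._+_ (ℚP.*-identityˡ (d i)) (ℚP.*-identityˡ (d i))))
    where
    lin : ∀ u a b → (u ℚ.* a ℚ.+ u ℚ.* b) ℚ.+ (u ℚ.* a ℚ.+ (ℚ.- u) ℚ.* b) ≡ u ℚ.* a ℚ.+ u ℚ.* a
    lin = solve-∀ ℚring

  evℤ-sum+diff : ∀ w → evℤ sum w ℤ.+ evℤ diff w ≡ w i ℤ.+ w i
  evℤ-sum+diff w = lin (w i) (w j)
    where
    lin : ∀ a b → (1ℤ ℤ.* a ℤ.+ 1ℤ ℤ.* b) ℤ.+ (1ℤ ℤ.* a ℤ.+ -1ℤ ℤ.* b) ≡ a ℤ.+ a
    lin = ℤSolver.solve-∀

  sum-diff-zeroℚ : ∀ d → evℚ sum d ≡ 0ℚ → evℚ diff d ≡ 0ℚ → d i ≡ 0ℚ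
  sum-diff-zeroℚ d p r = a+a≡0⇒a≡0 (trans (sym (evℚ-sum+diff d)) (cong₂ ℚ._+_ p r))

  sum-diff-zeroℤ : ∀ w → evℤ sum w ≡ 0ℤ → evℤ diff w ≡ 0ℤ → w i ≡ 0ℤ
  sum-diff-zeroℤ w p r = ℤP.*-cancelˡ-≡ (+ 2) (w i) 0ℤ (trans (lin (w i)) (trans (sym (evℤ-sum+diff w)) (cong₂ ℤ._+_ p r)))
    where
    lin : ∀ a → + 2 ℤ.* a ≡ a ℤ.+ a
    lin = ℤSolver.solve-∀

evℤ-zero : ∀ {m} s (i : Fin m) t j w → w i ≡ 0ℤ → w j ≡ 0ℤ → evℤ (form s i t j) w ≡ 0ℤ
evℤ-zero s i t j w p r = trans (cong₂ (λ a b → s ℤ.* a ℤ.+ t ℤ.* b) p r) (cong₂ ℤ._+_ (ℤP.*-zeroʳ s) (ℤP.*-zeroʳ t))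

evℚ-zero : ∀ {m} (φ : Form m) d → (∀ i → d i ≡ 0ℚ) → evℚ φ d ≡ 0ℚ
evℚ-zero (form s i t j) d z = trans (cong₂ (λ a b → ι s ℚ.* a ℚ.+ ι t ℚ.* b) (z i) (z j)) (cong₂ ℚ._+_ (ℚP.*-zeroʳ (ι s)) (ℚP.*-zeroʳ (ι t)))

coordinatewise : ∀ {m} {F : Form m → Set} {o q w x} → (∀ i → ι q ℚ.* (lookup x i ℚ.- lookup o i) ≡ ι (w i)) → Rep F o q w x
coordinatewise {o = o} {q} {w} {x} eqs φ _ = begin
  ι q ℚ.* (val φ x ℚ.- val φ o) ≡⟨ cong (ι q ℚ.*_) (evℚ-- φ (lookup x) (lookup o)) ⟨
  ι q ℚ.* evℚ φ (λ i → lookup x i ℚ.- lookup o i) ≡⟨ evℚ-* φ (ι q) (λ i → lookup x i ℚ.- lookup o i) ⟨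
  evℚ φ (λ i → ι q ℚ.* (lookup x i ℚ.- lookup o i)) ≡⟨ evℚ-cong φ eqs ⟩
  evℚ φ (λ i → ι (w i)) ≡⟨ ι-evℤ φ w ⟨
  ι (evℤ φ w) ∎
  where open ≡-Reasoning

0<2 : 0ℤ ℤ.< + 2
0<2 = ℤ.+<+ ℕ.z<s

-- An odd integer is not 0, so the exceptional value of `toward` does not occur and moving the odd
-- entries never increases an absolute value.
odd-move : ∀ a → (even a ≡ false × ℤ.∣ a ∣ ≡ suc ℤ.∣ a ℤ.+ stepTo false a ∣) ⊎ (even a ≡ true × ℤ.∣ a ℤ.+ stepTo false a ∣ ≡ ℤ.∣ a ∣)
odd-move a = [ odd , (λ c → inj₂ (BoolP.¬-not (proj₁ c) , cong ℤ.∣_∣ (trans (cong (λ s → a ℤ.+ s) (proj₂ c)) (ℤP.+-identityʳ a)))) ]′ (stepTo-cases false a)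
  where
  odd : even a ≡ false × stepTo false a ≡ toward a → _
  odd (eq , st) = inj₁ (eq , [ (λ p → trans p (cong (λ s → suc ℤ.∣ a ℤ.+ s ∣) (sym st)))
    , (λ z → contradiction (trans (sym eq) (cong even (ℤP.∣i∣≡0⇒i≡0 {a} (proj₁ z)))) λ ()) ]′ (∣+toward∣ a))

-- A nonzero even entry shrinks; 0 becomes 1, which is below `N` since a positive even number is at
-- least 2; an odd entry stays, but cannot equal the even number `N`.
even-move : ∀ {N} a → ℤ.∣ a ∣ ℕ.≤ N → 2 ℕ∣.∣ N → N ≢ 0 → suc ℤ.∣ a ℤ.+ stepTo true a ∣ ℕ.≤ N
even-move {N} a a≤N 2∣N N≢0 = [ moved , unmoved ]′ (stepTo-cases true a)
  where
  instance
    N-nonzero : ℕ.NonZero N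
    N-nonzero = ℕ.≢-nonZero N≢0
  moved : even a ≡ true × stepTo true a ≡ toward a → suc ℤ.∣ a ℤ.+ stepTo true a ∣ ℕ.≤ N
  moved (_ , st) = subst (λ s → suc ℤ.∣ a ℤ.+ s ∣ ℕ.≤ N) (sym st)
    ([ (λ p → subst (ℕ._≤ N) p a≤N) , (λ z → subst (λ g → suc g ℕ.≤ N) (sym (proj₂ z)) (ℕ∣.∣⇒≤ 2∣N)) ]′ (∣+toward∣ a))
  unmoved : even a ≢ true × stepTo true a ≡ 0ℤ → suc ℤ.∣ a ℤ.+ stepTo true a ∣ ℕ.≤ N
  unmoved (odd , st) = subst (λ b → suc ℤ.∣ b ∣ ℕ.≤ N) (sym (trans (cong (λ s → a ℤ.+ s) st) (ℤP.+-identityʳ a)))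
    (ℕP.≤∧≢⇒< a≤N λ eq → odd (∣⇒even (∣ᵤ⇒∣ {+ 2} {a} (subst (2 ℕ∣.∣_) (sym eq) 2∣N))))

∣+2toward∣ : ∀ {N} a → ℤ.∣ a ∣ ≡ suc (suc N) → ℤ.∣ a ℤ.+ + 2 ℤ.* toward a ∣ ≡ N
∣+2toward∣ (+ suc (suc n)) refl = refl
∣+2toward∣ -[1+ suc zero ] refl = refl
∣+2toward∣ -[1+ suc (suc n) ] refl = refl

-- `own` decides whether a root supported on the single coordinate i has a wall
-- through o + w / 2.
module HalfLattice {n : ℕ} (other : (i : Fin n) → ∃ λ j → j ≢ i) (F : Form n → Set)
  (long : ∀ {φ} → Longᶠ φ → F φ)
  (shape : ∀ {φ} → F φ → Longᶠ φ ⊎ (Shortᶠ φ ⊎ Doubleᶠ φ))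
  (own : ∀ (w : Fin n → ℤ) i → (∃ λ t → F (form 1ℤ i t i) × (t ≡ 0ℤ ⊎ t ≡ 1ℤ) × + 2 ∣ evℤ (form 1ℤ i t i) w) ⊎
    (∀ s t → F (form s i t i) → ¬ + 2 ∣ evℤ (form s i t i) w))
  (o : Pt n) (o-lattice : ∀ φ → F φ → ∃ λ K → val φ o ≡ ι K)
  where

  V : Pt n → Set
  V _ = ⊤

  long-sum : ∀ {i j : Fin n} → j ≢ i → F (form 1ℤ i 1ℤ j)
  long-sum j≢i = long ((λ eq → j≢i (sym eq)) , inj₁ refl , inj₁ refl)

  long-diff : ∀ {i j : Fin n} → j ≢ i → F (form 1ℤ i -1ℤ j)
  long-diff j≢i = long ((λ eq → j≢i (sym eq)) , inj₁ refl , inj₂ refl)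

  coefs : ∀ {φ} → F φ → Coef (Form.s φ) × Coef (Form.t φ)
  coefs Fφ = [ (λ { (_ , ss , st) → inj₁ ss , inj₁ st }) , [ (λ { (_ , ss , t≡0) → inj₁ ss , inj₂ t≡0 })
    , (λ { (_ , ss , refl) → inj₁ ss , inj₁ ss }) ]′ ]′ (shape Fφ)

  separated : ∀ {x y} → V x → V y → (∀ φ → F φ → val φ x ≡ val φ y) → x ≡ y
  separated {x} {y} _ _ eqs = trans (sym (VecP.tabulate∘lookup x)) (trans (VecP.tabulate-cong same) (VecP.tabulate∘lookup y))
    where
    zero-on : ∀ φ → F φ → evℚ φ (λ i → lookup x i ℚ.- lookup y i) ≡ 0ℚ
    zero-on φ Fφ = trans (evℚ-- φ (lookup x) (lookup y)) (x≡y⇒x-y≡0 (eqs φ Fφ))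
    same : ∀ i → lookup x i ≡ lookup y i
    same i = let (j , j≢i) = other i in
      x-y≡0⇒x≡y (sum-diff-zeroℚ {i = i} {j} (λ i → lookup x i ℚ.- lookup y i) (zero-on _ (long-sum j≢i)) (zero-on _ (long-diff j≢i)))

  realise : ∀ q w → 0ℤ ℤ.< q → ∃ λ z → V z × Rep F o q w z
  realise q w 0<q = z , tt , coordinatewise {o = o} {q} {w} {z} eqs
    where
    instance
      ιq-pos : ℚ.Positive (ι q)
      ιq-pos = ι-pos 0<q
      ιq≢0 : ℚ.NonZero (ι q)
      ιq≢0 = ℚP.pos⇒nonZero (ι q)
    z = tabulate (λ i → lookup o i ℚ.+ ℚ.1/ ι q ℚ.* ι (w i))
    lin : ∀ q v a b → q ℚ.* ((a ℚ.+ v ℚ.* b) ℚ.- a) ≡ (q ℚ.* v) ℚ.* b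
    lin = solve-∀ ℚring
    eqs : ∀ i → ι q ℚ.* (lookup z i ℚ.- lookup o i) ≡ ι (w i)
    eqs i = trans (cong (λ v → ι q ℚ.* (v ℚ.- lookup o i)) (VecP.lookup∘tabulate _ i))
      (trans (lin (ι q) (ℚ.1/ ι q) (lookup o i) (ι (w i))) (trans (cong (ℚ._* ι (w i)) (ℚP.*-inverseʳ (ι q))) (ℚP.*-identityˡ (ι (w i)))))

  open Apartment F V (λ _ _ _ → tt) separated o o-lattice realise public

  -- For each `i` the numerators are fed through the odd, `q`-periodic function `oddStep q (p i)`.
  -- Oddness commutes with the signs of a root and periodicity retains only residues, so this
  -- perturbation vanishes on the roots integral at `x`. Then `rigid` kills its coordinate `i`,
  -- which means that `q` divides twice `p i`.
  half-integral : ∀ {x} → Vertexᶠ F V x → ∃ λ w → Rep F o (+ 2) w x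
  half-integral {x} vx = w , coordinatewise {o = o} {+ 2} {w} {x} halves
    where
    u : Fin n → ℚ
    u i = lookup x i ℚ.- lookup o i
    cd = common-denominator u
    q = proj₁ cd
    p = proj₁ (proj₂ cd)
    0<q = proj₁ (proj₂ (proj₂ cd))
    u≡ = proj₂ (proj₂ (proj₂ cd))
    rep : Rep F o q p x
    rep = coordinatewise {o = o} {q} {p} {x} u≡
    q∣2p : ∀ i → q ∣ p i ℤ.+ p i
    q∣2p i = oddStep-self {q} {p i} (sum-diff-zeroℤ {i = i} {proj₁ (other i)} η (all _ (long-sum (proj₂ (other i)))) (all _ (long-diff (proj₂ (other i)))))
      where
      η : Fin n → ℤ
      η j = oddStep q (p i) (p j)
      small : ∀ φ → F φ → ℤ.∣ evℤ φ η ∣ ℕ.≤ 2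
      small (form s k t l) Fφ = ℕP.≤-trans (∣evℤ∣≤ {s = s} {t} {k} {l} η (proj₁ (coefs Fφ)) (proj₂ (coefs Fφ)))
        (ℕP.+-mono-≤ (∣oddStep∣≤1 q (p i) (p k)) (∣oddStep∣≤1 q (p i) (p l)))
      vanish : ∀ φ → F φ → q ∣ evℤ φ p → evℤ φ η ≡ 0ℤ
      vanish (form s k t l) Fφ q∣ = trans
        (sym (cong₂ ℤ._+_ (oddStep-coef {q} {p i} (p k) (proj₁ (coefs Fφ))) (oddStep-coef {q} {p i} (p l) (proj₂ (coefs Fφ)))))
        (oddStep-opposite {q} {p i} {s ℤ.* p k} {t ℤ.* p l} q∣)
      all : ∀ φ → F φ → evℤ φ η ≡ 0ℤ
      all = rigid {q} {p} {x} {η} 0<q rep vx small vanish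
    w : Fin n → ℤ
    w i = _∣_.quotient (q∣2p i)
    halves : ∀ i → ι (+ 2) ℚ.* u i ≡ ι (w i)
    halves i = *-cancelˡ-pos (0<ι 0<q) (begin
      ι q ℚ.* (ι (+ 2) ℚ.* u i) ≡⟨ left (ι q) (ι (+ 2)) (u i) ⟩
      ι (+ 2) ℚ.* (ι q ℚ.* u i) ≡⟨ cong (ι (+ 2) ℚ.*_) (u≡ i) ⟩
      ι (+ 2) ℚ.* ι (p i) ≡⟨ ι-* (+ 2) (p i) ⟨
      ι (+ 2 ℤ.* p i) ≡⟨ cong ι (trans (double (p i)) (trans (_∣_.equality (q∣2p i)) (ℤP.*-comm (w i) q))) ⟩
      ι (q ℤ.* w i) ≡⟨ ι-* q (w i) ⟩
      ι q ℚ.* ι (w i) ∎)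
      where
      open ≡-Reasoning
      left : ∀ a b c → a ℚ.* (b ℚ.* c) ≡ b ℚ.* (a ℚ.* c)
      left = solve-∀ ℚring
      double : ∀ a → + 2 ℤ.* a ≡ a ℤ.+ a
      double = ℤSolver.solve-∀

  -- Equal parity makes both eᵢ + eⱼ and eᵢ - eⱼ integral at the point, so walls through it
  -- determine the coordinate `i`. In `Pinned` a root supported on `i` alone does the same.
  Partner : (Fin n → ℤ) → Fin n → Set
  Partner w i = ∃ λ j → j ≢ i × even (w j) ≡ even (w i)

  Pinned : (Fin n → ℤ) → Fin n → Set
  Pinned w i = ∃ λ t → F (form 1ℤ i t i) × (t ≡ 0ℤ ⊎ t ≡ 1ℤ) × + 2 ∣ evℤ (form 1ℤ i t i) w

  δ : Fin n → Fin n → ℤ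
  δ i j = ⟦ j ≟ i ⟧

  ∣δ∣≤1 : ∀ i j → ℤ.∣ δ i j ∣ ℕ.≤ 1
  ∣δ∣≤1 i j with does (j ≟ i)
  ... | true = ℕP.≤-refl
  ... | false = ℕ.z≤n

  -- Without a partner the coordinate i could be perturbed alone.
  vertex-tight : ∀ {w x} → Rep F o (+ 2) w x → Vertexᶠ F V x → ∀ i → Pinned w i ⊎ Partner w i
  vertex-tight {w} {x} rep vx i = [ inj₁ , (λ free → inj₂ (search free (any? (λ j → ¬? (j ≟ i) ×-dec (even (w j) BoolP.≟ even (w i)))))) ]′ (own w i)
    where
    search : (∀ s t → F (form s i t i) → ¬ + 2 ∣ evℤ (form s i t i) w) → Dec (Partner w i) → Partner w i
    search free (yes partner) = partner
    search free (no lonely) = contradiction (trans (sym nonzero) (rigid {+ 2} {w} {x} {δ i} 0<2 rep vx small vanish (form 1ℤ i 1ℤ j) (long-sum j≢i))) λ ()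
      where
      j = proj₁ (other i)
      j≢i = proj₂ (other i)
      nonzero : evℤ (form 1ℤ i 1ℤ j) (δ i) ≡ 1ℤ
      nonzero = cong₂ (λ a b → 1ℤ ℤ.* a ℤ.+ 1ℤ ℤ.* b) (⟦⟧-yes (i ≟ i) refl) (⟦⟧-no (j ≟ i) j≢i)
      small : ∀ φ → F φ → ℤ.∣ evℤ φ (δ i) ∣ ℕ.≤ 2
      small (form s k t l) Fφ = ℕP.≤-trans (∣evℤ∣≤ {s = s} {t} {k} {l} (δ i) (proj₁ (coefs Fφ)) (proj₂ (coefs Fφ))) (ℕP.+-mono-≤ (∣δ∣≤1 i k) (∣δ∣≤1 i l))
      vanish : ∀ φ → F φ → + 2 ∣ evℤ φ w → evℤ φ (δ i) ≡ 0ℤ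
      vanish (form s k t l) Fφ 2∣ = evℤ-zero s k t l (δ i) (⟦⟧-no (k ≟ i) k≢i) (⟦⟧-no (l ≟ i) l≢i)
        where
        own-case : k ≡ l → k ≢ i
        own-case refl refl = free s t Fφ 2∣
        k≢i : k ≢ i
        k≢i refl = [ (λ { (k≢l , ss , st) → lonely (l , (λ eq → k≢l (sym eq)) , sym (2∣ev⇒same-parity {w = w} {s} {t} {k} {l} ss st 2∣)) })
          , [ (λ z → own-case (proj₁ z) refl) , (λ z → own-case (proj₁ z) refl) ]′ ]′ (shape Fφ)
        l≢i : l ≢ i
        l≢i refl = [ (λ { (k≢l , ss , st) → lonely (k , k≢l , 2∣ev⇒same-parity {w = w} {s} {t} {k} {l} ss st 2∣) })
          , [ (λ z → own-case (proj₁ z) (proj₁ z)) , (λ z → own-case (proj₁ z) (proj₁ z)) ]′ ]′ (shape Fφ)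

  -- Under uniform parity every coordinate has a partner, and the corresponding walls fix all
  -- coordinates.
  uniform⇒vertex : ∀ {w y b} → Rep F o (+ 2) w y → (∀ i → even (w i) ≡ b) → Vertexᶠ F V y
  uniform⇒vertex {w} {y} rep uniform = vertexᶠ {+ 2} {w} {y} 0<2 tt rep λ d vanishes φ _ → evℚ-zero φ d λ i →
    let (j , j≢i) = other i ; eq = trans (uniform i) (sym (uniform j)) in
    sum-diff-zeroℚ {i = i} {j} d (vanishes _ (long-sum j≢i) (same-parity⇒2∣ev {w = w} {1ℤ} {1ℤ} (inj₁ refl) (inj₁ refl) eq))
      (vanishes _ (long-diff j≢i) (same-parity⇒2∣ev {w = w} {1ℤ} { -1ℤ} (inj₁ refl) (inj₂ refl) eq))

  VanishesOn : (w ε : Fin n → ℤ) → (Fin n → ℚ) → Set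
  VanishesOn w ε d = ∀ φ → F φ → evℤ φ ε ≡ 0ℤ → + 2 ∣ evℤ φ w → evℚ φ d ≡ 0ℚ

  partner⇒fixed : ∀ {w ε d i j} → j ≢ i → even (w i) ≡ even (w j) → ε i ≡ 0ℤ → ε j ≡ 0ℤ → VanishesOn w ε d → d i ≡ 0ℚ
  partner⇒fixed {w} {ε} {d} {i} {j} j≢i par εi εj vanishes = sum-diff-zeroℚ {i = i} {j} d
    (vanishes _ (long-sum j≢i) (evℤ-zero 1ℤ i 1ℤ j ε εi εj) (same-parity⇒2∣ev {w = w} {1ℤ} {1ℤ} (inj₁ refl) (inj₁ refl) par))
    (vanishes _ (long-diff j≢i) (evℤ-zero 1ℤ i -1ℤ j ε εi εj) (same-parity⇒2∣ev {w = w} {1ℤ} { -1ℤ} (inj₁ refl) (inj₂ refl) par))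

  pinned⇒fixed : ∀ {w ε d i} → Pinned w i → ε i ≡ 0ℤ → VanishesOn w ε d → d i ≡ 0ℚ
  pinned⇒fixed {w} {ε} {d} {i} (t , Fφ , t01 , 2∣) εi vanishes = go t01 (trans (cong (λ u → u ℚ.* d i ℚ.+ ι t ℚ.* d i) (sym (ι≡ 1ℤ))) (vanishes _ Fφ (evℤ-zero 1ℤ i t i ε εi εi) 2∣))
    where
    go : ∀ {t} → t ≡ 0ℤ ⊎ t ≡ 1ℤ → 1ℚ ℚ.* d i ℚ.+ ι t ℚ.* d i ≡ 0ℚ → d i ≡ 0ℚ
    go (inj₁ refl) eq = trans (sym (trans (cong₂ ℚ._+_ (ℚP.*-identityˡ (d i)) (trans (cong (ℚ._* d i) (ι≡ 0ℤ)) (ℚP.*-zeroˡ (d i)))) (ℚP.+-identityʳ (d i)))) eq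
    go (inj₂ refl) eq = a+a≡0⇒a≡0 (trans (sym (cong₂ ℚ._+_ (ℚP.*-identityˡ (d i)) (trans (cong (ℚ._* d i) (ι≡ 1ℤ)) (ℚP.*-identityˡ (d i))))) eq)

  collinear : ∀ {ε d τ} → (∀ i → d i ≡ τ ℚ.* ι (ε i)) → ∀ φ → F φ → evℚ φ d ≡ τ ℚ.* ι (evℤ φ ε)
  collinear {ε} {d} {τ} eqs φ _ = trans (evℚ-cong φ eqs) (trans (evℚ-* φ τ (λ i → ι (ε i))) (cong (τ ℚ.*_) (sym (ι-evℤ φ ε))))

  some-nonzero : ∀ {ε : Fin n → ℤ} {i} → ε i ≢ 0ℤ → ∃ λ φ → F φ × evℤ φ ε ≢ 0ℤ
  some-nonzero {ε} {i} ε≢0 = go (evℤ (form 1ℤ i 1ℤ j) ε ℤ.≟ 0ℤ)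
    where
    j = proj₁ (other i)
    go : Dec (evℤ (form 1ℤ i 1ℤ j) ε ≡ 0ℤ) → _
    go (no p) = form 1ℤ i 1ℤ j , long-sum (proj₂ (other i)) , p
    go (yes p) = form 1ℤ i -1ℤ j , long-diff (proj₂ (other i)) , λ r → ε≢0 (sum-diff-zeroℤ {i = i} {j} ε p r)

  Reaches : Pt n → (Fin n → ℤ) → Set
  Reaches x w′ = ∃ λ y → Vertexᶠ F V y × Rep F o (+ 2) w′ y × (x ≡ y ⊎ Adjacentᶠ F V x y)

  -- All coordinates of one parity move by half a unit at once.
  move : ∀ b {w x} → Rep F o (+ 2) w x → Vertexᶠ F V x → Reaches x (λ i → w i ℤ.+ stepTo b (w i))
  move b {w} {x} rep vx = y , vy , rep′ , go (any? λ i → even (w i) BoolP.≟ b)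
    where
    ε : Fin n → ℤ
    ε i = stepTo b (w i)
    w′ : Fin n → ℤ
    w′ i = w i ℤ.+ ε i
    y = proj₁ (realise (+ 2) w′ 0<2)
    rep′ = proj₂ (proj₂ (realise (+ 2) w′ 0<2))
    vy : Vertexᶠ F V y
    vy = uniform⇒vertex {w′} {y} rep′ (λ i → even-stepTo b (w i))
    moved : ∀ {i} → even (w i) ≡ b → Sign (ε i)
    moved {i} eq = [ (λ c → subst Sign (sym (proj₂ c)) (toward-sign (w i))) , (λ c → contradiction eq (proj₁ c)) ]′ (stepTo-cases b (w i))
    unmoved : ∀ {i} → even (w i) ≢ b → ε i ≡ 0ℤ
    unmoved {i} neq = [ (λ c → contradiction (proj₁ c) neq) , proj₂ ]′ (stepTo-cases b (w i))
    ∣ε∣≤1 : ∀ i → ℤ.∣ ε i ∣ ℕ.≤ 1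
    ∣ε∣≤1 i = ∣coef∣≤1 (stepTo-coef b (w i))
    -- A long root on two coordinates of equal parity is integral at `x` and may change by 2
    -- half-units; for different parities only one of the coordinates moves. Twice a coordinate is
    -- always integral.
    short : ∀ φ → F φ → (ℤ.∣ evℤ φ ε ∣ ℕ.≤ 1) ⊎ (+ 2 ∣ evℤ φ w × + ℤ.∣ evℤ φ ε ∣ ℤ.≤ + 2)
    short φ@(form s k t l) Fφ = [ long-case , [ short-case , double-case ]′ ]′ (shape Fφ)
      where
      sum≤ : ℤ.∣ evℤ φ ε ∣ ℕ.≤ ℤ.∣ ε k ∣ ℕ.+ ℤ.∣ ε l ∣
      sum≤ = ∣evℤ∣≤ {s = s} {t} {k} {l} ε (proj₁ (coefs Fφ)) (proj₂ (coefs Fφ))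
      ≤2 : + ℤ.∣ evℤ φ ε ∣ ℤ.≤ + 2
      ≤2 = ℤ.+≤+ (ℕP.≤-trans sum≤ (ℕP.+-mono-≤ (∣ε∣≤1 k) (∣ε∣≤1 l)))
      long-case : Longᶠ φ → (ℤ.∣ evℤ φ ε ∣ ℕ.≤ 1) ⊎ (+ 2 ∣ evℤ φ w × + ℤ.∣ evℤ φ ε ∣ ℤ.≤ + 2)
      long-case (_ , ss , st) = parity (even (w k) BoolP.≟ even (w l)) (even (w k) BoolP.≟ b)
        where
        parity : Dec (even (w k) ≡ even (w l)) → Dec (even (w k) ≡ b) → (ℤ.∣ evℤ φ ε ∣ ℕ.≤ 1) ⊎ (+ 2 ∣ evℤ φ w × + ℤ.∣ evℤ φ ε ∣ ℤ.≤ + 2)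
        parity (yes eq) _ = inj₂ (same-parity⇒2∣ev {w = w} {s} {t} {k} {l} ss st eq , ≤2)
        parity (no neq) (yes k≡b) = inj₁ (ℕP.≤-trans sum≤ (ℕP.+-mono-≤ (∣ε∣≤1 k)
          (ℕP.≤-reflexive (cong ℤ.∣_∣ (unmoved λ l≡b → neq (trans k≡b (sym l≡b)))))))
        parity (no neq) (no k≢b) = inj₁ (ℕP.≤-trans sum≤ (ℕP.+-mono-≤ (ℕP.≤-reflexive (cong ℤ.∣_∣ (unmoved k≢b))) (∣ε∣≤1 l)))
      short-case : Shortᶠ φ → (ℤ.∣ evℤ φ ε ∣ ℕ.≤ 1) ⊎ (+ 2 ∣ evℤ φ w × + ℤ.∣ evℤ φ ε ∣ ℤ.≤ + 2)
      short-case (_ , ss , refl) = inj₁ (subst (λ a → ℤ.∣ a ∣ ℕ.≤ 1) (sym (ℤP.+-identityʳ (s ℤ.* ε k)))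
        (ℕP.≤-trans (∣coef*∣≤ (inj₁ ss) (ε k)) (∣ε∣≤1 k)))
      double-case : Doubleᶠ φ → (ℤ.∣ evℤ φ ε ∣ ℕ.≤ 1) ⊎ (+ 2 ∣ evℤ φ w × + ℤ.∣ evℤ φ ε ∣ ℤ.≤ + 2)
      double-case (k≡l , ss , t≡s) = inj₂ (same-parity⇒2∣ev {w = w} {s} {t} {k} {l} ss (subst Sign (sym t≡s) ss) (cong (λ i → even (w i)) k≡l) , ≤2)
    go : Dec (∃ λ i → even (w i) ≡ b) → x ≡ y ⊎ Adjacentᶠ F V x y
    -- No coordinate has the parity `b`, so nothing moves; this is why `Reaches` admits equality.
    go (no none) = inj₁ (separated tt tt λ φ Fφ → x-y≡0⇒x≡y (trans (tele (val φ x) (val φ y) (val φ o))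
        (x≡y⇒x-y≡0 (*-cancelˡ-pos (0<ι 0<2) (trans (rep φ Fφ) (trans (cong ι (still φ)) (sym (rep′ φ Fφ))))))))
      where
      tele : ∀ a b c → a ℚ.- b ≡ (a ℚ.- c) ℚ.- (b ℚ.- c)
      tele = solve-∀ ℚring
      still : ∀ φ → evℤ φ w ≡ evℤ φ w′
      still (form s k t l) = cong₂ (λ u v → s ℤ.* u ℤ.+ t ℤ.* v) (same k) (same l)
        where
        same : ∀ i → w i ≡ w′ i
        same i = sym (trans (cong (λ e → w i ℤ.+ e) (unmoved λ eq → none (i , eq))) (ℤP.+-identityʳ (w i)))
    go (yes (i₀ , eq₀)) = inj₂ (adjacentᶠ {+ 2} {w} {ε} {x} {y} 0<2 rep rep′ vx vy
        (some-nonzero {ε} {i₀} λ ε≡0 → contradiction (trans (sym (∣sign∣ sign₀)) (cong ℤ.∣_∣ ε≡0)) λ ()) short line)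
      where
      sign₀ = moved eq₀
      line : ∀ d → VanishesOn w ε d → ∃ λ τ → ∀ φ → F φ → evℚ φ d ≡ τ ℚ.* ι (evℤ φ ε)
      line d vanishes = τ , collinear {ε} {d} {τ} λ i → on-axis i (even (w i) BoolP.≟ b) (i ≟ i₀)
        where
        -- Forced by the coordinate `i₀`, because a sign is its own inverse.
        τ = ι (ε i₀) ℚ.* d i₀
        square : ∀ {i} → Sign (ε i) → ι (ε i) ℚ.* ι (ε i) ≡ 1ℚ
        square {i} s = trans (sym (ι-* (ε i) (ε i))) (trans (cong ι (sign-square s)) (ι≡ 1ℤ))
        swap-out : ∀ e d → (e ℚ.* d) ℚ.* e ≡ (e ℚ.* e) ℚ.* d
        swap-out = solve-∀ ℚring
        self : ∀ {i} → Sign (ε i) → d i ≡ (ι (ε i) ℚ.* d i) ℚ.* ι (ε i)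
        self {i} s = sym (trans (swap-out (ι (ε i)) (d i)) (trans (cong (ℚ._* d i) (square s)) (ℚP.*-identityˡ (d i))))
        on-axis : ∀ i → Dec (even (w i) ≡ b) → Dec (i ≡ i₀) → d i ≡ τ ℚ.* ι (ε i)
        -- A coordinate at rest is fixed by walls through `x`: a partner has the same parity and
        -- hence rests too.
        on-axis i (no neq) _ = trans ([ (λ pin → pinned⇒fixed {w} {ε} {d} pin (unmoved neq) vanishes)
            , (λ { (j , j≢i , par) → partner⇒fixed {w} {ε} {d} j≢i (sym par) (unmoved neq) (unmoved λ eq → neq (trans (sym par) eq)) vanishes }) ]′
            (vertex-tight {w} {x} rep vx i))
          (sym (trans (cong (λ e → τ ℚ.* ι e) (unmoved neq)) (trans (cong (τ ℚ.*_) (ι≡ 0ℤ)) (ℚP.*-zeroʳ τ))))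
        on-axis i (yes eq) (yes refl) = self (moved eq)
        on-axis i (yes eq) (no i≢i₀) = trans (self (moved eq)) (cong (ℚ._* ι (ε i)) balanced)
          where
          -- This root is constant along the edge, as its two contributions cancel, and integral at
          -- `x` by equal parity; its vanishing on `d` ties the coordinate `i` to `i₀`.
          φ : Form n
          φ = form (ε i) i (ℤ.- ε i₀) i₀
          level : evℤ φ ε ≡ 0ℤ
          level = trans (cong₂ ℤ._+_ (sign-square (moved eq)) (trans (sym (ℤP.neg-distribˡ-* (ε i₀) (ε i₀))) (cong ℤ.-_ (sign-square sign₀)))) refl
          evφ≡0 : evℚ φ d ≡ 0ℚ
          evφ≡0 = vanishes φ (long (i≢i₀ , moved eq , sign-neg sign₀)) level
            (same-parity⇒2∣ev {w = w} {ε i} {ℤ.- ε i₀} {i} {i₀} (moved eq) (sign-neg sign₀) (trans eq (sym eq₀)))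
          minus : ∀ a e d → a ℚ.+ (ℚ.- e) ℚ.* d ≡ a ℚ.- e ℚ.* d
          minus = solve-∀ ℚring
          balanced : ι (ε i) ℚ.* d i ≡ τ
          balanced = x-y≡0⇒x≡y (trans (sym (trans (cong (λ e → ι (ε i) ℚ.* d i ℚ.+ e ℚ.* d i₀) (ι-neg (ε i₀))) (minus (ι (ε i) ℚ.* d i) (ι (ε i₀)) (d i₀)))) evφ≡0)

  -- From o + m eᵢ with m integral, a whole unit along eᵢ.
  leap : (∀ {φ} → F φ → Longᶠ φ ⊎ Shortᶠ φ) → ∀ {w x i₀} → Rep F o (+ 2) w x → Vertexᶠ F V x →
    (∀ k → k ≢ i₀ → w k ≡ 0ℤ) → even (w i₀) ≡ true → (∀ i → i ≢ i₀ → ∃ λ j → j ≢ i × j ≢ i₀) →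
    Reaches x (λ k → w k ℤ.+ δ i₀ k ℤ.* (+ 2 ℤ.* toward (w i₀)))
  leap simple {w} {x} {i₀} rep vx on-axis even₀ third = y , vy , rep′ ,
      inj₂ (adjacentᶠ {+ 2} {w} {ε} {x} {y} 0<2 rep rep′ vx vy (some-nonzero {ε} {i₀} nonzero) short line)
    where
    σ = toward (w i₀)
    ε : Fin n → ℤ
    ε k = δ i₀ k ℤ.* (+ 2 ℤ.* σ)
    w′ : Fin n → ℤ
    w′ k = w k ℤ.+ ε k
    ε₀ : ε i₀ ≡ + 2 ℤ.* σ
    ε₀ = trans (cong (ℤ._* (+ 2 ℤ.* σ)) (⟦⟧-yes (i₀ ≟ i₀) refl)) (ℤP.*-identityˡ (+ 2 ℤ.* σ))
    ε-off : ∀ {k} → k ≢ i₀ → ε k ≡ 0ℤ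
    ε-off {k} k≢ = trans (cong (ℤ._* (+ 2 ℤ.* σ)) (⟦⟧-no (k ≟ i₀) k≢)) (ℤP.*-zeroˡ (+ 2 ℤ.* σ))
    all-even : ∀ k → even (w k) ≡ true
    all-even k = go (k ≟ i₀)
      where
      go : Dec (k ≡ i₀) → even (w k) ≡ true
      go (yes refl) = even₀
      go (no k≢) = cong even (on-axis k k≢)
    2∣ε : ∀ k → + 2 ∣ ε k
    2∣ε k = divides (δ i₀ k ℤ.* σ) (lin (δ i₀ k) σ)
      where
      lin : ∀ a s → a ℤ.* (+ 2 ℤ.* s) ≡ (a ℤ.* s) ℤ.* + 2
      lin = ℤSolver.solve-∀
    y = proj₁ (realise (+ 2) w′ 0<2)
    rep′ = proj₂ (proj₂ (realise (+ 2) w′ 0<2))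
    vy : Vertexᶠ F V y
    vy = uniform⇒vertex {w′} {y} {true} rep′ (λ k → ∣⇒even (∣m∣n⇒∣m+n (even⇒∣ {w k} (all-even k)) (2∣ε k)))
    ∣ε∣≤2 : ∀ k → ℤ.∣ ε k ∣ ℕ.≤ 2
    ∣ε∣≤2 k = subst (ℕ._≤ 2) (sym (ℤP.abs-* (δ i₀ k) (+ 2 ℤ.* σ))) (ℕP.≤-trans (ℕP.*-monoˡ-≤ ℤ.∣ + 2 ℤ.* σ ∣ (∣δ∣≤1 i₀ k))
      (ℕP.≤-reflexive (trans (ℕP.*-identityˡ ℤ.∣ + 2 ℤ.* σ ∣) (trans (ℤP.abs-* (+ 2) σ) (cong (2 ℕ.*_) (∣sign∣ (toward-sign (w i₀))))))))
    nonzero : ε i₀ ≢ 0ℤ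
    nonzero ε≡0 = contradiction (trans (sym (trans (ℤP.abs-* (+ 2) σ) (cong (2 ℕ.*_) (∣sign∣ (toward-sign (w i₀)))))) (cong ℤ.∣_∣ (trans (sym ε₀) ε≡0))) λ ()
    -- All entries are even, so every root is integral at `x` and may change by a whole unit. A long
    -- or short root meets `i₀` at most once, with coefficient of absolute value 1; a doubled one
    -- would change by two units.
    short : ∀ φ → F φ → (ℤ.∣ evℤ φ ε ∣ ℕ.≤ 1) ⊎ (+ 2 ∣ evℤ φ w × + ℤ.∣ evℤ φ ε ∣ ℤ.≤ + 2)
    short φ@(form s k t l) Fφ = inj₂ (∣m∣n⇒∣m+n (∣n⇒∣m*n s (even⇒∣ {w k} (all-even k))) (∣n⇒∣m*n t (even⇒∣ {w l} (all-even l))) ,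
      ℤ.+≤+ ([ long-case , short-case ]′ (simple Fφ)))
      where
      short-case : Shortᶠ φ → ℤ.∣ evℤ φ ε ∣ ℕ.≤ 2
      short-case (_ , ss , refl) = subst (λ a → ℤ.∣ a ∣ ℕ.≤ 2) (sym (ℤP.+-identityʳ (s ℤ.* ε k)))
        (ℕP.≤-trans (∣coef*∣≤ (inj₁ ss) (ε k)) (∣ε∣≤2 k))
      long-case : Longᶠ φ → ℤ.∣ evℤ φ ε ∣ ℕ.≤ 2
      long-case (k≢l , ss , st) = ℕP.≤-trans (∣evℤ∣≤ {s = s} {t} {k} {l} ε (inj₁ ss) (inj₁ st)) (go (k ≟ i₀))
        where
        go : Dec (k ≡ i₀) → ℤ.∣ ε k ∣ ℕ.+ ℤ.∣ ε l ∣ ℕ.≤ 2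
        go (yes refl) = ℕP.+-mono-≤ (∣ε∣≤2 k) (ℕP.≤-reflexive (cong ℤ.∣_∣ (ε-off λ l≡k → k≢l (sym l≡k))))
        go (no k≢) = ℕP.+-mono-≤ (ℕP.≤-reflexive (cong ℤ.∣_∣ (ε-off k≢))) (∣ε∣≤2 l)
    line : ∀ d → VanishesOn w ε d → ∃ λ τ → ∀ φ → F φ → evℚ φ d ≡ τ ℚ.* ι (evℤ φ ε)
    line d vanishes = τ , collinear {ε} {d} {τ} λ i → on-line i (i ≟ i₀)
      where
      -- The coordinate `i₀` of `ε` is 2σ, whose inverse is σ / 2.
      τ = (½ ℚ.* ι σ) ℚ.* d i₀
      lin : ∀ h s d u → ((h ℚ.* s) ℚ.* d) ℚ.* (u ℚ.* s) ≡ ((h ℚ.* u) ℚ.* (s ℚ.* s)) ℚ.* d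
      lin = solve-∀ ℚring
      on-line : ∀ i → Dec (i ≡ i₀) → d i ≡ τ ℚ.* ι (ε i)
      on-line i (yes refl) = sym (begin
        τ ℚ.* ι (ε i) ≡⟨ cong (λ e → τ ℚ.* e) (trans (cong ι ε₀) (ι-* (+ 2) σ)) ⟩
        τ ℚ.* (ι (+ 2) ℚ.* ι σ) ≡⟨ lin ½ (ι σ) (d i) (ι (+ 2)) ⟩
        ((½ ℚ.* ι (+ 2)) ℚ.* (ι σ ℚ.* ι σ)) ℚ.* d i ≡⟨ cong (ℚ._* d i) (cong₂ ℚ._*_ (cong (½ ℚ.*_) (ι≡ (+ 2)))
          (trans (sym (ι-* σ σ)) (trans (cong ι (sign-square (toward-sign (w i)))) (ι≡ 1ℤ)))) ⟩
        1ℚ ℚ.* d i ≡⟨ ℚP.*-identityˡ (d i) ⟩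
        d i ∎)
        where open ≡-Reasoning
      -- The partner that fixes `i` must itself be at rest, so it has to differ from `i₀` as well.
      on-line i (no i≢) = let (j , j≢i , j≢i₀) = third i i≢ in
        trans (partner⇒fixed {w} {ε} {d} j≢i (trans (all-even i) (sym (all-even j))) (ε-off i≢) (ε-off j≢i₀) vanishes)
          (sym (trans (cong (λ e → τ ℚ.* ι e) (ε-off i≢)) (trans (cong (τ ℚ.*_) (ι≡ 0ℤ)) (ℚP.*-zeroʳ τ))))

  BoundedBy : ℕ → (Fin n → ℤ) → Set
  BoundedBy r w = ∀ φ → F φ → evℤ φ w ℤ.≤ + 2 ℤ.* + r

  step-from : (∀ r {w x} → Rep F o (+ 2) w x → Vertexᶠ F V x → BoundedBy (suc r) w → ∃ λ w′ → Reaches x w′ × BoundedBy r w′) → Descends F V o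
  step-from descend r {x} vx bound =
    let (w , rep) = half-integral {x} vx
        (w′ , (y , vy , rep′ , near) , bound′) = descend r {w} {x} rep vx (λ φ Fφ → bound⇒ev {+ 2} {w} {x} {+ suc r} {φ} 0<2 rep Fφ (bound φ Fφ))
    in y , vy , near , λ φ Fφ → ev⇒bound {+ 2} {w′} {y} {+ r} {φ} 0<2 rep′ Fφ (bound′ φ Fφ)

  PairBound : ℕ → (Fin n → ℤ) → Set
  PairBound r w = ∀ {i j} → i ≢ j → ℤ.∣ w i ∣ ℕ.+ ℤ.∣ w j ∣ ℕ.≤ 2 ℕ.* r

  -- Signs matched to `w` pick the largest value among the long roots on `i` and `j`, which turns a
  -- bound on roots into one on absolute values. The case of equal indices gives the doubled roots
  -- of type C.
  abs-form : ∀ {w : Fin n → ℤ} i j → evℤ (form (sgn (w i)) i (sgn (w j)) j) w ≡ + (ℤ.∣ w i ∣ ℕ.+ ℤ.∣ w j ∣)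
  abs-form {w} i j = trans (cong₂ ℤ._+_ (sgn* (w i)) (sgn* (w j))) (sym (ℤP.pos-+ ℤ.∣ w i ∣ ℤ.∣ w j ∣))

  pair-bound : ∀ {r w} → BoundedBy r w → PairBound r w
  pair-bound {r} {w} bound {i} {j} i≢j = ℤP.drop‿+≤+ (subst₂ ℤ._≤_ (abs-form {w} i j) (sym (ℤP.pos-* 2 r))
    (bound _ (long (i≢j , sgn-sign (w i) , sgn-sign (w j)))))

  ∣∣-bounded : ∀ {r a} → ℤ.∣ a ∣ ℕ.≤ 2 ℕ.* r → a ℤ.≤ + 2 ℤ.* + r
  ∣∣-bounded {r} {a} le = subst (a ℤ.≤_) (ℤP.pos-* 2 r) (proj₂ (∣i∣≤n⇒bounds le))

  module _ (simple : ∀ {φ} → F φ → Longᶠ φ ⊎ Shortᶠ φ) (third : ∀ (i j : Fin n) → i ≢ j → ∃ λ k → k ≢ i × k ≢ j) where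

    pair-bound⇒bounded : ∀ {r w} → PairBound r w → BoundedBy r w
    pair-bound⇒bounded {r} {w} pairs φ@(form s k t l) Fφ = ∣∣-bounded {r} {evℤ φ w} ([ long-case , short-case ]′ (simple Fφ))
      where
      long-case : Longᶠ φ → ℤ.∣ evℤ φ w ∣ ℕ.≤ 2 ℕ.* r
      long-case (k≢l , ss , st) = ℕP.≤-trans (∣evℤ∣≤ {s = s} {t} {k} {l} w (inj₁ ss) (inj₁ st)) (pairs k≢l)
      short-case : Shortᶠ φ → ℤ.∣ evℤ φ w ∣ ℕ.≤ 2 ℕ.* r
      short-case (_ , ss , refl) = subst (λ a → ℤ.∣ a ∣ ℕ.≤ 2 ℕ.* r) (sym (ℤP.+-identityʳ (s ℤ.* w k)))
        (ℕP.≤-trans (∣coef*∣≤ (inj₁ ss) (w k)) (ℕP.≤-trans (ℕP.m≤m+n ℤ.∣ w k ∣ _) (pairs λ eq → proj₂ (other k) (sym eq))))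

    -- Moving the half-integral coordinates towards 0 fails only if two integral
    -- ones attain the bound; then either all the others are 0 and one leaps,
    -- or moving the integral coordinates works.
    simple-step : Descends F V o
    simple-step = step-from λ r {w} {x} rep vx bound →
      descend r {w} {x} rep vx (pair-bound {suc r} {w} bound)
        (any? λ i → any? λ j → ¬? (i ≟ j) ×-dec (2 ℕ.* r ℕ.<? ℤ.∣ w i ℤ.+ stepTo false (w i) ∣ ℕ.+ ℤ.∣ w j ℤ.+ stepTo false (w j) ∣))
      where
      descend : ∀ r {w x} → Rep F o (+ 2) w x → Vertexᶠ F V x → PairBound (suc r) w →
        Dec (∃ λ i → ∃ λ j → i ≢ j × 2 ℕ.* r ℕ.< ℤ.∣ w i ℤ.+ stepTo false (w i) ∣ ℕ.+ ℤ.∣ w j ℤ.+ stepTo false (w j) ∣) →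
        ∃ λ w′ → Reaches x w′ × BoundedBy r w′
      descend r {w} {x} rep vx pairs (no none) = _ , move false {w} {x} rep vx ,
        pair-bound⇒bounded {r} {λ i → w i ℤ.+ stepTo false (w i)} (λ {i} {j} i≢j → ℕP.≮⇒≥ λ lt → none (i , j , i≢j , lt))
      descend r {w} {x} rep vx pairs (yes (i , j , i≢j , exceeds)) = cases (f i ℕ.≟ 0) (f j ℕ.≟ 0)
        where
        f g : Fin n → ℕ
        f k = ℤ.∣ w k ∣
        g k = ℤ.∣ w k ℤ.+ stepTo false (w k) ∣
        g≤f : ∀ k → g k ℕ.≤ f k
        g≤f k = [ (λ c → subst (g k ℕ.≤_) (sym (proj₂ c)) (ℕP.n≤1+n (g k))) , (λ c → ℕP.≤-reflexive (proj₂ c)) ]′ (odd-move (w k))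
        2∣g : ∀ k → 2 ℕ∣.∣ g k
        2∣g k = ∣⇒∣ᵤ (even⇒∣ {w k ℤ.+ stepTo false (w k)} (even-stepTo false (w k)))
        -- After the move all entries are even, so a sum above 2r is already at least 2(r + 1). As
        -- the sum did not exceed this before, neither `i` nor `j` has moved, and both entries are
        -- even.
        attained : g i ℕ.+ g j ℕ.≥ 2 ℕ.* suc r
        attained = above (ℕ∣.∣m∣n⇒∣m+n (2∣g i) (2∣g j)) exceeds
          where
          above : ∀ {N} → 2 ℕ∣.∣ N → 2 ℕ.* r ℕ.< N → 2 ℕ.* suc r ℕ.≤ N
          above (ℕ∣.divides c refl) lt = ℕP.≤-trans (ℕP.*-monoʳ-≤ 2 (ℕP.*-cancelˡ-< 2 r c (subst (2 ℕ.* r ℕ.<_) (ℕP.*-comm c 2) lt)))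
            (ℕP.≤-reflexive (ℕP.*-comm 2 c))
        f≤g : f i ℕ.+ f j ℕ.≤ g i ℕ.+ g j
        f≤g = ℕP.≤-trans (pairs i≢j) attained
        f≡ : f i ℕ.+ f j ≡ 2 ℕ.* suc r
        f≡ = ℕP.≤-antisym (pairs i≢j) (ℕP.≤-trans attained (ℕP.+-mono-≤ (g≤f i) (g≤f j)))
        even-at : ∀ k → f k ℕ.≤ g k → even (w k) ≡ true
        even-at k le = [ (λ c → contradiction (subst (ℕ._≤ g k) (proj₂ c) le) (ℕP.n≮n (g k))) , proj₁ ]′ (odd-move (w k))
        even-i : even (w i) ≡ true
        even-i = even-at i (ℕP.+-cancelʳ-≤ (f j) (f i) (g i) (ℕP.≤-trans f≤g (ℕP.+-monoʳ-≤ (g i) (g≤f j))))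
        even-j : even (w j) ≡ true
        even-j = even-at j (ℕP.+-cancelˡ-≤ (f i) (f j) (g j) (ℕP.≤-trans f≤g (ℕP.+-monoˡ-≤ (g j) (g≤f i))))
        double-suc : 2 ℕ.* suc r ≡ suc (suc (2 ℕ.* r))
        double-suc = ℕP.*-suc 2 r
        j≢i : j ≢ i
        j≢i eq = i≢j (sym eq)
        -- The pair of `i` and `j` attains the maximum, so replacing one member by `k` cannot
        -- increase the sum.
        ≤j : ∀ k → k ≢ i → f k ℕ.≤ f j
        ≤j k k≢i = ℕP.+-cancelˡ-≤ (f i) (f k) (f j) (ℕP.≤-trans (pairs λ eq → k≢i (sym eq)) (ℕP.≤-reflexive (sym f≡)))
        ≤i : ∀ k → k ≢ j → f k ℕ.≤ f i
        ≤i k k≢j = ℕP.+-cancelʳ-≤ (f j) (f k) (f i) (ℕP.≤-trans (pairs k≢j) (ℕP.≤-reflexive (sym f≡)))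
        leap-at : ∀ i₀ → even (w i₀) ≡ true → f i₀ ≡ 2 ℕ.* suc r → (∀ k → k ≢ i₀ → f k ≡ 0) → ∃ λ w′ → Reaches x w′ × BoundedBy r w′
        leap-at i₀ even₀ f₀ others = w′ , leap simple {w} {x} {i₀} rep vx (λ k k≢ → ℤP.∣i∣≡0⇒i≡0 (others k k≢)) even₀ (λ k → third k i₀) ,
          pair-bound⇒bounded {r} {w′} λ {k} {l} k≢l → pair k≢l (k ≟ i₀)
          where
          w′ : Fin n → ℤ
          w′ k = w k ℤ.+ δ i₀ k ℤ.* (+ 2 ℤ.* toward (w i₀))
          at₀ : ℤ.∣ w′ i₀ ∣ ≡ 2 ℕ.* r
          at₀ = trans (cong (λ d → ℤ.∣ w i₀ ℤ.+ d ∣) (trans (cong (ℤ._* (+ 2 ℤ.* toward (w i₀))) (⟦⟧-yes (i₀ ≟ i₀) refl)) (ℤP.*-identityˡ (+ 2 ℤ.* toward (w i₀)))))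
            (∣+2toward∣ (w i₀) (trans f₀ double-suc))
          off₀ : ∀ {k} → k ≢ i₀ → ℤ.∣ w′ k ∣ ≡ 0
          off₀ {k} k≢ = trans (cong (λ d → ℤ.∣ w k ℤ.+ d ∣) (trans (cong (ℤ._* (+ 2 ℤ.* toward (w i₀))) (⟦⟧-no (k ≟ i₀) k≢)) (ℤP.*-zeroˡ (+ 2 ℤ.* toward (w i₀)))))
            (trans (cong ℤ.∣_∣ (ℤP.+-identityʳ (w k))) (others k k≢))
          ≤2r : ∀ k → ℤ.∣ w′ k ∣ ℕ.≤ 2 ℕ.* r
          ≤2r k = go (k ≟ i₀)
            where
            go : Dec (k ≡ i₀) → ℤ.∣ w′ k ∣ ℕ.≤ 2 ℕ.* r
            go (yes refl) = ℕP.≤-reflexive at₀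
            go (no k≢) = subst (ℕ._≤ 2 ℕ.* r) (sym (off₀ k≢)) ℕ.z≤n
          pair : ∀ {k l} → k ≢ l → Dec (k ≡ i₀) → ℤ.∣ w′ k ∣ ℕ.+ ℤ.∣ w′ l ∣ ℕ.≤ 2 ℕ.* r
          pair {k} {l} k≢l (yes refl) = subst (λ a → ℤ.∣ w′ k ∣ ℕ.+ a ℕ.≤ 2 ℕ.* r) (sym (off₀ λ eq → k≢l (sym eq)))
            (subst (ℕ._≤ 2 ℕ.* r) (sym (ℕP.+-identityʳ ℤ.∣ w′ k ∣)) (≤2r k))
          pair {k} {l} k≢l (no k≢) = subst (λ a → a ℕ.+ ℤ.∣ w′ l ∣ ℕ.≤ 2 ℕ.* r) (sym (off₀ k≢)) (≤2r l)
        cases : Dec (f i ≡ 0) → Dec (f j ≡ 0) → ∃ λ w′ → Reaches x w′ × BoundedBy r w′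
        -- If the entry at `i` is 0, extremality of the pair makes all entries other than `j`
        -- vanish, and the entry at `j` carries the whole bound.
        cases (yes fi≡0) _ = leap-at j even-j (trans (cong (ℕ._+ f j) (sym fi≡0)) f≡) λ k k≢j → ℕP.n≤0⇒n≡0 (subst (f k ℕ.≤_) fi≡0 (≤i k k≢j))
        cases (no _) (yes fj≡0) = leap-at i even-i (trans (sym (ℕP.+-identityʳ (f i))) (trans (cong (f i ℕ.+_) (sym fj≡0)) f≡))
          λ k k≢i → ℕP.n≤0⇒n≡0 (subst (f k ℕ.≤_) fj≡0 (≤j k k≢i))
        cases (no fi≢0) (no fj≢0) = w′ , move true {w} {x} rep vx , pair-bound⇒bounded {r} {w′} λ {k} {l} k≢l → reduce (pair k≢l (k ≟ i) (l ≟ j))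
          where
          w′ : Fin n → ℤ
          w′ k = w k ℤ.+ stepTo true (w k)
          -- Both `f i` and `f j` are even and nonzero, so either can be the bound in `even-move`.
          -- Each member of a pair then lies strictly below its own bound, and the sum drops by the
          -- required 2.
          <j : ∀ {k} → k ≢ i → suc ℤ.∣ w′ k ∣ ℕ.≤ f j
          <j {k} k≢i = even-move (w k) (≤j k k≢i) (∣⇒∣ᵤ (even⇒∣ {w j} even-j)) fj≢0
          <i : ∀ {k} → k ≢ j → suc ℤ.∣ w′ k ∣ ℕ.≤ f i
          <i {k} k≢j = even-move (w k) (≤i k k≢j) (∣⇒∣ᵤ (even⇒∣ {w i} even-i)) fi≢0
          pair : ∀ {k l} → k ≢ l → Dec (k ≡ i) → Dec (l ≡ j) → suc ℤ.∣ w′ k ∣ ℕ.+ suc ℤ.∣ w′ l ∣ ℕ.≤ f i ℕ.+ f j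
          pair {k} {l} k≢l (yes refl) _ = ℕP.+-mono-≤ (<i i≢j) (<j λ eq → k≢l (sym eq))
          pair {k} {l} k≢l (no k≢i) (no l≢j) = subst (suc ℤ.∣ w′ k ∣ ℕ.+ suc ℤ.∣ w′ l ∣ ℕ.≤_) (ℕP.+-comm (f j) (f i)) (ℕP.+-mono-≤ (<j k≢i) (<i l≢j))
          pair {k} {l} k≢l (no k≢i) (yes refl) = ℕP.+-mono-≤ (<i k≢l) (<j j≢i)
          reduce : ∀ {a b} → suc a ℕ.+ suc b ℕ.≤ f i ℕ.+ f j → a ℕ.+ b ℕ.≤ 2 ℕ.* r
          reduce {a} {b} le = ℕP.≤-pred (ℕP.≤-pred (subst₂ ℕ._≤_ (cong suc (ℕP.+-suc a b)) (trans f≡ double-suc) le))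

  module _ (double : ∀ {φ} → Doubleᶠ φ → F φ) where

    -- The roots 2eᵢ make the bound one on single coordinates: at most r + 1 half-units. Only
    -- entries with the parity of r + 1 can attain it, so exactly those are moved.
    double-step : Descends F V o
    double-step = step-from λ r {w} {x} rep vx bound → descend r {w} {x} rep vx (coordinate-bound {suc r} {w} bound) (2 ℕ∣.∣? suc r)
      where
      coordinate-bound : ∀ {r w} → BoundedBy r w → ∀ i → ℤ.∣ w i ∣ ℕ.≤ r
      coordinate-bound {r} {w} bound i = ℕP.*-cancelˡ-≤ 2 (ℤP.drop‿+≤+ (subst₂ ℤ._≤_
        (trans (abs-form {w} i i) (cong (λ a → + (ℤ.∣ w i ∣ ℕ.+ a)) (sym (ℕP.+-identityʳ ℤ.∣ w i ∣)))) (sym (ℤP.pos-* 2 r))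
        (bound _ (double (refl , sgn-sign (w i) , refl)))))
      coordinate-bound⁻¹ : ∀ {r w} → (∀ i → ℤ.∣ w i ∣ ℕ.≤ r) → BoundedBy r w
      coordinate-bound⁻¹ {r} {w} le φ@(form s k t l) Fφ = ∣∣-bounded {r} {evℤ φ w} (ℕP.≤-trans (∣evℤ∣≤ {s = s} {t} {k} {l} w (proj₁ (coefs Fφ)) (proj₂ (coefs Fφ)))
        (subst (ℤ.∣ w k ∣ ℕ.+ ℤ.∣ w l ∣ ℕ.≤_) (cong (r ℕ.+_) (sym (ℕP.+-identityʳ r))) (ℕP.+-mono-≤ (le k) (le l))))
      descend : ∀ r {w x} → Rep F o (+ 2) w x → Vertexᶠ F V x → (∀ i → ℤ.∣ w i ∣ ℕ.≤ suc r) → Dec (2 ℕ∣.∣ suc r) →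
        ∃ λ w′ → Reaches x w′ × BoundedBy r w′
      descend r {w} {x} rep vx le (yes 2∣) = _ , move true {w} {x} rep vx , coordinate-bound⁻¹ {r} λ i → ℕP.≤-pred (even-move (w i) (le i) 2∣ λ ())
      descend r {w} {x} rep vx le (no 2∤) = _ , move false {w} {x} rep vx , coordinate-bound⁻¹ {r} λ i →
        [ (λ c → ℕP.≤-pred (subst (ℕ._≤ suc r) (proj₂ c) (le i)))
        , (λ c → subst (ℕ._≤ r) (sym (proj₂ c)) (ℕP.≤-pred (ℕP.≤∧≢⇒< (le i) λ eq → 2∤ (subst (2 ℕ∣.∣_) eq (∣⇒∣ᵤ (even⇒∣ {w i} (proj₁ c))))))) ]′ (odd-move (w i))

-- Type A

Diffᶠ : ∀ {m} → Form m → Set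
Diffᶠ (form s i t j) = i ≢ j × s ≡ 1ℤ × t ≡ -1ℤ

evℚ-diff : ∀ {m} {i j : Fin m} d → evℚ (form 1ℤ i -1ℤ j) d ≡ d i ℚ.- d j
evℚ-diff {i = i} {j} d = trans (cong₂ (λ u v → u ℚ.* d i ℚ.+ v ℚ.* d j) (ι≡ 1ℤ) (trans (ι-neg 1ℤ) (cong ℚ.-_ (ι≡ 1ℤ))))
  (trans (lin 1ℚ (d i) (d j)) (cong₂ ℚ._-_ (ℚP.*-identityˡ (d i)) (ℚP.*-identityˡ (d j))))
  where
  lin : ∀ u a b → u ℚ.* a ℚ.+ (ℚ.- u) ℚ.* b ≡ u ℚ.* a ℚ.- u ℚ.* b
  lin = solve-∀ ℚring

evℤ-diff : ∀ {m} {i j : Fin m} w → evℤ (form 1ℤ i -1ℤ j) w ≡ w i ℤ.- w j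
evℤ-diff {i = i} {j} w = lin (w i) (w j)
  where
  lin : ∀ a b → 1ℤ ℤ.* a ℤ.+ -1ℤ ℤ.* b ≡ a ℤ.- b
  lin = ℤSolver.solve-∀

total : ∀ {m} → Pt m → ℚ
total = foldr _ ℚ._+_ 0ℚ

total-+ : ∀ {m} (x y : Pt m) → total (x +ₚ y) ≡ total x ℚ.+ total y
total-+ [] [] = refl
total-+ (a ∷ x) (b ∷ y) = trans (cong ((a ℚ.+ b) ℚ.+_) (total-+ x y)) (lin a b (total x) (total y))
  where
  lin : ∀ a b c d → (a ℚ.+ b) ℚ.+ (c ℚ.+ d) ≡ (a ℚ.+ c) ℚ.+ (b ℚ.+ d)
  lin = solve-∀ ℚring

total-- : ∀ {m} (x y : Pt m) → total (x -ₚ y) ≡ total x ℚ.- total y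
total-- [] [] = refl
total-- (a ∷ x) (b ∷ y) = trans (cong ((a ℚ.- b) ℚ.+_) (total-- x y)) (lin a b (total x) (total y))
  where
  lin : ∀ a b c d → (a ℚ.- b) ℚ.+ (c ℚ.- d) ≡ (a ℚ.+ c) ℚ.- (b ℚ.+ d)
  lin = solve-∀ ℚring

total-· : ∀ {m} c (x : Pt m) → total (c ·ₚ x) ≡ c ℚ.* total x
total-· c [] = sym (ℚP.*-zeroʳ c)
total-· c (a ∷ x) = trans (cong (c ℚ.* a ℚ.+_) (total-· c x)) (sym (ℚP.*-distribˡ-+ c a (total x)))

total-constant : ∀ {m} (x : Pt m) c → (∀ i → lookup x i ≡ c) → total x ≡ ι (+ m) ℚ.* c
total-constant [] c eqs = sym (trans (cong (ℚ._* c) (ι≡ 0ℤ)) (ℚP.*-zeroˡ c))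
total-constant {suc m} (a ∷ x) c eqs = trans (cong₂ ℚ._+_ (eqs zero) (total-constant x c (λ i → eqs (suc i))))
  (sym (trans (cong (ℚ._* c) (trans (ι-+ 1ℤ (+ m)) (cong (ℚ._+ ι (+ m)) (ι≡ 1ℤ))))
    (trans (ℚP.*-distribʳ-+ c 1ℚ (ι (+ m))) (cong (ℚ._+ ι (+ m) ℚ.* c) (ℚP.*-identityˡ c)))))

module SumZero {n : ℕ} (o : Pt (suc n)) (Vo : total o ≡ 0ℚ)
  (o-lattice : ∀ φ → Diffᶠ φ → ∃ λ K → val φ o ≡ ι K) where

  V : Pt (suc n) → Set
  V x = total x ≡ 0ℚ

  V-seg : ∀ {x y} t → V x → V y → V (seg x y t)
  V-seg {x} {y} t Vx Vy = trans (total-+ x (t ·ₚ (y -ₚ x))) (trans (cong (total x ℚ.+_) (trans (total-· t (y -ₚ x)) (cong (t ℚ.*_) (total-- y x))))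
    (trans (cong₂ (λ a b → a ℚ.+ t ℚ.* (b ℚ.- a)) Vx Vy) (trans (ℚP.+-identityˡ (t ℚ.* 0ℚ)) (ℚP.*-zeroʳ t))))

  -- Equal coordinate differences make x - y a constant vector, and its coordinate sum 0 then makes
  -- the constant 0.
  separated : ∀ {x y} → V x → V y → (∀ φ → Diffᶠ φ → val φ x ≡ val φ y) → x ≡ y
  separated {x} {y} Vx Vy eqs = trans (sym (VecP.tabulate∘lookup x)) (trans (VecP.tabulate-cong same) (VecP.tabulate∘lookup y))
    where
    d : Fin (suc n) → ℚ
    d i = lookup x i ℚ.- lookup y i
    level : ∀ i → Dec (i ≡ zero) → d i ≡ d zero
    level i (yes refl) = refl
    level i (no i≢0) = x-y≡0⇒x≡y (trans (sym (evℚ-diff {i = i} {zero} d)) (trans (evℚ-- φ (lookup x) (lookup y)) (x≡y⇒x-y≡0 (eqs φ (i≢0 , refl , refl)))))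
      where
      φ : Form (suc n)
      φ = form 1ℤ i -1ℤ zero
    d₀≡0 : d zero ≡ 0ℚ
    d₀≡0 = *-cancelˡ-pos (0<ι {+ suc n} (ℤ.+<+ ℕ.z<s)) (trans (sym (total-constant (x -ₚ y) (d zero) λ i → trans (VecP.lookup-zipWith ℚ._-_ i x y) (level i (i ≟ zero))))
      (trans (total-- x y) (trans (cong₂ ℚ._-_ Vx Vy) (sym (ℚP.*-zeroʳ (ι (+ suc n)))))))
    same : ∀ i → lookup x i ≡ lookup y i
    same i = x-y≡0⇒x≡y (trans (level i (i ≟ zero)) d₀≡0)

  -- Subtracting the mean brings the displacement into the hyperplane of sum 0 and leaves all
  -- differences unchanged.
  realise : ∀ q w → 0ℤ ℤ.< q → ∃ λ z → V z × Rep Diffᶠ o q w z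
  realise q w 0<q = z , Vz , rep
    where
    instance
      ιq-pos : ℚ.Positive (ι q)
      ιq-pos = ι-pos 0<q
      ιq≢0 : ℚ.NonZero (ι q)
      ιq≢0 = ℚP.pos⇒nonZero (ι q)
      ιm-pos : ℚ.Positive (ι (+ suc n))
      ιm-pos = ι-pos (ℤ.+<+ ℕ.z<s)
      ιm≢0 : ℚ.NonZero (ι (+ suc n))
      ιm≢0 = ℚP.pos⇒nonZero (ι (+ suc n))
    v : ℚ
    v = ℚ.1/ ι q
    ws : Pt (suc n)
    ws = tabulate λ i → ι (w i)
    mean = ℚ.1/ ι (+ suc n) ℚ.* total ws
    means centred : Pt (suc n)
    means = tabulate λ _ → mean
    centred = ws -ₚ means
    z : Pt (suc n)
    z = o +ₚ (v ·ₚ centred)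
    centred≡0 : total centred ≡ 0ℚ
    centred≡0 = trans (total-- ws means) (x≡y⇒x-y≡0 (sym (begin
      total means ≡⟨ total-constant means mean (VecP.lookup∘tabulate λ _ → mean) ⟩
      ι (+ suc n) ℚ.* mean ≡⟨ ℚP.*-assoc (ι (+ suc n)) _ (total ws) ⟨
      (ι (+ suc n) ℚ.* ℚ.1/ ι (+ suc n)) ℚ.* total ws ≡⟨ cong (ℚ._* total ws) (ℚP.*-inverseʳ (ι (+ suc n))) ⟩
      1ℚ ℚ.* total ws ≡⟨ ℚP.*-identityˡ (total ws) ⟩
      total ws ∎)))
      where open ≡-Reasoning
    Vz : V z
    Vz = trans (total-+ o (v ·ₚ centred)) (trans (cong₂ ℚ._+_ Vo (trans (total-· (v) centred) (cong (v ℚ.*_) centred≡0)))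
      (trans (ℚP.+-identityˡ _) (ℚP.*-zeroʳ (v))))
    at : ∀ i → lookup z i ≡ lookup o i ℚ.+ v ℚ.* (ι (w i) ℚ.- mean)
    at i = trans (VecP.lookup-zipWith ℚ._+_ i o (v ·ₚ centred)) (cong (lookup o i ℚ.+_) (trans (VecP.lookup-map i (v ℚ.*_) centred)
      (cong (v ℚ.*_) (trans (VecP.lookup-zipWith ℚ._-_ i ws means) (cong₂ ℚ._-_ (VecP.lookup∘tabulate (λ i → ι (w i)) i) (VecP.lookup∘tabulate (λ _ → mean) i))))))
    rep : Rep Diffᶠ o q w z
    rep φ@(form _ i _ j) (_ , refl , refl) = begin
      ι q ℚ.* (val φ z ℚ.- val φ o) ≡⟨ cong (ι q ℚ.*_) (cong₂ ℚ._-_ (trans (evℚ-diff {i = i} {j} (lookup z)) (cong₂ ℚ._-_ (at i) (at j))) (evℚ-diff {i = i} {j} (lookup o))) ⟩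
      ι q ℚ.* (((lookup o i ℚ.+ v ℚ.* (ι (w i) ℚ.- mean)) ℚ.- (lookup o j ℚ.+ v ℚ.* (ι (w j) ℚ.- mean))) ℚ.- (lookup o i ℚ.- lookup o j))
        ≡⟨ lin (ι q) (v) (lookup o i) (lookup o j) (ι (w i)) (ι (w j)) mean ⟩
      (ι q ℚ.* v) ℚ.* (ι (w i) ℚ.- ι (w j)) ≡⟨ cong (ℚ._* (ι (w i) ℚ.- ι (w j))) (ℚP.*-inverseʳ (ι q)) ⟩
      1ℚ ℚ.* (ι (w i) ℚ.- ι (w j)) ≡⟨ ℚP.*-identityˡ _ ⟩
      ι (w i) ℚ.- ι (w j) ≡⟨ ι-- (w i) (w j) ⟨
      ι (w i ℤ.- w j) ≡⟨ cong ι (evℤ-diff {i = i} {j} w) ⟨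
      ι (evℤ φ w) ∎
      where
      open ≡-Reasoning
      lin : ∀ q v a b c d m → q ℚ.* (((a ℚ.+ v ℚ.* (c ℚ.- m)) ℚ.- (b ℚ.+ v ℚ.* (d ℚ.- m))) ℚ.- (a ℚ.- b)) ≡ (q ℚ.* v) ℚ.* (c ℚ.- d)
      lin = solve-∀ ℚring

  open Apartment Diffᶠ V (λ {x} {y} → V-seg {x} {y}) (λ {x} {y} → separated {x} {y}) o o-lattice realise public

  0<1ℤ : 0ℤ ℤ.< 1ℤ
  0<1ℤ = ℤ.+<+ ℕ.z<s

  1∣ : ∀ a → 1ℤ ∣ a
  1∣ a = divides a (sym (ℤP.*-identityʳ a))

  -- The perturbation is the indicator of the coordinates congruent to the first one modulo `q`. A
  -- root integral at `x` compares two congruent coordinates, so the perturbation vanishes on it; by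
  -- `rigid` it is constant, and all coordinates lie in one class.
  integral-differences : ∀ {x} → Vertexᶠ Diffᶠ V x → ∃ λ w → Rep Diffᶠ o 1ℤ w x
  integral-differences {x} vx = w , rep₁
    where
    cd = common-denominator (λ i → lookup x i ℚ.- lookup o i)
    q = proj₁ cd
    p = proj₁ (proj₂ cd)
    0<q = proj₁ (proj₂ (proj₂ cd))
    rep : Rep Diffᶠ o q p x
    rep = coordinatewise {o = o} {q} {p} {x} (proj₂ (proj₂ (proj₂ cd)))
    η : Fin (suc n) → ℤ
    η j = indicator q (p j ℤ.- p zero)
    ∣η∣≤1 : ∀ j → ℤ.∣ η j ∣ ℕ.≤ 1
    ∣η∣≤1 j with does (q ∣? (p j ℤ.- p zero))
    ... | true = ℕP.≤-refl
    ... | false = ℕ.z≤n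
    small : ∀ φ → Diffᶠ φ → ℤ.∣ evℤ φ η ∣ ℕ.≤ 2
    small (form _ k _ l) (_ , refl , refl) = ℕP.≤-trans (∣evℤ∣≤ {s = 1ℤ} { -1ℤ} {k} {l} η (inj₁ (inj₁ refl)) (inj₁ (inj₂ refl))) (ℕP.+-mono-≤ (∣η∣≤1 k) (∣η∣≤1 l))
    vanish : ∀ φ → Diffᶠ φ → q ∣ evℤ φ p → evℤ φ η ≡ 0ℤ
    vanish (form _ k _ l) (_ , refl , refl) q∣ = trans (evℤ-diff {i = k} {l} η) (ℤP.i≡j⇒i-j≡0 (indicator-cong {q} {p k ℤ.- p zero} {p l ℤ.- p zero}
      (λ q∣k → subst (q ∣_) (lin₁ (p k) (p l) (p zero)) (∣m∣n⇒∣m+n q∣k (∣m⇒∣-m q∣kl)))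
      (λ q∣l → subst (q ∣_) (lin₂ (p k) (p l) (p zero)) (∣m∣n⇒∣m+n q∣l q∣kl))))
      where
      q∣kl : q ∣ p k ℤ.- p l
      q∣kl = subst (q ∣_) (evℤ-diff {i = k} {l} p) q∣
      lin₁ : ∀ a b c → (a ℤ.- c) ℤ.+ ℤ.- (a ℤ.- b) ≡ b ℤ.- c
      lin₁ = ℤSolver.solve-∀
      lin₂ : ∀ a b c → (b ℤ.- c) ℤ.+ (a ℤ.- b) ≡ a ℤ.- c
      lin₂ = ℤSolver.solve-∀
    q∣self : q ∣ p zero ℤ.- p zero
    q∣self = subst (q ∣_) (sym (ℤP.+-inverseʳ (p zero))) ∣0ℤ
    q∣ : ∀ j → Dec (j ≡ zero) → q ∣ p j ℤ.- p zero
    q∣ j (yes refl) = q∣self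
    q∣ j (no j≢0) = indicator≡1⇒∣ {q} {p j ℤ.- p zero} (trans (ℤP.i-j≡0⇒i≡j (η j) (η zero)
      (trans (sym (evℤ-diff {i = j} {zero} η)) (rigid {q} {p} {x} {η} 0<q rep vx small vanish (form 1ℤ j -1ℤ zero) (j≢0 , refl , refl))))
      (indicator-∣ {q} {p zero ℤ.- p zero} q∣self))
    w : Fin (suc n) → ℤ
    w j = _∣_.quotient (q∣ j (j ≟ zero))
    w≡ : ∀ j → p j ℤ.- p zero ≡ w j ℤ.* q
    w≡ j = _∣_.equality (q∣ j (j ≟ zero))
    rep₁ : Rep Diffᶠ o 1ℤ w x
    rep₁ φ@(form _ i _ j) Fφ@(_ , refl , refl) = trans (trans (cong (ℚ._* (val φ x ℚ.- val φ o)) (ι≡ 1ℤ)) (ℚP.*-identityˡ _))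
      (*-cancelˡ-pos (0<ι 0<q) (trans (rep φ Fφ) (trans (cong ι scaled) (ι-* q (evℤ φ w)))))
      where
      open ≡-Reasoning
      lin₁ : ∀ a b c → a ℤ.- b ≡ (a ℤ.- c) ℤ.- (b ℤ.- c)
      lin₁ = ℤSolver.solve-∀
      lin₂ : ∀ a b q → a ℤ.* q ℤ.- b ℤ.* q ≡ q ℤ.* (a ℤ.- b)
      lin₂ = ℤSolver.solve-∀
      scaled : evℤ φ p ≡ q ℤ.* evℤ φ w
      scaled = begin
        evℤ φ p ≡⟨ evℤ-diff {i = i} {j} p ⟩
        p i ℤ.- p j ≡⟨ lin₁ (p i) (p j) (p zero) ⟩
        (p i ℤ.- p zero) ℤ.- (p j ℤ.- p zero) ≡⟨ cong₂ ℤ._-_ (w≡ i) (w≡ j) ⟩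
        w i ℤ.* q ℤ.- w j ℤ.* q ≡⟨ lin₂ (w i) (w j) q ⟩
        q ℤ.* (w i ℤ.- w j) ≡⟨ cong (q ℤ.*_) (evℤ-diff {i = i} {j} w) ⟨
        q ℤ.* evℤ φ w ∎

  -- Every root is integral at `y`; with `integral-differences` this says that in type A all
  -- vertices are special.
  integral⇒vertex : ∀ {w y} → V y → Rep Diffᶠ o 1ℤ w y → Vertexᶠ Diffᶠ V y
  integral⇒vertex {w} {y} Vy rep = vertexᶠ {1ℤ} {w} {y} 0<1ℤ Vy rep λ d vanishes φ Fφ → vanishes φ Fφ (1∣ (evℤ φ w))

  -- If the bound is attained, lower all the largest coordinates by 1.
  lower : ∀ r w {x} → Rep Diffᶠ o 1ℤ w x → Vertexᶠ Diffᶠ V x → (∀ φ → Diffᶠ φ → val φ x ℚ.- val φ o ℚ.≤ ι (+ suc r)) →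
    ∃ λ y → Vertexᶠ Diffᶠ V y × (x ≡ y ⊎ Adjacentᶠ Diffᶠ V x y) × (∀ φ → Diffᶠ φ → val φ y ℚ.- val φ o ℚ.≤ ι (+ r))
  lower r w {x} rep vx bound = go (any? λ i → any? λ j → ¬? (i ≟ j) ×-dec (+ r ℤ.<? w i ℤ.- w j))
    where
    pairs : ∀ {k l} → k ≢ l → w k ℤ.- w l ℤ.≤ + suc r
    pairs {k} {l} k≢l = subst₂ ℤ._≤_ (evℤ-diff {i = k} {l} w) (ℤP.*-identityˡ (+ suc r))
      (bound⇒ev {1ℤ} {w} {x} {+ suc r} {form 1ℤ k -1ℤ l} 0<1ℤ rep (k≢l , refl , refl) (bound _ (k≢l , refl , refl)))
    bounded : ∀ {w′ y} → Rep Diffᶠ o 1ℤ w′ y → (∀ {k l} → k ≢ l → w′ k ℤ.- w′ l ℤ.≤ + r) → ∀ φ → Diffᶠ φ → val φ y ℚ.- val φ o ℚ.≤ ι (+ r)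
    bounded {w′} {y} rep′ le φ@(form _ k _ l) Fφ@(k≢l , refl , refl) = ev⇒bound {1ℤ} {w′} {y} {+ r} {φ} 0<1ℤ rep′ Fφ
      (subst₂ ℤ._≤_ (sym (evℤ-diff {i = k} {l} w′)) (sym (ℤP.*-identityˡ (+ r))) (le k≢l))
    go : Dec (∃ λ i → ∃ λ j → i ≢ j × + r ℤ.< w i ℤ.- w j) →
      ∃ λ y → Vertexᶠ Diffᶠ V y × (x ≡ y ⊎ Adjacentᶠ Diffᶠ V x y) × (∀ φ → Diffᶠ φ → val φ y ℚ.- val φ o ℚ.≤ ι (+ r))
    go (no none) = x , vx , inj₁ refl , bounded {w} {x} rep λ {k} {l} k≢l → ℤP.≮⇒≥ λ lt → none (k , l , k≢l , lt)
    go (yes (i , j , i≢j , exceeds)) = y , vy , inj₂ (adjacentᶠ {1ℤ} {w} {ε} {x} {y} 0<1ℤ rep rep′ vx vy nonzero short line) ,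
        bounded {w′} {y} rep′ λ {k} {l} k≢l → lowered k≢l (w l ℤ.≟ w i)
      where
      attained : w i ℤ.- w j ≡ + suc r
      attained = ℤP.≤-antisym (pairs i≢j) (ℤP.i<j⇒suc[i]≤j exceeds)
      -- Minus the indicator of a set, so every root changes by at most 1. Lowering only some of the
      -- largest coordinates would leave the bound attained at the rest.
      ε w′ : Fin (suc n) → ℤ
      ε k = ℤ.- ⟦ w k ℤ.≟ w i ⟧
      w′ k = w k ℤ.+ ε k
      ε-top : ∀ k → w k ≡ w i → ε k ≡ -1ℤ
      ε-top k eq = cong ℤ.-_ (⟦⟧-yes (w k ℤ.≟ w i) eq)
      ε-low : ∀ k → w k ≢ w i → ε k ≡ 0ℤ
      ε-low k neq = cong ℤ.-_ (⟦⟧-no (w k ℤ.≟ w i) neq)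
      j-low : w j ≢ w i
      j-low eq = contradiction (trans (sym attained) (ℤP.i≡j⇒i-j≡0 (sym eq))) λ ()
      realised = realise 1ℤ w′ 0<1ℤ
      y = proj₁ realised
      rep′ = proj₂ (proj₂ realised)
      vy : Vertexᶠ Diffᶠ V y
      vy = integral⇒vertex {w′} {y} (proj₁ (proj₂ realised)) rep′
      nonzero : ∃ λ φ → Diffᶠ φ × evℤ φ ε ≢ 0ℤ
      nonzero = form 1ℤ i -1ℤ j , (i≢j , refl , refl) , λ eq → contradiction (trans (sym (trans (evℤ-diff {i = i} {j} ε) (cong₂ ℤ._-_ (ε-top i refl) (ε-low j j-low)))) eq) λ ()
      short : ∀ φ → Diffᶠ φ → (ℤ.∣ evℤ φ ε ∣ ℕ.≤ 1) ⊎ (1ℤ ∣ evℤ φ w × + ℤ.∣ evℤ φ ε ∣ ℤ.≤ 1ℤ)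
      short (form _ k _ l) (_ , refl , refl) = inj₁ (subst (λ a → ℤ.∣ a ∣ ℕ.≤ 1) (sym (evℤ-diff {i = k} {l} ε)) (bit (does (w k ℤ.≟ w i)) (does (w l ℤ.≟ w i))))
        where
        bit : ∀ a b → ℤ.∣ ℤ.- (if a then 1ℤ else 0ℤ) ℤ.- ℤ.- (if b then 1ℤ else 0ℤ) ∣ ℕ.≤ 1
        bit true true = ℕ.z≤n
        bit true false = ℕP.≤-refl
        bit false true = ℕP.≤-refl
        bit false false = ℕ.z≤n
      line : ∀ d → (∀ φ → Diffᶠ φ → evℤ φ ε ≡ 0ℤ → 1ℤ ∣ evℤ φ w → evℚ φ d ≡ 0ℚ) → ∃ λ τ → ∀ φ → Diffᶠ φ → evℚ φ d ≡ τ ℚ.* ι (evℤ φ ε)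
      line d vanishes = τ , collinear
        where
        -- `d` is constant on the lowered and on the resting coordinates; `ε` is -1 at `i` and 0 at
        -- `j`, which determines `τ`.
        τ = d j ℚ.- d i
        agree : ∀ k l → ε k ≡ ε l → Dec (k ≡ l) → d k ≡ d l
        agree _ _ _ (yes refl) = refl
        agree k l eq (no k≢l) = x-y≡0⇒x≡y (trans (sym (evℚ-diff {i = k} {l} d)) (vanishes _ (k≢l , refl , refl)
          (trans (evℤ-diff {i = k} {l} ε) (ℤP.i≡j⇒i-j≡0 eq)) (1∣ _)))
        at : ∀ k → Dec (w k ≡ w i) → d k ≡ d j ℚ.+ τ ℚ.* ι (ε k)
        at k (yes top) = trans (agree k i (trans (ε-top k top) (sym (ε-top i refl))) (k ≟ i)) (trans (trans (lin (d i) (d j) 1ℚ) (cong (λ u → d j ℚ.+ u) (drop-1 τ)))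
          (cong (λ e → d j ℚ.+ τ ℚ.* e) (sym (trans (cong ι (ε-top k top)) (trans (ι-neg 1ℤ) (cong ℚ.-_ (ι≡ 1ℤ)))))))
          where
          lin : ∀ a b u → a ≡ b ℚ.+ ((b ℚ.- a) ℚ.* (ℚ.- u) ℚ.+ (b ℚ.- a) ℚ.* (u ℚ.- 1ℚ))
          lin = solve-∀ ℚring
          drop-1 : ∀ t → t ℚ.* (ℚ.- 1ℚ) ℚ.+ t ℚ.* (1ℚ ℚ.- 1ℚ) ≡ t ℚ.* (ℚ.- 1ℚ)
          drop-1 t = trans (cong (t ℚ.* (ℚ.- 1ℚ) ℚ.+_) (ℚP.*-zeroʳ t)) (ℚP.+-identityʳ _)
        at k (no low) = trans (agree k j (trans (ε-low k low) (sym (ε-low j j-low))) (k ≟ j)) (sym (trans (cong (λ e → d j ℚ.+ τ ℚ.* e) (trans (cong ι (ε-low k low)) (ι≡ 0ℤ)))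
          (trans (cong (d j ℚ.+_) (ℚP.*-zeroʳ τ)) (ℚP.+-identityʳ (d j)))))
        collinear : ∀ φ → Diffᶠ φ → evℚ φ d ≡ τ ℚ.* ι (evℤ φ ε)
        collinear (form _ k _ l) (_ , refl , refl) = begin
          evℚ (form 1ℤ k -1ℤ l) d ≡⟨ evℚ-diff {i = k} {l} d ⟩
          d k ℚ.- d l ≡⟨ cong₂ ℚ._-_ (at k (w k ℤ.≟ w i)) (at l (w l ℤ.≟ w i)) ⟩
          (d j ℚ.+ τ ℚ.* ι (ε k)) ℚ.- (d j ℚ.+ τ ℚ.* ι (ε l)) ≡⟨ lin (d j) τ (ι (ε k)) (ι (ε l)) ⟩
          τ ℚ.* (ι (ε k) ℚ.- ι (ε l)) ≡⟨ cong (τ ℚ.*_) (trans (cong ι (evℤ-diff {i = k} {l} ε)) (ι-- (ε k) (ε l))) ⟨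
          τ ℚ.* ι (evℤ (form 1ℤ k -1ℤ l) ε) ∎
          where
          open ≡-Reasoning
          lin : ∀ a t b c → (a ℚ.+ t ℚ.* b) ℚ.- (a ℚ.+ t ℚ.* c) ≡ t ℚ.* (b ℚ.- c)
          lin = solve-∀ ℚring
      -- Compared through `j`: no difference with `w j` exceeds the attained one.
      w≤top : ∀ k → w k ℤ.≤ w i
      w≤top k = cases (k ≟ j)
        where
        back : ∀ a b → (a ℤ.- b) ℤ.+ b ≡ a
        back = ℤSolver.solve-∀
        cases : Dec (k ≡ j) → w k ℤ.≤ w i
        cases (yes refl) = ℤP.0≤i-j⇒j≤i (subst (0ℤ ℤ.≤_) (sym attained) (ℤ.+≤+ ℕ.z≤n))
        cases (no k≢j) = subst₂ ℤ._≤_ (back (w k) (w j)) (back (w i) (w j))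
          (ℤP.+-monoˡ-≤ (w j) (ℤP.≤-trans (pairs k≢j) (ℤP.≤-reflexive (sym attained))))
      w′≤ : ∀ k → Dec (w k ≡ w i) → w′ k ℤ.≤ ℤ.pred (w i)
      w′≤ k (yes top) = ℤP.≤-reflexive (trans (cong₂ ℤ._+_ top (ε-top k top)) (ℤP.+-comm (w i) -1ℤ))
      w′≤ k (no low) = subst (ℤ._≤ ℤ.pred (w i)) (sym (trans (cong (λ e → w k ℤ.+ e) (ε-low k low)) (ℤP.+-identityʳ (w k))))
        (ℤP.i<j⇒i≤pred[j] (ℤP.≤∧≢⇒< (w≤top k) low))
      -- If `l` was lowered, it now has the largest possible entry and the difference is at most 0.
      -- Otherwise `w l` is unchanged, and the new upper bound w i - 1 on the entries gains the 1.
      lowered : ∀ {k l} → k ≢ l → Dec (w l ≡ w i) → w′ k ℤ.- w′ l ℤ.≤ + r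
      lowered {k} {l} _ (yes top) = ℤP.≤-trans (ℤP.i≤j⇒i-j≤0 (ℤP.≤-trans (w′≤ k (w k ℤ.≟ w i))
        (ℤP.≤-reflexive (sym (trans (cong₂ ℤ._+_ top (ε-top l top)) (ℤP.+-comm (w i) -1ℤ)))))) (ℤ.+≤+ ℕ.z≤n)
      lowered {k} {l} _ (no low) = ℤP.≤-trans (ℤP.+-monoˡ-≤ (ℤ.- w′ l) (w′≤ k (w k ℤ.≟ w i)))
        (subst₂ ℤ._≤_ (trans (lin (w i) (w l)) (cong (λ v → ℤ.pred (w i) ℤ.- v) (sym (trans (cong (λ e → w l ℤ.+ e) (ε-low l low)) (ℤP.+-identityʳ (w l)))))) refl
          (ℤP.+-monoʳ-≤ -1ℤ (pairs {i} {l} λ eq → low (cong w (sym eq)))))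
        where
        lin : ∀ a b → -1ℤ ℤ.+ (a ℤ.- b) ≡ (-1ℤ ℤ.+ a) ℤ.- b
        lin = ℤSolver.solve-∀

  sumZero-step : Descends Diffᶠ V o
  sumZero-step r {x} vx bound = let (w , rep) = integral-differences {x} vx in lower r w rep vx bound

-- Root systems

⟪⟫-+ : ∀ {m} (a b : IVec m) x → ⟪ a +ᵢ b , x ⟫ ≡ ⟪ a , x ⟫ ℚ.+ ⟪ b , x ⟫
⟪⟫-+ [] [] [] = refl
⟪⟫-+ (k ∷ a) (l ∷ b) (q ∷ x) = trans (cong₂ ℚ._+_ (cong (ℚ._* q) (trans (sym (ι≡ (k ℤ.+ l))) (trans (ι-+ k l) (cong₂ ℚ._+_ (ι≡ k) (ι≡ l))))) (⟪⟫-+ a b x))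
  (lin (k / 1) (l / 1) q ⟪ a , x ⟫ ⟪ b , x ⟫)
  where
  lin : ∀ k l q a b → (k ℚ.+ l) ℚ.* q ℚ.+ (a ℚ.+ b) ≡ (k ℚ.* q ℚ.+ a) ℚ.+ (l ℚ.* q ℚ.+ b)
  lin = solve-∀ ℚring

⟪⟫-· : ∀ {m} c (a : IVec m) x → ⟪ c ·ᵢ a , x ⟫ ≡ ι c ℚ.* ⟪ a , x ⟫
⟪⟫-· c [] [] = sym (ℚP.*-zeroʳ (ι c))
⟪⟫-· c (k ∷ a) (q ∷ x) = trans (cong₂ ℚ._+_ (cong (ℚ._* q) (trans (sym (ι≡ (c ℤ.* k))) (trans (ι-* c k) (cong (ι c ℚ.*_) (ι≡ k))))) (⟪⟫-· c a x))
  (lin (ι c) (k / 1) q ⟪ a , x ⟫)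
  where
  lin : ∀ c k q a → (c ℚ.* k) ℚ.* q ℚ.+ c ℚ.* a ≡ c ℚ.* (k ℚ.* q ℚ.+ a)
  lin = solve-∀ ℚring

⟪⟫-zero : ∀ {m} (x : Pt m) → ⟪ zeroᵢ , x ⟫ ≡ 0ℚ
⟪⟫-zero [] = refl
⟪⟫-zero (q ∷ x) = trans (cong₂ ℚ._+_ (ℚP.*-zeroˡ q) (⟪⟫-zero x)) refl

⟪⟫-e : ∀ {m} (i : Fin m) x → ⟪ e i , x ⟫ ≡ lookup x i
⟪⟫-e zero (q ∷ x) = trans (cong₂ ℚ._+_ (ℚP.*-identityˡ q) (vanish x)) (ℚP.+-identityʳ q)
  where
  vanish : ∀ {m} (x : Pt m) → ⟪ tabulate (λ _ → + 0) , x ⟫ ≡ 0ℚ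
  vanish [] = refl
  vanish (q ∷ x) = trans (cong₂ ℚ._+_ (ℚP.*-zeroˡ q) (vanish x)) refl
⟪⟫-e (suc i) (q ∷ x) = trans (cong₂ ℚ._+_ (ℚP.*-zeroˡ q) (⟪⟫-e i x)) (ℚP.+-identityˡ (lookup x i))

⟪⟫-·e : ∀ {m} c (i : Fin m) x → ⟪ c ·ᵢ e i , x ⟫ ≡ ι c ℚ.* lookup x i
⟪⟫-·e c i x = trans (⟪⟫-· c (e i) x) (cong (ι c ℚ.*_) (⟪⟫-e i x))

IsForm : ∀ T n → Form (dim T n) → Set
IsForm A n φ = Diffᶠ φ
IsForm B n φ = Longᶠ φ ⊎ Shortᶠ φ
IsForm C n φ = Longᶠ φ ⊎ Doubleᶠ φ
IsForm D n φ = Longᶠ φ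

Represents : ∀ {m} → Form m → IVec m → Set
Represents φ a = ∀ x → ⟪ a , x ⟫ ≡ val φ x

long-rep : ∀ {m} (s : ℤ) (i : Fin m) t j → Represents (form s i t j) ((s ·ᵢ e i) +ᵢ (t ·ᵢ e j))
long-rep s i t j x = trans (⟪⟫-+ (s ·ᵢ e i) (t ·ᵢ e j) x) (cong₂ ℚ._+_ (⟪⟫-·e s i x) (⟪⟫-·e t j x))

diff-rep : ∀ {m} (i j : Fin m) → Represents (form 1ℤ i -1ℤ j) (e i +ᵢ (-1ℤ ·ᵢ e j))
diff-rep i j x = trans (⟪⟫-+ (e i) (-1ℤ ·ᵢ e j) x) (cong₂ ℚ._+_
  (trans (⟪⟫-e i x) (sym (trans (cong (ℚ._* lookup x i) (ι≡ 1ℤ)) (ℚP.*-identityˡ (lookup x i))))) (⟪⟫-·e -1ℤ j x))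

short-rep : ∀ {m} s (i : Fin m) → Represents (form s i 0ℤ i) (s ·ᵢ e i)
short-rep s i x = trans (⟪⟫-·e s i x) (sym (trans (cong (λ z → ι s ℚ.* lookup x i ℚ.+ z) (trans (cong (ℚ._* lookup x i) (ι≡ 0ℤ)) (ℚP.*-zeroˡ (lookup x i)))) (ℚP.+-identityʳ _)))

double-rep : ∀ {m} s (i : Fin m) → Represents (form s i s i) ((s ℤ.* + 2) ·ᵢ e i)
double-rep s i x = trans (⟪⟫-·e (s ℤ.* + 2) i x) (trans (cong (ℚ._* lookup x i) (trans (cong ι (lin s)) (ι-+ s s))) (ℚP.*-distribʳ-+ (lookup x i) (ι s) (ι s)))
  where
  lin : ∀ s → s ℤ.* + 2 ≡ s ℤ.+ s
  lin = ℤSolver.solve-∀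

root⇒form : ∀ T n {a} → IsRoot T n a → ∃ λ φ → IsForm T n φ × Represents φ a
root⇒form A n (i , j , i≢j , refl) = _ , (i≢j , refl , refl) , diff-rep i j
root⇒form B n (inj₁ (i , j , i≢j , s , t , ss , st , refl)) = _ , inj₁ (i≢j , ss , st) , long-rep s i t j
root⇒form B n (inj₂ (i , s , ss , refl)) = _ , inj₂ (refl , ss , refl) , short-rep s i
root⇒form C n (inj₁ (i , j , i≢j , s , t , ss , st , refl)) = _ , inj₁ (i≢j , ss , st) , long-rep s i t j
root⇒form C n (inj₂ (i , s , ss , refl)) = _ , inj₂ (refl , ss , refl) , double-rep s i
root⇒form D n (i , j , i≢j , s , t , ss , st , refl) = _ , (i≢j , ss , st) , long-rep s i t j

form⇒root : ∀ T n φ → IsForm T n φ → ∃ λ a → IsRoot T n a × Represents φ a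
form⇒root A n (form _ i _ j) (i≢j , refl , refl) = _ , (i , j , i≢j , refl) , diff-rep i j
form⇒root B n (form s i t j) (inj₁ (i≢j , ss , st)) = _ , inj₁ (i , j , i≢j , s , t , ss , st , refl) , long-rep s i t j
form⇒root B n (form s i _ _) (inj₂ (refl , ss , refl)) = _ , inj₂ (i , s , ss , refl) , short-rep s i
form⇒root C n (form s i t j) (inj₁ (i≢j , ss , st)) = _ , inj₁ (i , j , i≢j , s , t , ss , st , refl) , long-rep s i t j
form⇒root C n (form s i _ _) (inj₂ (refl , ss , refl)) = _ , inj₂ (i , s , ss , refl) , double-rep s i
form⇒root D n (form s i t j) (i≢j , ss , st) = _ , (i , j , i≢j , s , t , ss , st , refl) , long-rep s i t j

negate : ∀ {m} → Form m → Form m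
negate (form s i t j) = form (ℤ.- s) i (ℤ.- t) j

val-negate : ∀ {m} (φ : Form m) x → val (negate φ) x ≡ ℚ.- val φ x
val-negate (form s i t j) x = trans (cong₂ (λ u v → u ℚ.* lookup x i ℚ.+ v ℚ.* lookup x j) (ι-neg s) (ι-neg t)) (lin (ι s) (ι t) (lookup x i) (lookup x j))
  where
  lin : ∀ s t a b → (ℚ.- s) ℚ.* a ℚ.+ (ℚ.- t) ℚ.* b ≡ ℚ.- (s ℚ.* a ℚ.+ t ℚ.* b)
  lin = solve-∀ ℚring

-- In type A the coefficients are normalised to 1 and -1, so negation has to exchange the indices
-- instead of the signs.
opposite : ∀ T n φ → IsForm T n φ → ∃ λ ψ → IsForm T n ψ × (∀ x → val ψ x ≡ ℚ.- val φ x)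
opposite A n φ@(form _ i _ j) (i≢j , refl , refl) = form 1ℤ j -1ℤ i , ((λ eq → i≢j (sym eq)) , refl , refl) ,
  λ x → trans (ℚP.+-comm (ι 1ℤ ℚ.* lookup x j) (ι -1ℤ ℚ.* lookup x i)) (val-negate φ x)
opposite B n φ (inj₁ (i≢j , ss , st)) = negate φ , inj₁ (i≢j , sign-neg ss , sign-neg st) , val-negate φ
opposite B n φ (inj₂ (i≡j , ss , t≡0)) = negate φ , inj₂ (i≡j , sign-neg ss , cong ℤ.-_ t≡0) , val-negate φ
opposite C n φ (inj₁ (i≢j , ss , st)) = negate φ , inj₁ (i≢j , sign-neg ss , sign-neg st) , val-negate φ
opposite C n φ (inj₂ (i≡j , ss , t≡s)) = negate φ , inj₂ (i≡j , sign-neg ss , cong ℤ.-_ t≡s) , val-negate φ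
opposite D n φ (i≢j , ss , st) = negate φ , (i≢j , sign-neg ss , sign-neg st) , val-negate φ

-- Translating between roots and forms

sameSide-subst : ∀ {κ κ′ α α′ β β′} → κ ≡ κ′ → α ≡ α′ → β ≡ β′ → SameSide κ α β → SameSide κ′ α′ β′
sameSide-subst refl refl refl same = same

module _ {T : CType} {n : ℕ} where

  private
    F = IsForm T n
    V = InV T n

  sameFacet⇒ : ∀ {x y} → SameFacet T n x y → SameFacetᶠ F x y
  sameFacet⇒ {x} {y} same φ Fφ k = let (a , root , rep) = form⇒root T n φ Fφ in
    sameSide-subst (sym (ι≡ k)) (rep x) (rep y) (same a root k)

  sameFacet⇐ : ∀ {x y} → SameFacetᶠ F x y → SameFacet T n x y
  sameFacet⇐ {x} {y} same a root k = let (φ , Fφ , rep) = root⇒form T n root in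
    sameSide-subst (ι≡ k) (sym (rep x)) (sym (rep y)) (same φ Fφ k)

  vertex⇒ : ∀ {x} → Vertex T n x → Vertexᶠ F V x
  vertex⇒ {x} (Vx , unique) = Vx , λ z Vz same → unique z Vz (sameFacet⇐ {x} {z} same)

  vertex⇐ : ∀ {x} → Vertexᶠ F V x → Vertex T n x
  vertex⇐ {x} (Vx , unique) = Vx , λ z Vz same → unique z Vz (sameFacet⇒ {x} {z} same)

  adjacent⇒ : ∀ {x y} → Adjacent T n x y → Adjacentᶠ F V x y
  adjacent⇒ {x} {y} (vx , vy , x≢y , same , line) = vertex⇒ vx , vertex⇒ vy , x≢y ,
    (λ t 0<t t<1 → sameFacet⇒ {seg x y t} {seg x y ½} (same t 0<t t<1)) ,
    λ z Vz facet → line z Vz (sameFacet⇐ {z} {seg x y ½} facet)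

  adjacent⇐ : ∀ {x y} → Adjacentᶠ F V x y → Adjacent T n x y
  adjacent⇐ {x} {y} (vx , vy , x≢y , same , line) = vertex⇐ vx , vertex⇐ vy , x≢y ,
    (λ t 0<t t<1 → sameFacet⇐ {seg x y t} {seg x y ½} (same t 0<t t<1)) ,
    λ z Vz facet → line z Vz (sameFacet⇒ {z} {seg x y ½} facet)

another : ∀ {n} → 2 ℕ.≤ n → (i : Fin n) → ∃ λ j → j ≢ i
another (ℕ.s≤s (ℕ.s≤s _)) zero = suc zero , λ ()
another (ℕ.s≤s (ℕ.s≤s _)) (suc i) = zero , λ ()

a-third : ∀ {n} → 3 ℕ.≤ n → (i j : Fin n) → i ≢ j → ∃ λ k → k ≢ i × k ≢ j
a-third (ℕ.s≤s (ℕ.s≤s (ℕ.s≤s _))) zero zero i≢j = contradiction refl i≢j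
a-third (ℕ.s≤s (ℕ.s≤s (ℕ.s≤s _))) zero (suc zero) _ = suc (suc zero) , (λ ()) , λ ()
a-third (ℕ.s≤s (ℕ.s≤s (ℕ.s≤s _))) zero (suc (suc j)) _ = suc zero , (λ ()) , λ ()
a-third (ℕ.s≤s (ℕ.s≤s (ℕ.s≤s _))) (suc zero) zero _ = suc (suc zero) , (λ ()) , λ ()
a-third (ℕ.s≤s (ℕ.s≤s (ℕ.s≤s _))) (suc (suc i)) zero _ = suc zero , (λ ()) , λ ()
a-third (ℕ.s≤s (ℕ.s≤s (ℕ.s≤s _))) (suc i) (suc j) _ = zero , (λ ()) , λ ()

Separates : ∀ {m} (F : Form m → Set) (V : Pt m → Set) → Set
Separates F V = ∀ {x y} → V x → V y → (∀ φ → F φ → val φ x ≡ val φ y) → x ≡ y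

lattice : ∀ {T n o} → Special T n o → ∀ φ → IsForm T n φ → ∃ λ K → val φ o ≡ ι K
lattice {T} {n} {o} (_ , integral) φ Fφ =
  let (a , root , rep) = form⇒root T n φ Fφ ; (K , eq) = integral a root
  in K , trans (sym (rep o)) (trans eq (sym (ι≡ K)))

-- Types B, C and D differ in the roots supported on one coordinate: in B such a root is integral
-- exactly where `w i` is even, in C at every half-integral point, and in D there is none.
geometry : ∀ T n → Valid T n → ∀ o → Special T n o → Separates (IsForm T n) (InV T n) × Descends (IsForm T n) (InV T n) o
geometry A n _ o special = (λ {x} {y} → S.separated {x} {y}) , λ r {x} → S.sumZero-step r {x}
  where module S = SumZero {n} o (proj₁ (proj₁ special)) (lattice {A} special)
geometry B n 3≤n o special = (λ {x} {y} → S.separated {x} {y}) , λ r {x} → S.simple-step (λ Fφ → Fφ) (a-third 3≤n) r {x}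
  where
  shape : ∀ {φ} → IsForm B n φ → Longᶠ φ ⊎ (Shortᶠ φ ⊎ Doubleᶠ φ)
  shape (inj₁ l) = inj₁ l
  shape (inj₂ s) = inj₂ (inj₁ s)
  own : ∀ (w : Fin n → ℤ) i → Dec (+ 2 ∣ w i) → (∃ λ t → IsForm B n (form 1ℤ i t i) × (t ≡ 0ℤ ⊎ t ≡ 1ℤ) × + 2 ∣ evℤ (form 1ℤ i t i) w) ⊎
    (∀ s t → IsForm B n (form s i t i) → ¬ + 2 ∣ evℤ (form s i t i) w)
  own w i (yes 2∣) = inj₁ (0ℤ , inj₂ (refl , inj₁ refl , refl) , inj₁ refl , ∣m∣n⇒∣m+n (∣n⇒∣m*n 1ℤ 2∣) (∣n⇒∣m*n 0ℤ 2∣))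
  own w i (no 2∤) = inj₂ λ { s t (inj₁ (i≢i , _)) _ → i≢i refl
    ; s t (inj₂ (_ , ss , refl)) 2∣ → 2∤ (∣-sign {+ 2} {s} ss (subst (+ 2 ∣_) (ℤP.+-identityʳ (s ℤ.* w i)) 2∣)) }
  module S = HalfLattice {n} (another (ℕP.≤-trans (ℕP.n≤1+n 2) 3≤n)) (IsForm B n) inj₁ shape (λ w i → own w i (+ 2 ∣? w i)) o (lattice {B} special)
geometry C n 2≤n o special = (λ {x} {y} → S.separated {x} {y}) , λ r {x} → S.double-step inj₂ r {x}
  where
  shape : ∀ {φ} → IsForm C n φ → Longᶠ φ ⊎ (Shortᶠ φ ⊎ Doubleᶠ φ)
  shape (inj₁ l) = inj₁ l
  shape (inj₂ d) = inj₂ (inj₂ d)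
  module S = HalfLattice {n} (another 2≤n) (IsForm C n) inj₁ shape
    (λ w i → inj₁ (1ℤ , inj₂ (refl , inj₁ refl , refl) , inj₂ refl , same-parity⇒2∣ev {w = w} {1ℤ} {1ℤ} {i} {i} (inj₁ refl) (inj₁ refl) refl)) o (lattice {C} special)
geometry D n 4≤n o special = (λ {x} {y} → S.separated {x} {y}) , λ r {x} → S.simple-step inj₁ (a-third (ℕP.≤-trans (ℕP.n≤1+n 3) 4≤n)) r {x}
  where
  own : ∀ (w : Fin n → ℤ) i → (∃ λ t → IsForm D n (form 1ℤ i t i) × (t ≡ 0ℤ ⊎ t ≡ 1ℤ) × + 2 ∣ evℤ (form 1ℤ i t i) w) ⊎
    (∀ s t → IsForm D n (form s i t i) → ¬ + 2 ∣ evℤ (form s i t i) w)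
  own w i = inj₂ λ s t long _ → proj₁ long refl
  module S = HalfLattice {n} (another (ℕP.≤-trans (ℕ.s≤s (ℕ.s≤s ℕ.z≤n)) 4≤n)) (IsForm D n) (λ l → l) inj₁ own o (lattice {D} special)

-- Distance and root values

walk⇒val≤ : ∀ {T n x z k φ} → IsForm T n φ → Walk T n x z k → val φ x ℚ.- val φ z ℚ.≤ ι (+ k)
walk⇒val≤ {x = x} {φ = φ} Fφ here = ℚP.≤-reflexive (trans (ℚP.+-inverseʳ (val φ x)) (sym (ι≡ 0ℤ)))
walk⇒val≤ {T} {n} {x} {z} {suc k} {φ} Fφ (step {y = y} adj walk) = subst₂ ℚ._≤_ (tele (val φ x) (val φ y) (val φ z))
  (trans (cong (ℚ._+ ι (+ k)) (sym (ι≡ 1ℤ))) (sym (ι-+ 1ℤ (+ k))))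
  (ℚP.+-mono-≤ (adjacent-val-≤1 {x = x} {y} {φ} (adjacent⇒ adj) Fφ) (walk⇒val≤ {T} {n} {y} {z} {k} {φ} Fφ walk))
  where
  tele : ∀ a b c → (a ℚ.- b) ℚ.+ (b ℚ.- c) ≡ a ℚ.- c
  tele = solve-∀ ℚring

bounded⇒near : ∀ {T n o} → Separates (IsForm T n) (InV T n) → Descends (IsForm T n) (InV T n) o → InV T n o →
  ∀ r {x} → Vertexᶠ (IsForm T n) (InV T n) x → (∀ φ → IsForm T n φ → val φ x ℚ.- val φ o ℚ.≤ ι (+ r)) → Dist≤ T n x o r
bounded⇒near {T} {n} {o} separates descends Vo zero {x} vx bound = 0 , ℕ.z≤n , subst (λ z → Walk T n x z 0) (separates (proj₁ vx) Vo equal) here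
  where
  -- The bound 0 for a root and for its opposite leaves only the value at `o`.
  equal : ∀ φ → IsForm T n φ → val φ x ≡ val φ o
  equal φ Fφ = let (ψ , Fψ , neg) = opposite T n φ Fφ in ℚP.≤-antisym (drop (bound φ Fφ))
    (drop (subst (ℚ._≤ ι 0ℤ) (trans (cong₂ ℚ._-_ (neg x) (neg o)) (lin (val φ x) (val φ o))) (bound ψ Fψ)))
    where
    lin : ∀ a b → (ℚ.- a) ℚ.- (ℚ.- b) ≡ b ℚ.- a
    lin = solve-∀ ℚring
    lin′ : ∀ a b → b ℚ.- a ≡ 0ℚ ℚ.- (a ℚ.- b)
    lin′ = solve-∀ ℚring
    drop : ∀ {a b} → a ℚ.- b ℚ.≤ ι 0ℤ → a ℚ.≤ b
    drop {a} {b} le = x≤y-if (subst (0ℚ ℚ.≤_) (sym (lin′ a b)) (0≤y-x (subst (a ℚ.- b ℚ.≤_) (ι≡ 0ℤ) le)))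
bounded⇒near {T} {n} {o} separates descends Vo (suc r) {x} vx bound = let (y , vy , near , bound′) = descends r {x} vx bound in
  extend near (bounded⇒near {T} {n} {o} separates descends Vo r {y} vy bound′)
  where
  extend : ∀ {y} → x ≡ y ⊎ Adjacentᶠ (IsForm T n) (InV T n) x y → Dist≤ T n y o r → Dist≤ T n x o (suc r)
  extend (inj₁ refl) (k , k≤r , walk) = k , ℕP.m≤n⇒m≤1+n k≤r , walk
  extend (inj₂ adj) (k , k≤r , walk) = suc k , ℕ.s≤s k≤r , step (adjacent⇐ adj) walk

highest-dominates : ∀ {T n v a0 o x b} → Highest T n v a0 → InClosedSector T n o v x → IsRoot T n b → ⟪ b , x -ₚ o ⟫ ℚ.≤ ⟪ a0 , x -ₚ o ⟫
highest-dominates {T} {n} {v} {a0} {o} {x} {b} (_ , dominates) (_ , positive) root = let (l , simples , eq) = dominates b root in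
  subst₂ ℚ._≤_ (ℚP.+-identityʳ _) (sym (trans (cong (λ a → ⟪ a , x -ₚ o ⟫) eq) (⟪⟫-+ b (sumᵢ l) (x -ₚ o))))
    (ℚP.+-monoʳ-≤ ⟪ b , x -ₚ o ⟫ (nonneg simples))
  where
  nonneg : ∀ {l} → All (Simple T n v) l → 0ℚ ℚ.≤ ⟪ sumᵢ l , x -ₚ o ⟫
  nonneg [] = ℚP.≤-reflexive (sym (⟪⟫-zero (x -ₚ o)))
  nonneg {a ∷ l} (simple ∷ simples) = subst (0ℚ ℚ.≤_) (sym (⟪⟫-+ a (sumᵢ l) (x -ₚ o))) (ℚP.+-mono-≤ (positive a (proj₁ simple)) (nonneg simples))

theorem1p4 : (T : CType) (n : ℕ) → Valid T n →
    (o : Pt (dim T n)) → Special T n o →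
    (v : Pt (dim T n)) → Regular T n v →
    (a0 : IVec (dim T n)) → Highest T n v a0 →
    (x : Pt (dim T n)) → Vertex T n x → InClosedSector T n o v x →
    (r : ℕ) →
    (Dist≤ T n x o r ⇔ (⟪ a0 , x -ₚ o ⟫ ≤ (+ r) / 1))
theorem1p4 T n valid o special v regular a0 highest x vertex sector r = mk⇔ far near
  where
  far : Dist≤ T n x o r → ⟪ a0 , x -ₚ o ⟫ ≤ (+ r) / 1
  far (k , k≤r , walk) = let (φ , Fφ , rep) = root⇒form T n (proj₁ highest) in
    subst₂ _≤_ (sym (trans (rep (x -ₚ o)) (val-- φ x o))) (ι≡ (+ r))
      (ℚP.≤-trans (walk⇒val≤ {T} {n} {x} {o} {k} {φ} Fφ walk) (ι-mono-≤ (ℤ.+≤+ k≤r)))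
  near : ⟪ a0 , x -ₚ o ⟫ ≤ (+ r) / 1 → Dist≤ T n x o r
  near le = bounded⇒near {T} {n} {o} (proj₁ (geometry T n valid o special)) (proj₂ (geometry T n valid o special)) (proj₁ (proj₁ special)) r {x} (vertex⇒ vertex)
    λ φ Fφ → let (b , root , rep) = form⇒root T n φ Fφ in
      subst₂ _≤_ (trans (rep (x -ₚ o)) (val-- φ x o)) (sym (ι≡ (+ r)))
        (ℚP.≤-trans (highest-dominates {T} {n} {v} {a0} {o} {x} {b} highest sector root) le)
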